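{- For all $j,f\ge0$, $$F_{j,f}(t)=\sum_{k\ge0}\gamma_{j,f,k}\,t^k(1+t)^{2j+f-2k},$$ where $$\gamma_{j,f,k}=\sum_{r=0}^{f}A_{j,k,r}\binom fr,\qquad A_{j,k,r}\in\mathbb N.$$ Consequently, for every $n\ge0$ there exist polynomials $C_{n,k}(p)\in\mathbb N[p]$ such that $$\mathcal F_n(p,t)=\sum_{k=0}^{\lfloor n/2\rfloor}C_{n,k}(p)\,t^k(1+t)^{n-2k}.$$
   Context: $\mathbb N=\{0,1,2,\dots\}$. For $n\ge1$, $\mathfrak B_n$ is the hyperoctahedral group of signed permutations: words $\pi=\pi_1\cdots\pi_n$ of nonzero integers such that $|\pi_1|,\dots,|\pi_n|$ is a permutation of $[n]=\{1,\dots,n\}$, with $\pi(i)=\pi_i$, $\pi(-i)=-\pi(i)$. $\mathcal I_n^B$ is the set of $\pi\in\mathfrak B_n$ with $\pi^2=\mathrm{id}$ (for $n=0$, a single empty involution). With $\pi_0=0$ and the usual order on $\mathbb Z$, $\operatorname{des}^B(\pi)=\#\{0\le i\le n-1:\pi_i>\pi_{i+1}\}$. $\operatorname{fix}_B(\pi)=\#\{i\in[n]:|\pi(i)|=i\}$, and $\operatorname{cyc}_2(\pi)$ is the number of two-cycles of the ordinary involution $i\mapsto|\pi(i)|$ of $[n]$. $$\mathcal F_n(p,t)=\sum_{\pi\in\mathcal I_n^B}p^{\operatorname{fix}_B(\pi)}t^{\operatorname{des}^B(\pi)},\qquad F_{j,f}(t)=\sum_{\substack{\pi\in\mathcal I_{2j+f}^B\\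 \operatorname{cyc}_2(\pi)=j,\ \operatorname{fix}_B(\pi)=f}}t^{\operatorname{des}^B(\pi)}.$$ Let $J_{2j}^B(t)=F_{j,0}(t)$ and let $P_j(x)=\sum_{s=0}^jD_{2j,s}x^s$ be the unique polynomial with $J_{2j}^B(t)=(1+t)^{2j}P_j\!\left(\frac{t}{(1+t)^2}\right)$. The following is a known theorem of Wan, Gao, Li and Yang taken as given: $P_j$ exists and $D_{2j,s}\in\mathbb N$. The numbers $A_{j,k,r}$ are the coefficients of $x^k$ in the polynomials $A_{j,r}(x)=\sum_kA_{j,k,r}x^k$ defined by $$\sum_{r\ge0}A_{j,r}(x)W^r=(1+4xW)^{2j}\,P_j\!\left(\frac{x(1+2W+4xW^2)}{(1+4xW)^2}\right).$$ -}

module Defs where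

open import Algebra.Bundles.Raw using (RawRing)
import Algebra.Definitions.RawSemiring as RawSemiringDefinitions
open import Data.Fin.Base as Fin using (Fin; toℕ; inject₁)
import Data.Fin.Properties as Fin
open import Data.Integer.Base as ℤ using (ℤ; +_; _◃_)
import Data.Integer.Properties as ℤ
open import Data.List.Base as List
  using (List; []; _∷_; allFin; cartesianProduct; cartesianProductWith; filter; length)
open import Data.Nat.Base as ℕ using (ℕ; zero; suc; ⌊_/2⌋; _∸_)
open import Data.Nat.Combinatorics using (_C_)
import Data.Nat.Properties as ℕ
open import Data.Product.Base using (_×_; _,_; proj₂)
import Data.Product.Properties as Product
open import Data.Sign.Base as Sign using (Sign)
import Data.Sign.Properties as Sign
open import Data.Vec.Base as Vec using (Vec; []; _∷_; lookup)
open import Level using (0ℓ)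
open import Function.Base using (_∘_)
open import Function.Definitions using (Bijective; Injective; Surjective; StrictlySurjective)
open import Relation.Binary.PropositionalEquality using (_≡_; refl; trans; cong)
open import Relation.Nullary.Decidable using (Dec; map′; _×-dec_; _→-dec_)
open import Relation.Unary using (Decidable)

module Ops {c ℓ} (R : RawRing c ℓ) where
  open RawRing R public
  -- n · x is the n-fold sum x + ⋯ + x.
  open RawSemiringDefinitions rawSemiring public
    using (_^_; sum) renaming (_×_ to _·_)

  -- ∑≤ m f = f 0 + ⋯ + f m
  ∑≤ : ℕ → (ℕ → Carrier) → Carrier
  ∑≤ m f = sum {suc m} (f ∘ toℕ)

  ∑ : ∀ {a} {A : Set a} → List A → (A → Carrier) → Carrier
  ∑ xs f = List.foldr _+_ 0# (List.map f xs)

infix 4 ≈-in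
≈-in : ∀ {c ℓ} (R : RawRing c ℓ) → RawRing.Carrier R → RawRing.Carrier R → Set ℓ
≈-in R = RawRing._≈_ R

syntax ≈-in R x y = x ≈[ R ] y

-- Lists of coefficients, constant term first; trailing zeros are
-- immaterial because equality compares coefficients.
module Polynomial {c ℓ} (R : RawRing c ℓ) where
  open RawRing R

  coeff : List Carrier → ℕ → Carrier
  coeff []      _       = 0#
  coeff (a ∷ p) zero    = a
  coeff (a ∷ p) (suc n) = coeff p n

  add : List Carrier → List Carrier → List Carrier
  add []      q       = q
  add (a ∷ p) []      = a ∷ p
  add (a ∷ p) (b ∷ q) = (a + b) ∷ add p q

  mul : List Carrier → List Carrier → List Carrier
  mul []      q = []
  mul (a ∷ p) q = add (List.map (a *_) q) (0# ∷ mul p q)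

  polyRing : RawRing c ℓ
  polyRing = record
    { Carrier = List Carrier
    ; _≈_     = λ p q → ∀ n → coeff p n ≈ coeff q n
    ; _+_     = add
    ; _*_     = mul
    ; -_      = List.map (-_)
    ; 0#      = []
    ; 1#      = 1# ∷ []
    }

  const : Carrier → List Carrier
  const a = a ∷ []

  X : List Carrier
  X = 0# ∷ 1# ∷ []

module PowerSeries {c ℓ} (R : RawRing c ℓ) where
  open Ops R

  seriesRing : RawRing c ℓ
  seriesRing = record
    { Carrier = ℕ → Carrier
    ; _≈_     = λ f g → ∀ n → f n ≈ g n
    ; _+_     = λ f g n → f n + g n
    ; _*_     = λ f g n → ∑≤ n (λ i → f i * g (n ∸ i))
    ; -_      = λ f n → - f n
    ; 0#      = λ _ → 0#
    ; 1#      = Polynomial.coeff R (1# ∷ [])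
    }

  1+_X : Carrier → (ℕ → Carrier)
  1+ a X = Polynomial.coeff R (1# ∷ a ∷ [])

  -- The inverse of 1+ a X, as a geometric series.
  1/1+_X : Carrier → (ℕ → Carrier)
  1/1+ a X n = (- a) ^ n

ℤ-ring ℤ[t] ℤ[p] ℤ[x] ℤ[p][t] ℤ⟦t⟧ ℤ[x]⟦W⟧ : RawRing 0ℓ 0ℓ
ℤ-ring  = ℤ.+-*-rawRing
ℤ[t]    = Polynomial.polyRing ℤ-ring
ℤ[p]    = Polynomial.polyRing ℤ-ring
ℤ[x]    = Polynomial.polyRing ℤ-ring
ℤ[p][t] = Polynomial.polyRing ℤ[p]
ℤ⟦t⟧    = PowerSeries.seriesRing ℤ-ring
ℤ[x]⟦W⟧ = PowerSeries.seriesRing ℤ[x]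

-- (s , i) stands for the nonzero integer s (i + 1), as Fin n counts from 0.
±[_] : ℕ → Set
±[ n ] = Sign × Fin n

value : ∀ {n} → ±[ n ] → ℤ
value (s , i) = s ◃ suc (toℕ i)

Word : ℕ → Set
Word n = Vec ±[ n ] n

abs : ∀ {n} → Word n → Fin n → Fin n
abs π i = proj₂ (lookup π i)

IsSignedPermutation : ∀ {n} → Word n → Set
IsSignedPermutation π = Bijective _≡_ _≡_ (abs π)

-- The extension of π to negative arguments by π(-i) = -π(i).
apply : ∀ {n} → Word n → ±[ n ] → ±[ n ]
apply π (s , i) with s′ , k ← lookup π i = s Sign.* s′ , k

IsInvolution : ∀ {n} → Word n → Set
IsInvolution π = ∀ a → apply π (apply π a) ≡ a

isSignedPermutation? : ∀ {n} → Decidable (IsSignedPermutation {n})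
isSignedPermutation? π = injective? ×-dec surjective?
  where
  injective? : Dec (Injective _≡_ _≡_ (abs π))
  injective? = map′ (λ h {x} {y} → h x y) (λ h x y → h)
    (Fin.all? λ x → Fin.all? λ y → (abs π x Fin.≟ abs π y) →-dec (x Fin.≟ y))

  strictly : StrictlySurjective _≡_ (abs π) → Surjective _≡_ _≡_ (abs π)
  strictly h y = let x , eq = h y in x , λ z≡x → trans (cong (abs π) z≡x) eq

  surjective? : Dec (Surjective _≡_ _≡_ (abs π))
  surjective? = map′ strictly (λ h y → let x , eq = h y in x , eq refl)
    (Fin.all? λ y → Fin.any? λ x → abs π x Fin.≟ y)

isInvolution? : ∀ {n} → Decidable (IsInvolution {n})
isInvolution? π = map′
  (λ { (h₊ , h₋) (Sign.+ , i) → h₊ i ; (h₊ , h₋) (Sign.- , i) → h₋ i })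
  (λ h → (λ i → h (Sign.+ , i)) , (λ i → h (Sign.- , i)))
  (Fin.all? (λ i → fixes? (Sign.+ , i)) ×-dec Fin.all? (λ i → fixes? (Sign.- , i)))
  where
  fixes? : ∀ a → Dec (apply π (apply π a) ≡ a)
  fixes? a = Product.≡-dec Sign._≟_ Fin._≟_ (apply π (apply π a)) a

vectors : ∀ {A : Set} → List A → (m : ℕ) → List (Vec A m)
vectors as zero    = [] ∷ []
vectors as (suc m) = cartesianProductWith _∷_ as (vectors as m)

words : ∀ n → List (Word n)
words n = vectors (cartesianProduct (Sign.+ ∷ Sign.- ∷ []) (allFin n)) n

-- 𝓘 n lists each involution of the hyperoctahedral group 𝔅ₙ exactly once.
𝓘 : ∀ n → List (Word n)
𝓘 n = filter (λ π → isSignedPermutation? π ×-dec isInvolution? π) (words n)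

count : ∀ {A : Set} {P : A → Set} → Decidable P → List A → ℕ
count P? = length ∘ filter P?

des : ∀ {n} → Word n → ℕ
des {n} π = count (λ i → π₀ (Fin.suc i) ℤ.<? π₀ (inject₁ i)) (allFin n)
  where
  -- The word with π₀ = 0 put in front.
  π₀ : Fin (suc n) → ℤ
  π₀ = lookup (+ 0 ∷ Vec.map value π)

fix : ∀ {n} → Word n → ℕ
fix {n} π = count (λ i → abs π i Fin.≟ i) (allFin n)

-- A two-cycle is counted once, as the pair (i , j) with i < j.
cyc₂ : ∀ {n} → Word n → ℕ
cyc₂ {n} π = count
  (λ (i , j) → (i Fin.<? j) ×-dec (abs π i Fin.≟ j) ×-dec (abs π j Fin.≟ i))
  (cartesianProduct (allFin n) (allFin n))

𝓕 : ℕ → RawRing.Carrier ℤ[p][t]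
𝓕 n = ∑ (𝓘 n) (λ π → const (p ^ₚ fix π) * t ^ des π)
  where
  open Ops ℤ[p][t]
  open Ops ℤ[p] using () renaming (_^_ to _^ₚ_)
  open Polynomial ℤ[p] using (const) renaming (X to t)
  open Polynomial ℤ-ring using () renaming (X to p)

F : ℕ → ℕ → RawRing.Carrier ℤ[t]
F j f = ∑ (filter (λ π → (cyc₂ π ℕ.≟ j) ×-dec (fix π ℕ.≟ f)) (𝓘 (2 ℕ.* j ℕ.+ f)))
          (λ π → t ^ des π)
  where
  open Ops ℤ[t]
  open Polynomial ℤ-ring using () renaming (X to t)

Jᴮ : ℕ → RawRing.Carrier ℤ[t]
Jᴮ j = F j 0

-- D j s is the number written D_{2j,s}, and P D j u is the value at u of
-- the polynomial Pⱼ.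
module _ {c ℓ} (R : RawRing c ℓ) where
  open Ops R

  P : (ℕ → ℕ → ℕ) → ℕ → Carrier → Carrier
  P D j u = ∑≤ j (λ s → D j s · u ^ s)

-- J_{2j}(t) = F_{j,0}(t) = (1+t)^{2j} Pⱼ(t/(1+t)²) for all j, as an identity in ℤ⟦t⟧.
IsGammaVector : (ℕ → ℕ → ℕ) → Set
IsGammaVector D = ∀ j →
  coeff (Jᴮ j) ≈ (1+ 1ℤ X) ^ (2 ℕ.* j) * P ℤ⟦t⟧ D j (t * (1/1+ 1ℤ X) ^ 2)
  where
  open Ops ℤ⟦t⟧
  open PowerSeries ℤ-ring using (1+_X; 1/1+_X)
  open Polynomial ℤ-ring using (coeff; X)
  1ℤ = + 1
  t = coeff X

A-series : (ℕ → ℕ → ℕ) → ℕ → RawRing.Carrier ℤ[x]⟦W⟧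
A-series D j = (1+ 4x X) ^ (2 ℕ.* j)
  * P ℤ[x]⟦W⟧ D j (x * (1# + 2 · W + 4 · (x * W ^ 2)) * (1/1+ 4x X) ^ 2)
  where
  open Ops ℤ[x]⟦W⟧
  open PowerSeries ℤ[x] using (1+_X; 1/1+_X)
  open Polynomial ℤ[x] using (coeff; const) renaming (X to X-W)
  open Polynomial ℤ-ring using () renaming (X to X-x)
  W = coeff X-W
  x = coeff (const X-x)
  4x = Ops._·_ ℤ[x] 4 X-x

-- A D j k r is the coefficient of xᵏ in the coefficient of Wʳ.
A : (ℕ → ℕ → ℕ) → ℕ → ℕ → ℕ → ℤ
A D j k r = Polynomial.coeff ℤ-ring (A-series D j r) k

γ : (ℕ → ℕ → ℕ) → ℕ → ℕ → ℕ → ℤ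
γ D j f k = Ops.∑≤ ℤ-ring f (λ r → A D j k r ℤ.* + (f C r))

-- The sum of g(k) tᵏ (1+t)^{n-2k} over 0 ≤ k ≤ ⌊n/2⌋.
module _ {c ℓ} (R : RawRing c ℓ) where
  open RawRing R using (Carrier)
  open Polynomial R using (polyRing; const) renaming (X to t)
  open Ops polyRing using (∑≤; _^_; _*_; _+_; 1#)

  gammaExpansion : ℕ → (ℕ → Carrier) → RawRing.Carrier polyRing
  gammaExpansion n g =
    ∑≤ ⌊ n /2⌋ (λ k → const (g k) * t ^ k * (1# + t) ^ (n ∸ 2 ℕ.* k))

{-# OPTIONS --safe #-}
module Submission where

-- Fix an involution σ of 2j letters without fixed points and insert f
-- signed fixed points into it. Whether two neighbouring letters form a
-- descent depends only on whether each of them is fixed, below its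
-- position in absolute value, above it, or below minus it, except for two
-- letters of the same kind, which keep their order in σ. The generating
-- functions of the 2j+1 gaps of σ therefore telescope: with u = 1+t and
-- d = des σ, the insertions contribute
--   ∑_f z^f ∑ t^des = t^d α^{2j-d} β^d / (1-uz)^{2j+1},
--   α = 1-(1-t)z,  β = 1+(1-t)z.
-- In terms of Z = z/(1-uz) this is (1-uz)⁻¹ a^{2j-d} b^d with a = 1+2tZ and
-- b = t(1+2Z), so that summing over σ homogenizes J_{2j} at (a , b):
--   ∑_f F_{j,f} z^f = (1-uz)⁻¹ ∑_s D_{2j,s} (ab)^s (a+b)^{2j-2s}.
-- For x = t/u² and W = uZ one has ab = u²x(1+2W+4xW²), a+b = u(1+4xW) and
-- (1-uz)⁻¹ W^r = ∑_f C(f,r) (uz)^f, which gives the expansion of F_{j,f}.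

open import Defs
open import Data.Integer.Base using (ℤ; +_)
open import Data.List.Base using (List; map)
open import Data.Nat.Base using (ℕ)
open import Data.Product.Base using (_×_; Σ-syntax)
open import Relation.Binary.PropositionalEquality using (_≡_)

open import Algebra.Bundles using (CommutativeRing; RawRing)
import Algebra.Morphism.Construct.Composition as Composition
import Algebra.Morphism.RingMonomorphism as RingMonomorphism
open import Algebra.Morphism.Structures using (IsSemiringHomomorphism; IsRingMonomorphism)
import Algebra.Properties.CommutativeSemigroup as CSG
import Algebra.Properties.CommutativeSemiring.Exp as CommutativeExp
import Algebra.Properties.Group as GroupProperties
import Algebra.Properties.Ring as RingProperties
import Algebra.Properties.Semiring.Exp as Exp
import Algebra.Properties.Semiring.Mult as Mult
import Algebra.Properties.Semiring.Sum as Sum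
import Algebra.Solver.Ring.NaturalCoefficients.Default as Solver
open import Algebra.Structures using (IsCommutativeRing)
open import Data.Bool.Base using (Bool; true; false; if_then_else_)
open import Data.Fin.Base as Fin using (Fin; toℕ; fromℕ<; inject₁; punchIn; punchOut)
import Data.Fin.Properties as Fin
open import Data.Integer.Base as ℤ using (-[1+_]; _◃_; ∣_∣; +<+; -<+; -<-)
import Data.Integer.Properties as ℤ
open import Data.List.Base as List using ([]; _∷_; [_]; _++_; allFin; cartesianProduct; filter; length)
open import Data.List.Membership.Propositional using (_∈_)
open import Data.List.Membership.Propositional.Properties
open import Data.List.Membership.Propositional.Properties.WithK using (unique∧set⇒bag)
open import Data.List.Properties using (++-assoc; length-++; length-map; length-tabulate; map-tabulate)
open import Data.List.Relation.Binary.BagAndSetEquality using (∼bag⇒↭)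
open import Data.List.Relation.Binary.Disjoint.Propositional using (Disjoint)
open import Data.List.Relation.Binary.Permutation.Propositional as ↭ using (_↭_)
open import Data.List.Relation.Binary.Permutation.Propositional.Properties using (↭-length)
open import Data.List.Relation.Unary.All as All using ([]; _∷_)
open import Data.List.Relation.Unary.AllPairs using ([]; _∷_)
open import Data.List.Relation.Unary.Any using (here; there)
open import Data.List.Relation.Unary.Unique.Propositional using (Unique)
import Data.List.Relation.Unary.Unique.Propositional.Properties as Unique
open import Data.Nat.Base as ℕ using (zero; suc; z≤n; s≤s; ⌊_/2⌋; _∸_)
open import Data.Nat.Combinatorics using (nCk+nC[k+1]≡[n+1]C[k+1]; k>n⇒nCk≡0) renaming (_C_ to _choose_)
import Data.Nat.Properties as ℕ
open import Data.Nat.Tactic.RingSolver using (solve-∀)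
open import Data.Product.Base as Product using (_,_; proj₁; proj₂; ∃; map₂)
open import Data.Product.Properties using (,-injective)
open import Data.Sign.Base as Sign using (Sign)
import Data.Sign.Properties as Sign
open import Data.Sum.Base using (_⊎_; inj₁; inj₂)
open import Data.Vec.Base as Vec using (Vec; []; _∷_; lookup; insertAt; tabulate)
import Data.Vec.Properties as Vec
open import Function.Base using (_∘_; id; case_of_)
open import Function.Bundles using (mk⇔)
open import Relation.Binary.Definitions using (tri<; tri≈; tri>)
open import Relation.Binary.PropositionalEquality as ≡ using (_≢_)
import Relation.Binary.Reasoning.Setoid as SetoidReasoning
open import Relation.Nullary.Decidable using (yes; no; does; dec-true; dec-false; _×-dec_; _→-dec_; ¬?)
open import Relation.Nullary.Negation using (contradiction)
open import Relation.Unary using (Decidable)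

-- Power series and polynomials

-- To become a recursion over words, the sum over involutions is taken apart by deleting fixed
-- points from left to right; a lower bound on the position of the next one makes every insertion
-- occur once. Deletion relabels all other letters, but kinds and the order of two old letters
-- survive, so a list of kinds with Boolean comparisons (`Profile`) carries all that descents need.
-- Rational functions become power series with explicit inverses. The passage from Z to z is the
-- linear operator `tr`, which is not multiplicative, so products pass through it one linear factor
-- at a time. Denominators are cleared by the form `Q y w`, of which J, A and the sum over σ are all
-- values, related by ring homomorphisms. A is natural because `Q` and its arguments have natural
-- coefficients. A weight bound on these arguments makes γ vanish for 2k > 2j+f, where t^k
-- (1+t)^{2j+f-2k} would cease to be a polynomial. Since two-cycles and fixed points together cover
-- all n letters, C_{n,k} is the sum over j of γ_{j,n-2j,k} p^{n-2j}.

module SumLemmas {c ℓ} (R : CommutativeRing c ℓ) where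
  open CommutativeRing R hiding (isCommutativeRing)
  open Ops rawRing using (∑≤)
  open Sum semiring using (sum-cong-≋; ∑-distrib-+; *-distribˡ-sum; *-distribʳ-sum; sum-replicate-zero)

  ∑≤-cong : ∀ n {f g : ℕ → Carrier} → (∀ i → f i ≈ g i) → ∑≤ n f ≈ ∑≤ n g
  ∑≤-cong n f≈g = sum-cong-≋ {suc n} (λ i → f≈g (toℕ i))

  ∑≤-cong-≤ : ∀ n {f g : ℕ → Carrier} → (∀ i → i ℕ.≤ n → f i ≈ g i) → ∑≤ n f ≈ ∑≤ n g
  ∑≤-cong-≤ zero    f≈g = +-congʳ (f≈g 0 ℕ.z≤n)
  ∑≤-cong-≤ (suc n) f≈g = +-cong (f≈g 0 ℕ.z≤n) (∑≤-cong-≤ n (λ i i≤n → f≈g (suc i) (ℕ.s≤s i≤n)))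

  ∑≤-distrib-+ : ∀ n (f g : ℕ → Carrier) → ∑≤ n (λ i → f i + g i) ≈ ∑≤ n f + ∑≤ n g
  ∑≤-distrib-+ n f g = ∑-distrib-+ {suc n} (f ∘ toℕ) (g ∘ toℕ)

  *-distribˡ-∑≤ : ∀ n x f → x * ∑≤ n f ≈ ∑≤ n (λ i → x * f i)
  *-distribˡ-∑≤ n x f = *-distribˡ-sum {suc n} x (f ∘ toℕ)

  *-distribʳ-∑≤ : ∀ n x f → ∑≤ n f * x ≈ ∑≤ n (λ i → f i * x)
  *-distribʳ-∑≤ n x f = *-distribʳ-sum {suc n} x (f ∘ toℕ)

  ∑≤-zero : ∀ n {f : ℕ → Carrier} → (∀ i → i ℕ.≤ n → f i ≈ 0#) → ∑≤ n f ≈ 0#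
  ∑≤-zero n f≈0 = trans (∑≤-cong-≤ n f≈0) (sum-replicate-zero (suc n))

  ∑≤-last : ∀ n f → ∑≤ (suc n) f ≈ ∑≤ n f + f (suc n)
  ∑≤-last zero    f = trans (sym (+-assoc _ _ _)) (trans (+-identityʳ _) (+-congʳ (sym (+-identityʳ _))))
  ∑≤-last (suc n) f = trans (+-congˡ (∑≤-last n (f ∘ suc))) (sym (+-assoc _ _ _))

module Series {c ℓ} (R : CommutativeRing c ℓ) where
  open CommutativeRing R hiding (isCommutativeRing)
  open CSG +-commutativeSemigroup using (x∙yz≈xz∙y)
  open SumLemmas R
  private
    module S = Ops (PowerSeries.seriesRing rawRing)
  open SetoidReasoning setoid

  private
    Ser : Set c
    Ser = ℕ → Carrier
    infix 4 _≋_
    _≋_ : Ser → Ser → Set ℓ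
    f ≋ g = ∀ n → f n ≈ g n
    tail : Ser → Ser
    tail f = f ∘ suc

  *-congₛ : ∀ {f f′ g g′} → f ≋ f′ → g ≋ g′ → f S.* g ≋ f′ S.* g′
  *-congₛ f≋f′ g≋g′ n = ∑≤-cong n (λ i → *-cong (f≋f′ i) (g≋g′ (n ∸ i)))

  -- The product unfolds along its left factor by computation. This is the mirror recursion along
  -- the right factor, on which commutativity by induction rests.
  *-sucʳ : ∀ f g n → (f S.* g) (suc n) ≈ (f S.* tail g) n + f (suc n) * g 0
  *-sucʳ f g zero    = x∙yz≈xz∙y _ _ _
  *-sucʳ f g (suc n) = trans (+-congˡ (*-sucʳ (tail f) g n)) (sym (+-assoc _ _ _))

  *-commₛ : ∀ f g → f S.* g ≋ g S.* f
  *-commₛ f g zero    = +-congʳ (*-comm _ _)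
  *-commₛ f g (suc n) = begin
    f 0 * g (suc n) + (tail f S.* g) n  ≈⟨ +-cong (*-comm _ _) (*-commₛ (tail f) g n) ⟩
    g (suc n) * f 0 + (g S.* tail f) n  ≈⟨ +-comm _ _ ⟩
    (g S.* tail f) n + g (suc n) * f 0  ≈⟨ *-sucʳ g f n ⟨
    (g S.* f) (suc n)                   ∎

  *-distribʳₛ : ∀ h f g → (f S.+ g) S.* h ≋ f S.* h S.+ g S.* h
  *-distribʳₛ h f g n = trans (∑≤-cong n (λ i → distribʳ (h (n ∸ i)) (f i) (g i))) (∑≤-distrib-+ n (λ i → f i * h (n ∸ i)) (λ i → g i * h (n ∸ i)))

  *-distribˡₛ : ∀ h f g → h S.* (f S.+ g) ≋ h S.* f S.+ h S.* g
  *-distribˡₛ h f g n = trans (∑≤-cong n (λ i → distribˡ (h i) (f (n ∸ i)) (g (n ∸ i)))) (∑≤-distrib-+ n (λ i → h i * f (n ∸ i)) (λ i → h i * g (n ∸ i)))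

  scale-* : ∀ a f g n → ((λ i → a * f i) S.* g) n ≈ a * (f S.* g) n
  scale-* a f g n = trans (∑≤-cong n (λ i → *-assoc a (f i) (g (n ∸ i)))) (sym (*-distribˡ-∑≤ n a (λ i → f i * g (n ∸ i))))

  *-assocₛ : ∀ f g h → (f S.* g) S.* h ≋ f S.* (g S.* h)
  *-assocₛ f g h zero    = +-congʳ (begin
    (f 0 * g 0 + 0#) * h 0    ≈⟨ *-congʳ (+-identityʳ _) ⟩
    (f 0 * g 0) * h 0         ≈⟨ *-assoc _ _ _ ⟩
    f 0 * (g 0 * h 0)         ≈⟨ *-congˡ (+-identityʳ _) ⟨
    f 0 * (g 0 * h 0 + 0#)    ∎)
  *-assocₛ f g h (suc n) = begin
    (f 0 * g 0 + 0#) * h (suc n) + ((λ i → f 0 * g (suc i) + (tail f S.* g) i) S.* h) n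
      ≈⟨ +-cong (trans (*-congʳ (+-identityʳ _)) (*-assoc _ _ _))
                (trans (*-distribʳₛ h (λ i → f 0 * g (suc i)) (tail f S.* g) n) (+-cong (scale-* (f 0) (tail g) h n) (*-assocₛ (tail f) g h n))) ⟩
    f 0 * (g 0 * h (suc n)) + (f 0 * (tail g S.* h) n + (tail f S.* (g S.* h)) n)
      ≈⟨ +-assoc _ _ _ ⟨
    (f 0 * (g 0 * h (suc n)) + f 0 * (tail g S.* h) n) + (tail f S.* (g S.* h)) n
      ≈⟨ +-congʳ (distribˡ _ _ _) ⟨
    f 0 * (g S.* h) (suc n) + (tail f S.* (g S.* h)) n ∎

  zeroˡₛ : ∀ g → S.0# S.* g ≋ S.0#
  zeroˡₛ g n = ∑≤-zero n (λ i _ → zeroˡ (g (n ∸ i)))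

  *-identityˡₛ : ∀ g → S.1# S.* g ≋ g
  *-identityˡₛ g zero    = trans (+-identityʳ _) (*-identityˡ _)
  *-identityˡₛ g (suc n) = trans (+-cong (*-identityˡ _) (zeroˡₛ g n)) (+-identityʳ _)

  isCommutativeRing : IsCommutativeRing (S._≈_) S._+_ S._*_ S.-_ S.0# S.1#
  isCommutativeRing = record
    { isRing = record
      { +-isAbelianGroup = record
        { isGroup = record
          { isMonoid = record
            { isSemigroup = record
              { isMagma = record
                { isEquivalence = record
                  { refl = λ n → refl ; sym = λ p n → sym (p n) ; trans = λ p q n → trans (p n) (q n) }
                ; ∙-cong = λ p q n → +-cong (p n) (q n)
                }
              ; assoc = λ f g h n → +-assoc _ _ _
              }
            ; identity = (λ f n → +-identityˡ _) , (λ f n → +-identityʳ _)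
            }
          ; inverse = (λ f n → -‿inverseˡ _) , (λ f n → -‿inverseʳ _)
          ; ⁻¹-cong = λ p n → -‿cong (p n)
          }
        ; comm = λ f g n → +-comm _ _
        }
      ; *-cong = *-congₛ
      ; *-assoc = *-assocₛ
      ; *-identity = *-identityˡₛ , λ f n → trans (*-commₛ f S.1# n) (*-identityˡₛ f n)
      ; distrib = *-distribˡₛ , *-distribʳₛ
      }
    ; *-comm = *-commₛ
    }

  commutativeRing : CommutativeRing c ℓ
  commutativeRing = record { isCommutativeRing = isCommutativeRing }

module Poly {c ℓ} (R : CommutativeRing c ℓ) where
  open CommutativeRing R hiding (isCommutativeRing)
  open RingProperties ring using (-0#≈0#)
  open Polynomial rawRing
  private
    module S = CommutativeRing (Series.commutativeRing R)

  coeff-add : ∀ p q n → coeff (add p q) n ≈ coeff p n + coeff q n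
  coeff-add []      q       n       = sym (+-identityˡ _)
  coeff-add (a ∷ p) []      n       = sym (+-identityʳ _)
  coeff-add (a ∷ p) (b ∷ q) zero    = refl
  coeff-add (a ∷ p) (b ∷ q) (suc n) = coeff-add p q n

  coeff-scale : ∀ a p n → coeff (List.map (a *_) p) n ≈ a * coeff p n
  coeff-scale a []      n       = sym (zeroʳ a)
  coeff-scale a (b ∷ p) zero    = refl
  coeff-scale a (b ∷ p) (suc n) = coeff-scale a p n

  coeff-neg : ∀ p n → coeff (List.map (-_) p) n ≈ - coeff p n
  coeff-neg []      n       = sym -0#≈0#
  coeff-neg (a ∷ p) zero    = refl
  coeff-neg (a ∷ p) (suc n) = coeff-neg p n

  coeff-mul : ∀ p q n → coeff (mul p q) n ≈ (coeff p S.* coeff q) n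
  coeff-mul []      q n       = sym (Series.zeroˡₛ R (coeff q) n)
  coeff-mul (a ∷ p) q zero    = trans (coeff-add (List.map (a *_) q) _ 0) (+-congʳ (coeff-scale a q 0))
  coeff-mul (a ∷ p) q (suc n) = trans (coeff-add (List.map (a *_) q) _ (suc n))
                                      (+-cong (coeff-scale a q (suc n)) (coeff-mul p q n))

  -- Polynomials are compared by coefficients, so injectivity holds by definition and all ring laws
  -- of polynomials descend from those of power series.
  coeff-isRingMonomorphism : IsRingMonomorphism polyRing S.rawRing coeff
  coeff-isRingMonomorphism = record
    { isRingHomomorphism = record
      { isSemiringHomomorphism = record
        { isNearSemiringHomomorphism = record
          { +-isMonoidHomomorphism = record
            { isMagmaHomomorphism = record
              { isRelHomomorphism = record { cong = λ p≈q → p≈q }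
              ; homo = coeff-add
              }
            ; ε-homo = λ _ → refl
            }
          ; *-homo = coeff-mul
          }
        ; 1#-homo = λ _ → refl
        }
      ; -‿homo = coeff-neg
      }
    ; injective = λ p≈q → p≈q
    }

  commutativeRing : CommutativeRing c ℓ
  commutativeRing = record
    { isCommutativeRing = RingMonomorphism.isCommutativeRing coeff-isRingMonomorphism
        (Series.isCommutativeRing R) }

-- Homomorphisms, evaluation and rescaling

IsHom : ∀ {c ℓ c′ ℓ′} (A : CommutativeRing c ℓ) (B : CommutativeRing c′ ℓ′) →
        (CommutativeRing.Carrier A → CommutativeRing.Carrier B) → Set _
IsHom A B = IsSemiringHomomorphism (RawRing.rawSemiring (CommutativeRing.rawRing A))
                                   (RawRing.rawSemiring (CommutativeRing.rawRing B))

∘-isHom : ∀ {c₁ ℓ₁ c₂ ℓ₂ c₃ ℓ₃} {A : CommutativeRing c₁ ℓ₁} {B : CommutativeRing c₂ ℓ₂}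
          {C : CommutativeRing c₃ ℓ₃} {f g} → IsHom B C g → IsHom A B f → IsHom A C (g ∘ f)
∘-isHom {C = C} hg hf = Composition.isSemiringHomomorphism (CommutativeRing.trans C) hf hg

module _ {c ℓ c′ ℓ′} {A : CommutativeRing c ℓ} {B : CommutativeRing c′ ℓ′} where
  private
    module A = CommutativeRing A
    module B = CommutativeRing B

  mkHom : ∀ φ → (∀ {x y} → x A.≈ y → φ x B.≈ φ y) →
          (∀ x y → φ (x A.+ y) B.≈ φ x B.+ φ y) → φ A.0# B.≈ B.0# →
          (∀ x y → φ (x A.* y) B.≈ φ x B.* φ y) → φ A.1# B.≈ B.1# → IsHom A B φ
  mkHom φ cong +-homo 0-homo *-homo 1-homo = record
    { isNearSemiringHomomorphism = record
      { +-isMonoidHomomorphism = record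
        { isMagmaHomomorphism = record
          { isRelHomomorphism = record { cong = cong }
          ; homo = +-homo }
        ; ε-homo = 0-homo }
      ; *-homo = *-homo }
    ; 1#-homo = 1-homo }

  module Hom {φ} (isHom : IsHom A B φ) where
    open IsSemiringHomomorphism isHom public
      using (+-homo; *-homo; 1#-homo; 0#-homo) renaming (⟦⟧-cong to cong)
    private
      module OA = Ops A.rawRing
      module OB = Ops B.rawRing

    ^-homo : ∀ x n → φ (x OA.^ n) B.≈ φ x OB.^ n
    ^-homo x zero    = 1#-homo
    ^-homo x (suc n) = B.trans (*-homo _ _) (B.*-congˡ (^-homo x n))

    ·-homo : ∀ n x → φ (n OA.· x) B.≈ n OB.· φ x
    ·-homo zero    x = 0#-homo
    ·-homo (suc n) x = B.trans (+-homo _ _) (B.+-congˡ (·-homo n x))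

    sum-homo : ∀ n f → φ (OA.sum {n} f) B.≈ OB.sum {n} (φ ∘ f)
    sum-homo zero    f = 0#-homo
    sum-homo (suc n) f = B.trans (+-homo _ _) (B.+-congˡ (sum-homo n (f ∘ Fin.suc)))

    ∑≤-homo : ∀ n f → φ (OA.∑≤ n f) B.≈ OB.∑≤ n (φ ∘ f)
    ∑≤-homo n f = sum-homo (suc n) (f ∘ toℕ)

    ∑-homo : ∀ {a} {I : Set a} (xs : List I) f → φ (OA.∑ xs f) B.≈ OB.∑ xs (φ ∘ f)
    ∑-homo []       f = 0#-homo
    ∑-homo (x ∷ xs) f = B.trans (+-homo _ _) (B.+-congˡ (∑-homo xs f))

module SeriesLemmas {c ℓ} (R : CommutativeRing c ℓ) where
  open CommutativeRing R
  open RingProperties ring using (-‿distribˡ-*)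
  private
    𝕊 = Series.commutativeRing R
    module S = CommutativeRing 𝕊
    open PowerSeries rawRing using (1+_X; 1/1+_X)
  open Polynomial rawRing using (coeff; const) renaming (X to X-poly)

  C : Carrier → S.Carrier
  C a = coeff (const a)

  X : S.Carrier
  X = coeff X-poly

  C-* : ∀ a g n → (C a S.* g) n ≈ a * g n
  C-* a g zero    = +-identityʳ _
  C-* a g (suc n) = trans (+-congˡ (Series.zeroˡₛ R g n)) (+-identityʳ _)

  X-*-zero : ∀ g → (X S.* g) 0 ≈ 0#
  X-*-zero g = trans (+-identityʳ _) (zeroˡ _)

  X-*-suc : ∀ g n → (X S.* g) (suc n) ≈ g n
  X-*-suc g n = trans (+-cong (zeroˡ _) (S.*-identityˡ g n)) (+-identityˡ _)

  C-isHom : IsHom R 𝕊 C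
  C-isHom = mkHom {A = R} {B = 𝕊} C
    (λ { a≈b zero → a≈b ; a≈b (suc n) → refl })
    (λ { a b zero → refl ; a b (suc n) → sym (+-identityˡ _) })
    (λ { zero → refl ; (suc n) → refl })
    (λ { a b zero → sym (C-* a (C b) 0) ; a b (suc n) → sym (trans (C-* a (C b) (suc n)) (zeroʳ a)) })
    (λ n → refl)

  1+X≈ : ∀ a → 1+ a X S.≈ S.1# S.+ C a S.* X
  1+X≈ a n = trans (lemma n) (+-congˡ (sym (C-* a X n)))
    where
    lemma : ∀ n → (1+ a X) n ≈ S.1# n + a * X n
    lemma zero          = sym (trans (+-congˡ (zeroʳ a)) (+-identityʳ _))
    lemma (suc zero)    = sym (trans (+-congˡ (*-identityʳ a)) (+-identityˡ _))
    lemma (suc (suc n)) = sym (trans (+-congˡ (zeroʳ a)) (+-identityˡ _))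

  1+X-inverse : ∀ a → 1+ a X S.* 1/1+ a X S.≈ S.1#
  1+X-inverse a zero    = trans (+-identityʳ _) (*-identityˡ _)
  1+X-inverse a (suc n) = begin
    1# * (- a * g n) + (C a S.* g) n  ≈⟨ +-cong (*-identityˡ _) (C-* a g n) ⟩
    - a * g n + a * g n               ≈⟨ +-congʳ (-‿distribˡ-* a (g n)) ⟨
    - (a * g n) + a * g n             ≈⟨ -‿inverseˡ _ ⟩
    0#                                ∎
    where
    g = 1/1+ a X
    open SetoidReasoning setoid

module PolyLemmas {c ℓ} (R : CommutativeRing c ℓ) where
  open CommutativeRing R
  private
    ℙ = Poly.commutativeRing R
    module P = CommutativeRing ℙ
  open Polynomial rawRing using (coeff; const)

  const-isHom : IsHom R ℙ const
  const-isHom = mkHom {A = R} {B = ℙ} const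
    (λ { a≈b zero → a≈b ; a≈b (suc n) → refl })
    (λ { a b n → refl })
    (λ { zero → refl ; (suc n) → refl })
    (λ { a b zero → sym (+-identityʳ _) ; a b (suc n) → refl })
    (λ n → refl)

  coeff-isHom : IsHom ℙ (Series.commutativeRing R) coeff
  coeff-isHom = IsRingMonomorphism.isSemiringHomomorphism (Poly.coeff-isRingMonomorphism R)

module Evaluation {c ℓ c′ ℓ′} {A : CommutativeRing c ℓ} {B : CommutativeRing c′ ℓ′}
  {ι} (ι-isHom : IsHom A B ι) (x : CommutativeRing.Carrier B) where
  private
    module A = CommutativeRing A
    ℙ = Poly.commutativeRing A
    module P = CommutativeRing ℙ
    module ι = Hom {A = A} {B = B} ι-isHom
  open CommutativeRing B
  open CSG +-commutativeSemigroup using () renaming (interchange to +-interchange)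
  open CSG *-commutativeSemigroup using (x∙yz≈y∙xz)
  open Polynomial A.rawRing using (coeff; const; add) renaming (X to X-poly)
  open Ops rawRing using (∑≤; _^_)
  open SetoidReasoning setoid
  open SumLemmas B

  eval : List A.Carrier → Carrier
  eval []      = 0#
  eval (a ∷ p) = ι a + x * eval p

  private
    -- Equal polynomials may be lists of different lengths; that trailing zeros evaluate to zero is
    -- what makes `eval` well defined on them.
    eval-zero : ∀ p → (∀ n → coeff p n A.≈ A.0#) → eval p ≈ 0#
    eval-zero []      p≈0 = refl
    eval-zero (a ∷ p) p≈0 = begin
      ι a + x * eval p  ≈⟨ +-cong (ι.cong (p≈0 0)) (*-congˡ (eval-zero p (p≈0 ∘ suc))) ⟩
      ι A.0# + x * 0#   ≈⟨ +-cong ι.0#-homo (zeroʳ x) ⟩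
      0# + 0#           ≈⟨ +-identityˡ 0# ⟩
      0#                ∎

    eval-cong : ∀ p q → p P.≈ q → eval p ≈ eval q
    eval-cong []      q       p≈q = sym (eval-zero q (λ n → A.sym (p≈q n)))
    eval-cong (a ∷ p) []      p≈q = eval-zero (a ∷ p) p≈q
    eval-cong (a ∷ p) (b ∷ q) p≈q = +-cong (ι.cong (p≈q 0)) (*-congˡ (eval-cong p q (p≈q ∘ suc)))

    eval-+ : ∀ p q → eval (p P.+ q) ≈ eval p + eval q
    eval-+ []      q       = sym (+-identityˡ _)
    eval-+ (a ∷ p) []      = sym (+-identityʳ _)
    eval-+ (a ∷ p) (b ∷ q) = begin
      ι (a A.+ b) + x * eval (p P.+ q)           ≈⟨ +-cong (ι.+-homo a b) (*-congˡ (eval-+ p q)) ⟩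
      (ι a + ι b) + x * (eval p + eval q)        ≈⟨ +-congˡ (distribˡ x _ _) ⟩
      (ι a + ι b) + (x * eval p + x * eval q)    ≈⟨ +-interchange _ _ _ _ ⟩
      (ι a + x * eval p) + (ι b + x * eval q)    ∎

    eval-scale : ∀ a p → eval (List.map (a A.*_) p) ≈ ι a * eval p
    eval-scale a []      = sym (zeroʳ _)
    eval-scale a (b ∷ p) = begin
      ι (a A.* b) + x * eval (List.map (a A.*_) p)  ≈⟨ +-cong (ι.*-homo a b) (*-congˡ (eval-scale a p)) ⟩
      ι a * ι b + x * (ι a * eval p)                ≈⟨ +-congˡ (x∙yz≈y∙xz _ _ _) ⟩
      ι a * ι b + ι a * (x * eval p)                ≈⟨ distribˡ _ _ _ ⟨
      ι a * (ι b + x * eval p)                      ∎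

    eval-* : ∀ p q → eval (p P.* q) ≈ eval p * eval q
    eval-* []      q = sym (zeroˡ _)
    eval-* (a ∷ p) q = begin
      eval (add (List.map (a A.*_) q) (A.0# ∷ (p P.* q)))
        ≈⟨ eval-+ (List.map (a A.*_) q) _ ⟩
      eval (List.map (a A.*_) q) + (ι A.0# + x * eval (p P.* q))
        ≈⟨ +-cong (eval-scale a q) (trans (+-cong ι.0#-homo (*-congˡ (eval-* p q))) (+-identityˡ _)) ⟩
      ι a * eval q + x * (eval p * eval q)
        ≈⟨ +-congˡ (*-assoc _ _ _) ⟨
      ι a * eval q + (x * eval p) * eval q
        ≈⟨ distribʳ _ _ _ ⟨
      (ι a + x * eval p) * eval q ∎

  eval-const : ∀ a → eval (const a) ≈ ι a
  eval-const a = trans (+-congˡ (zeroʳ x)) (+-identityʳ _)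

  eval-X : eval X-poly ≈ x
  eval-X = begin
    ι A.0# + x * eval P.1#  ≈⟨ +-cong ι.0#-homo (*-congˡ (trans (eval-const A.1#) ι.1#-homo)) ⟩
    0# + x * 1#             ≈⟨ trans (+-identityˡ _) (*-identityʳ x) ⟩
    x                       ∎

  eval-isHom : IsHom ℙ B eval
  eval-isHom = mkHom {A = ℙ} {B = B} eval (λ {p} {q} → eval-cong p q) eval-+ refl eval-*
    (trans (eval-const A.1#) ι.1#-homo)

  eval-expansion : ∀ m p → (∀ k → m ℕ.< k → coeff p k A.≈ A.0#) →
                   eval p ≈ ∑≤ m (λ k → ι (coeff p k) * x ^ k)
  eval-expansion m [] _ = sym (∑≤-zero m (λ k _ → trans (*-congʳ ι.0#-homo) (zeroˡ (x ^ k))))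
  eval-expansion zero (a ∷ p) high = +-cong (sym (*-identityʳ _))
    (trans (*-congˡ (eval-zero p (λ k → high (suc k) (ℕ.s≤s ℕ.z≤n)))) (zeroʳ x))
  eval-expansion (suc m) (a ∷ p) high = +-cong (sym (*-identityʳ _)) (begin
    x * eval p                                      ≈⟨ *-congˡ (eval-expansion m p (λ k m<k → high (suc k) (ℕ.s≤s m<k))) ⟩
    x * ∑≤ m (λ k → ι (coeff p k) * x ^ k)          ≈⟨ *-distribˡ-∑≤ m x (λ k → ι (coeff p k) * x ^ k) ⟩
    ∑≤ m (λ k → x * (ι (coeff p k) * x ^ k))        ≈⟨ ∑≤-cong m (λ k → x∙yz≈y∙xz x (ι (coeff p k)) (x ^ k)) ⟩
    ∑≤ m (λ k → ι (coeff p k) * (x * x ^ k))        ∎)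

-- The substitution W ↦ uW, combined with φ on coefficients.
module Rescale {c ℓ c′ ℓ′} {A : CommutativeRing c ℓ} {B : CommutativeRing c′ ℓ′}
  {φ} (φ-isHom : IsHom A B φ) (u : CommutativeRing.Carrier B) where
  private
    module A = CommutativeRing A
    module φ = Hom {A = A} {B = B} φ-isHom
    𝔸 = Series.commutativeRing A
    𝔹 = Series.commutativeRing B
    module 𝔸 = CommutativeRing 𝔸
    module 𝔹 = CommutativeRing 𝔹
    module LA = SeriesLemmas A
    module LB = SeriesLemmas B
  open CommutativeRing B
  open CSG *-commutativeSemigroup using () renaming (interchange to *-interchange)
  open Ops rawRing using (∑≤; _^_)
  open Exp semiring using (^-homo-*; ^-congʳ)
  open SetoidReasoning setoid
  open SumLemmas B

  rescale : 𝔸.Carrier → 𝔹.Carrier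
  rescale f n = u ^ n * φ (f n)

  private
    rescale-* : ∀ f g → rescale (f 𝔸.* g) 𝔹.≈ rescale f 𝔹.* rescale g
    rescale-* f g n = begin
      u ^ n * φ (Ops.∑≤ A.rawRing n (λ i → f i A.* g (n ∸ i)))
        ≈⟨ *-congˡ (φ.∑≤-homo n (λ i → f i A.* g (n ∸ i))) ⟩
      u ^ n * ∑≤ n (λ i → φ (f i A.* g (n ∸ i)))
        ≈⟨ *-distribˡ-∑≤ n (u ^ n) (λ i → φ (f i A.* g (n ∸ i))) ⟩
      ∑≤ n (λ i → u ^ n * φ (f i A.* g (n ∸ i)))
        ≈⟨ ∑≤-cong-≤ n (λ i i≤n → trans
             (*-cong (trans (^-congʳ u (≡.sym (ℕ.m+[n∸m]≡n i≤n))) (^-homo-* u i (n ∸ i))) (φ.*-homo _ _))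
             (*-interchange (u ^ i) (u ^ (n ∸ i)) (φ (f i)) (φ (g (n ∸ i))))) ⟩
      ∑≤ n (λ i → rescale f i * rescale g (n ∸ i)) ∎

  rescale-C : ∀ a → rescale (LA.C a) 𝔹.≈ LB.C (φ a)
  rescale-C a zero    = *-identityˡ _
  rescale-C a (suc n) = trans (*-congˡ φ.0#-homo) (zeroʳ _)

  rescale-X : rescale LA.X 𝔹.≈ LB.C u 𝔹.* LB.X
  rescale-X n = trans (lemma n) (sym (LB.C-* u LB.X n))
    where
    lemma : ∀ n → rescale LA.X n ≈ u * LB.X n
    lemma zero          = trans (*-congˡ φ.0#-homo) (trans (zeroʳ _) (sym (zeroʳ u)))
    lemma (suc zero)    = *-cong (*-identityʳ u) φ.1#-homo
    lemma (suc (suc n)) = trans (*-congˡ φ.0#-homo) (trans (zeroʳ _) (sym (zeroʳ u)))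

  rescale-isHom : IsHom 𝔸 𝔹 rescale
  rescale-isHom = mkHom {A = 𝔸} {B = 𝔹} rescale
    (λ f≈g n → *-congˡ (φ.cong (f≈g n)))
    (λ f g n → trans (*-congˡ (φ.+-homo (f n) (g n))) (distribˡ _ _ _))
    (λ n → trans (*-congˡ φ.0#-homo) (zeroʳ _))
    rescale-*
    (λ n → trans (rescale-C A.1# n) (Hom.cong {A = B} {B = 𝔹} LB.C-isHom φ.1#-homo n))

-- The homogeneous form of the gamma polynomial

module Homogeneous {c ℓ} (R : CommutativeRing c ℓ) (D : ℕ → ℕ → ℕ) (j : ℕ) where
  open CommutativeRing R
  open Ops rawRing using (∑≤; _^_; _·_)
  open SumLemmas R
  open Exp semiring using (^-homo-*; ^-congʳ; ^-congˡ; ^-assocʳ)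
  open CommutativeExp commutativeSemiring using (^-distrib-*)
  open Mult semiring using (×-congʳ; ×-comm-*)
  open CSG *-commutativeSemigroup using () renaming (interchange to *-interchange)
  open SetoidReasoning setoid

  -- w²ʲ Pⱼ(y/w²)
  Q : Carrier → Carrier → Carrier
  Q y w = ∑≤ j (λ s → D j s · (y ^ s * w ^ (2 ℕ.* (j ∸ s))))

  Q-cong : ∀ {y y′ w w′} → y ≈ y′ → w ≈ w′ → Q y w ≈ Q y′ w′
  Q-cong y≈ w≈ = ∑≤-cong j (λ s → ×-congʳ (D j s) (*-cong (^-congˡ s y≈) (^-congˡ (2 ℕ.* (j ∸ s)) w≈)))

  private
    split : ∀ c s → s ℕ.≤ j → c ^ (2 ℕ.* j) ≈ (c ^ 2) ^ s * c ^ (2 ℕ.* (j ∸ s))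
    split c s s≤j = begin
      c ^ (2 ℕ.* j)                          ≈⟨ ^-congʳ c (≡.trans (≡.cong (2 ℕ.*_) (≡.sym (ℕ.m+[n∸m]≡n s≤j))) (ℕ.*-distribˡ-+ 2 s (j ∸ s))) ⟩
      c ^ (2 ℕ.* s ℕ.+ 2 ℕ.* (j ∸ s))        ≈⟨ ^-homo-* c (2 ℕ.* s) _ ⟩
      c ^ (2 ℕ.* s) * c ^ (2 ℕ.* (j ∸ s))    ≈⟨ *-congʳ (^-assocʳ c 2 s) ⟨
      (c ^ 2) ^ s * c ^ (2 ℕ.* (j ∸ s))      ∎

  Q-homogeneous : ∀ c y w → c ^ (2 ℕ.* j) * Q y w ≈ Q (c ^ 2 * y) (c * w)
  Q-homogeneous c y w = trans (*-distribˡ-∑≤ j _ (λ s → D j s · (y ^ s * w ^ (2 ℕ.* (j ∸ s)))))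
    (∑≤-cong-≤ j (λ s s≤j → begin
      c ^ (2 ℕ.* j) * (D j s · (y ^ s * w ^ e s))
        ≈⟨ ×-comm-* (D j s) _ _ ⟩
      D j s · (c ^ (2 ℕ.* j) * (y ^ s * w ^ e s))
        ≈⟨ ×-congʳ (D j s) (trans (*-congʳ (split c s s≤j)) (trans (*-interchange _ _ _ _)
             (sym (*-cong (^-distrib-* (c ^ 2) y s) (^-distrib-* c w (e s)))))) ⟩
      D j s · ((c ^ 2 * y) ^ s * (c * w) ^ e s) ∎))
    where
    e : ℕ → ℕ
    e s = 2 ℕ.* (j ∸ s)

  -- Clears denominators: of the 2j factors w, the term of index s spends 2s on cancelling v. It
  -- applies both to the given expansion of J, with w = 1+t, and to the definition of A, with w =
  -- 1+4xW.
  P-homogenize : ∀ {w v} y → w * v ≈ 1# → w ^ (2 ℕ.* j) * P rawRing D j (y * v ^ 2) ≈ Q y w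
  P-homogenize {w} {v} y wv≈1 = trans (*-distribˡ-∑≤ j _ (λ s → D j s · (y * v ^ 2) ^ s))
    (∑≤-cong-≤ j (λ s s≤j → begin
      w ^ (2 ℕ.* j) * (D j s · (y * v ^ 2) ^ s)
        ≈⟨ ×-comm-* (D j s) _ _ ⟩
      D j s · (w ^ (2 ℕ.* j) * (y * v ^ 2) ^ s)
        ≈⟨ ×-congʳ (D j s) (begin
           w ^ (2 ℕ.* j) * (y * v ^ 2) ^ s
             ≈⟨ *-cong (trans (split w s s≤j) (*-comm _ _)) (^-distrib-* y (v ^ 2) s) ⟩
           (w ^ e s * (w ^ 2) ^ s) * (y ^ s * (v ^ 2) ^ s)
             ≈⟨ trans (*-congʳ (*-comm _ _)) (trans (*-congˡ (*-comm _ _)) (*-interchange _ _ _ _)) ⟩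
           ((w ^ 2) ^ s * (v ^ 2) ^ s) * (w ^ e s * y ^ s)
             ≈⟨ *-congʳ (trans (sym (^-distrib-* (w ^ 2) (v ^ 2) s)) (^-congˡ s (trans (sym (^-distrib-* w v 2)) (^-congˡ 2 wv≈1)))) ⟩
           ((1# ^ 2) ^ s) * (w ^ e s * y ^ s)
             ≈⟨ *-cong (trans (^-congˡ s (1^ 2)) (1^ s)) (*-comm _ _) ⟩
           1# * (y ^ s * w ^ e s)
             ≈⟨ *-identityˡ _ ⟩
           y ^ s * w ^ e s ∎) ⟩
      D j s · (y ^ s * w ^ e s) ∎))
    where
    e : ℕ → ℕ
    e s = 2 ℕ.* (j ∸ s)
    1^ : ∀ n → 1# ^ n ≈ 1#
    1^ zero    = refl
    1^ (suc n) = trans (*-identityˡ _) (1^ n)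

module _ {c ℓ c′ ℓ′} {A : CommutativeRing c ℓ} {B : CommutativeRing c′ ℓ′}
  {φ} (φ-isHom : IsHom A B φ) where
  private
    module A = CommutativeRing A
    module B = CommutativeRing B
    module φ = Hom {A = A} {B = B} φ-isHom
    module OA = Ops A.rawRing

  Q-homo : ∀ D j y w → φ (Homogeneous.Q A D j y w) B.≈ Homogeneous.Q B D j (φ y) (φ w)
  Q-homo D j y w = B.trans (φ.∑≤-homo j (λ s → D j s OA.· (y OA.^ s OA.* w OA.^ (2 ℕ.* (j ∸ s)))))
    (SumLemmas.∑≤-cong B j (λ s → B.trans (φ.·-homo (D j s) _) (Mult.×-congʳ B.semiring (D j s)
      (B.trans (φ.*-homo _ _) (B.*-cong (φ.^-homo y s) (φ.^-homo w (2 ℕ.* (j ∸ s))))))))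

-- Generating functions of insertions

-- The kind of a letter πᵢ that is not fixed: ∣πᵢ∣ < i, πᵢ > i or πᵢ < -i.
data Kind : Set where
  low above below : Kind

data Letter : Set where
  old : Kind → Bool → Letter
  new : Sign → Letter

Profile : Set
Profile = List (Kind × Bool)

toLetter : Kind × Bool → Letter
toLetter (k , b) = old k b

-- Kinds decide every comparison of neighbours except that of two old
-- letters of the same kind, whose outcome the second one carries.
descent : Letter → Letter → Bool
descent (old low   _) (old low   b)   = b
descent (old low   _) (old above _)   = false
descent (old low   _) (old below _)   = true
descent (old above _) (old low   _)   = true
descent (old above _) (old above b)   = b
descent (old above _) (old below _)   = true
descent (old below _) (old low   _)   = false
descent (old below _) (old above _)   = false
descent (old below _) (old below b)   = b
descent (old low   _) (new Sign.+)    = false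
descent (old low   _) (new Sign.-)    = true
descent (old above _) (new _)         = true
descent (old below _) (new _)         = false
descent (new Sign.+)  (old low   _)   = true
descent (new Sign.-)  (old low   _)   = false
descent (new _)       (old above _)   = false
descent (new _)       (old below _)   = true
descent (new _)       (new Sign.+)    = false
descent (new _)       (new Sign.-)    = true

indicator : Bool → ℕ
indicator b = if b then 1 else 0

descents : Letter → List Letter → ℕ
descents x []       = 0
descents x (y ∷ ys) = indicator (descent x y) ℕ.+ descents y ys

module Gap {c ℓ} (R : CommutativeRing c ℓ) where
  open CommutativeRing R

  -- Over the gaps of a word the generating functions telescope: with
  -- φ = potential, a gap contributes φ(left)/φ(right) times α/ω at an
  -- ascent and tβ/ω at a descent, where ω = 1 - (1+t)z. The unit is
  -- written ω + z + tz wherever this makes the identities homogeneous.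
  module At (T Z ω : Carrier) (unit : ω + (Z + T * Z) ≈ 1#) where

    open CSG *-commutativeSemigroup using () renaming (x∙yz≈y∙xz to *-x∙yz≈y∙xz)
    open GroupProperties +-group using () renaming (∙-cancelʳ to +-cancelʳ)
    open SetoidReasoning setoid
    private
      module RSolver = Solver commutativeSemiring
    open RSolver using (solve; _:=_; _:+_; _:*_; con)

    I α β : Carrier
    I = ω + (Z + T * Z)
    α = ω + (T * Z + T * Z)
    β = ω + (Z + Z)

    wt factor : Bool → Carrier
    wt d     = if d then T else 1#
    factor d = if d then T * β else α

    -- The potentials are read off the gap after the last letter. Its numerator is ω + Z(a₊ + a₋),
    -- where a₊ and a₋ weigh the step to a new letter of either sign; the total a₊ + a₋ is 1+T after
    -- a low letter, 2T after one above and 2 after one below.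
    potential : Kind → Carrier
    potential low   = I
    potential above = α
    potential below = β

    gap : (a₊ a₋ b₊ b₋ d : Carrier) → Carrier
    gap a₊ a₋ b₊ b₋ d = ω * d * I + Z * (a₊ * (ω * b₊ + Z * (b₊ + T * b₋))
                                       + a₋ * (ω * b₋ + Z * (b₊ + T * b₋)))

    -- The first two equations are a linear system for the series after a new letter of either sign.
    -- What follows a new letter does not depend on its sign if it is another new letter, so both
    -- unknowns recur only through Y = F₊ + T F₋, and the system has determinant ω. Here q is the
    -- series after the next old letter, b₊ and b₋ weigh the step to it from a new letter, and d the
    -- direct step.
    gap-solve : ∀ a₊ a₋ b₊ b₋ d q F₊ F₋ G →
      F₊ ≈ b₊ * q + Z * (1# * F₊ + T * F₋) →
      F₋ ≈ b₋ * q + Z * (1# * F₊ + T * F₋) →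
      G ≈ d * q + Z * (a₊ * F₊ + a₋ * F₋) →
      ω * G ≈ gap a₊ a₋ b₊ b₋ d * q
    gap-solve a₊ a₋ b₊ b₋ d q F₊ F₋ G eq₊ eq₋ eq = begin
      ω * G
        ≈⟨ *-congˡ eq ⟩
      ω * (d * q + Z * (a₊ * F₊ + a₋ * F₋))
        ≈⟨ solve 8 (λ ω d q Z a₊ F₊ a₋ F₋ →
             ω :* (d :* q :+ Z :* (a₊ :* F₊ :+ a₋ :* F₋)) :=
             ω :* d :* con 1 :* q :+ Z :* (a₊ :* (ω :* F₊) :+ a₋ :* (ω :* F₋))) refl ω d q Z a₊ F₊ a₋ F₋ ⟩
      ω * d * 1# * q + Z * (a₊ * (ω * F₊) + a₋ * (ω * F₋))
        ≈⟨ +-cong (*-congʳ (*-congˡ (sym unit))) (*-congˡ (+-cong (*-congˡ (ωF b₊ F₊ eq₊)) (*-congˡ (ωF b₋ F₋ eq₋)))) ⟩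
      ω * d * I * q + Z * (a₊ * ((ω * b₊ + Z * B) * q) + a₋ * ((ω * b₋ + Z * B) * q))
        ≈⟨ solve 7 (λ x q Z a₊ y₊ a₋ y₋ →
             x :* q :+ Z :* (a₊ :* (y₊ :* q) :+ a₋ :* (y₋ :* q))
             := (x :+ Z :* (a₊ :* y₊ :+ a₋ :* y₋)) :* q)
             refl (ω * d * I) q Z a₊ (ω * b₊ + Z * B) a₋ (ω * b₋ + Z * B) ⟩
      gap a₊ a₋ b₊ b₋ d * q ∎
      where
      B Y : Carrier
      B = b₊ + T * b₋
      Y = 1# * F₊ + T * F₋

      ωY : ω * Y ≈ B * q
      -- Since ω + (Z + TZ) is the unit, Y splits as ωY + (Z + TZ)Y, and the second summand
      -- reappears on the right.
      ωY = +-cancelʳ ((Z + T * Z) * Y) _ _ (begin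
        ω * Y + (Z + T * Z) * Y                        ≈⟨ distribʳ Y _ _ ⟨
        I * Y                                          ≈⟨ trans (*-congʳ unit) (*-identityˡ Y) ⟩
        Y                                              ≈⟨ +-cong (*-congˡ eq₊) (*-congˡ eq₋) ⟩
        1# * (b₊ * q + Z * Y) + T * (b₋ * q + Z * Y)   ≈⟨ solve 6 (λ b₊ b₋ q Z Y T →
            con 1 :* (b₊ :* q :+ Z :* Y) :+ T :* (b₋ :* q :+ Z :* Y) :=
            (b₊ :+ T :* b₋) :* q :+ (Z :+ T :* Z) :* Y) refl b₊ b₋ q Z Y T ⟩
        B * q + (Z + T * Z) * Y                        ∎)

      ωF : ∀ b F → F ≈ b * q + Z * Y → ω * F ≈ (ω * b + Z * B) * q
      ωF b F eqF = begin
        ω * F                    ≈⟨ *-congˡ eqF ⟩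
        ω * (b * q + Z * Y)      ≈⟨ solve 5 (λ ω b q Z Y → ω :* (b :* q :+ Z :* Y) := ω :* b :* q :+ Z :* (ω :* Y)) refl ω b q Z Y ⟩
        ω * b * q + Z * (ω * Y)  ≈⟨ +-congˡ (*-congˡ ωY) ⟩
        ω * b * q + Z * (B * q)  ≈⟨ solve 5 (λ ω b q Z B → ω :* b :* q :+ Z :* (B :* q) := (ω :* b :+ Z :* B) :* q) refl ω b q Z B ⟩
        (ω * b + Z * B) * q      ∎

    gapAt : Letter → Letter → Carrier
    gapAt x y = gap (wt (descent x (new Sign.+))) (wt (descent x (new Sign.-)))
                    (wt (descent (new Sign.+) y)) (wt (descent (new Sign.-) y)) (wt (descent x y))

    gapEnd : Letter → Carrier
    gapEnd x = gap (wt (descent x (new Sign.+))) (wt (descent x (new Sign.-))) 1# 1# 1#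

    private
      module _ {n} (T Z ω : RSolver.Polynomial n) where
        Iₚ αₚ βₚ : RSolver.Polynomial n
        Iₚ = ω :+ (Z :+ T :* Z)
        αₚ = ω :+ (T :* Z :+ T :* Z)
        βₚ = ω :+ (Z :+ Z)

        wtₚ factorₚ : Bool → RSolver.Polynomial n
        wtₚ d     = if d then T else con 1
        factorₚ d = if d then T :* βₚ else αₚ

        potentialₚ : Kind → RSolver.Polynomial n
        potentialₚ low   = Iₚ
        potentialₚ above = αₚ
        potentialₚ below = βₚ

        gapₚ : (a₊ a₋ b₊ b₋ d : RSolver.Polynomial n) → RSolver.Polynomial n
        gapₚ a₊ a₋ b₊ b₋ d = ω :* d :* Iₚ :+ Z :* (a₊ :* (ω :* b₊ :+ Z :* (b₊ :+ T :* b₋))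
                                                :+ a₋ :* (ω :* b₋ :+ Z :* (b₊ :+ T :* b₋)))

        transferₚ : Kind → Kind → Bool → RSolver.Polynomial n × RSolver.Polynomial n
        transferₚ k k′ b =
          gapₚ (wtₚ (descent x (new Sign.+))) (wtₚ (descent x (new Sign.-)))
               (wtₚ (descent (new Sign.+) y)) (wtₚ (descent (new Sign.-) y)) (wtₚ (descent x y)) :* potentialₚ k′
          := potentialₚ k :* (factorₚ (descent x y) :* Iₚ)
          where
          -- Any Boolean serves here: `descent` reads only the one carried by the second letter.
          x = old k false
          y = old k′ b

        endₚ : Kind → RSolver.Polynomial n × RSolver.Polynomial n
        endₚ k = gapₚ (wtₚ (descent (old k false) (new Sign.+))) (wtₚ (descent (old k false) (new Sign.-))) (con 1) (con 1) (con 1)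
                 := potentialₚ k :* Iₚ

      -- With the unit written as `I`, both sides are cubic forms in Z and ω over the polynomials in
      -- T with natural coefficients. They agree identically, so a semiring solver settles every
      -- pair of kinds; the Boolean matters, and is split, only when the kinds coincide.
      transfer-I : ∀ k b₀ k′ b → gapAt (old k b₀) (old k′ b) * potential k′
                   ≈ potential k * (factor (descent (old k b₀) (old k′ b)) * I)
      transfer-I low   _ low   false = solve 3 (λ T Z ω → transferₚ T Z ω low   low   false) refl T Z ω
      transfer-I low   _ low   true  = solve 3 (λ T Z ω → transferₚ T Z ω low   low   true ) refl T Z ω
      transfer-I low   _ above b     = solve 3 (λ T Z ω → transferₚ T Z ω low   above b    ) refl T Z ω
      transfer-I low   _ below b     = solve 3 (λ T Z ω → transferₚ T Z ω low   below b    ) refl T Z ω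
      transfer-I above _ low   b     = solve 3 (λ T Z ω → transferₚ T Z ω above low   b    ) refl T Z ω
      transfer-I above _ above false = solve 3 (λ T Z ω → transferₚ T Z ω above above false) refl T Z ω
      transfer-I above _ above true  = solve 3 (λ T Z ω → transferₚ T Z ω above above true ) refl T Z ω
      transfer-I above _ below b     = solve 3 (λ T Z ω → transferₚ T Z ω above below b    ) refl T Z ω
      transfer-I below _ low   b     = solve 3 (λ T Z ω → transferₚ T Z ω below low   b    ) refl T Z ω
      transfer-I below _ above b     = solve 3 (λ T Z ω → transferₚ T Z ω below above b    ) refl T Z ω
      transfer-I below _ below false = solve 3 (λ T Z ω → transferₚ T Z ω below below false) refl T Z ω
      transfer-I below _ below true  = solve 3 (λ T Z ω → transferₚ T Z ω below below true ) refl T Z ω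

      end-I : ∀ k b₀ → gapEnd (old k b₀) ≈ potential k * I
      end-I low   _ = solve 3 (λ T Z ω → endₚ T Z ω low  ) refl T Z ω
      end-I above _ = solve 3 (λ T Z ω → endₚ T Z ω above) refl T Z ω
      end-I below _ = solve 3 (λ T Z ω → endₚ T Z ω below) refl T Z ω

      *I : ∀ x → x * I ≈ x
      *I x = trans (*-congˡ unit) (*-identityʳ x)

    transfer : ∀ k b₀ k′ b → gapAt (old k b₀) (old k′ b) * potential k′
               ≈ potential k * factor (descent (old k b₀) (old k′ b))
    transfer k b₀ k′ b = trans (transfer-I k b₀ k′ b) (*-congˡ (*I _))

    end : ∀ k b₀ → gapEnd (old k b₀) ≈ potential k
    end k b₀ = trans (end-I k b₀) (*I _)

    private
      open Ops rawRing using (_^_)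
      module *-CSG = CSG *-commutativeSemigroup

    cancel-unit : ∀ {w v} → w * v ≈ 1# → ∀ {f g} → w * f ≈ w * g → f ≈ g
    cancel-unit {w} {v} wv≈1 {f} {g} wf≈wg = trans (sym (lemma f)) (trans (*-congˡ wf≈wg) (lemma g))
      where
      lemma : ∀ h → v * (w * h) ≈ h
      lemma h = trans (sym (*-assoc v w h)) (trans (*-congʳ (trans (*-comm v w) wv≈1)) (*-identityˡ h))

    -- Here `Z` is the variable before `tr` is applied and stands for z/(1-uz), whereas in `α` and
    -- `β` it stands for z itself. Under `tr`, multiplication by `a` becomes multiplication by α/ω,
    -- and by `b` multiplication by Tβ/ω.
    a b : Carrier
    a = 1# + (T * Z + T * Z)
    b = T * (1# + (Z + Z))

    -- Because `tr` also divides by ω, it does not respect products. It enters through linearity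
    -- over T and through its effect on 1 and on multiplication by Z, which suffices to move the
    -- factors `a` and `b` across it one by one.
    module Telescope
      (ω⁻¹ : Carrier) (ω-inverse : ω * ω⁻¹ ≈ 1#) (a⁻¹ : Carrier) (a-inverse : a * a⁻¹ ≈ 1#)
      (tr : Carrier → Carrier)
      (tr-cong : ∀ {E E′} → E ≈ E′ → tr E ≈ tr E′)
      (tr-+ : ∀ E E′ → tr (E + E′) ≈ tr E + tr E′)
      (tr-T : ∀ E → tr (T * E) ≈ T * tr E)
      (ω-tr-1 : ω * tr 1# ≈ 1#)
      (ω-tr-Z : ∀ E → ω * tr (Z * E) ≈ Z * tr E)
      (jump insertions : Letter → Profile → Carrier)
      (jump-eq : ∀ x w → jump x w ≈ wt (descent x (new Sign.+)) * insertions (new Sign.+) w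
                                  + wt (descent x (new Sign.-)) * insertions (new Sign.-) w)
      (insertions-[] : ∀ x → insertions x [] ≈ 1# + Z * jump x [])
      (insertions-∷ : ∀ x y ys → insertions x (y ∷ ys) ≈
         wt (descent x (toLetter y)) * insertions (toLetter y) ys + Z * jump x (y ∷ ys))
      where

      private
        factor′ : Bool → Carrier
        factor′ d = if d then b else a

        ∏ : (Bool → Carrier) → Letter → Profile → Carrier
        ∏ h x []       = 1#
        ∏ h x (y ∷ ys) = h (descent x (toLetter y)) * ∏ h (toLetter y) ys

        cancel-ω^ : ∀ m {f g} → (ω ^ m) * f ≈ (ω ^ m) * g → f ≈ g
        cancel-ω^ zero    eq = trans (sym (*-identityˡ _)) (trans eq (*-identityˡ _))
        cancel-ω^ (suc m) eq = cancel-ω^ m (cancel-unit ω-inverse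
          (trans (sym (*-assoc _ _ _)) (trans eq (*-assoc _ _ _))))

        ω-tr-double : ∀ E → ω * tr (E + (Z * E + Z * E)) ≈ β * tr E
        ω-tr-double E = begin
          ω * tr (E + (Z * E + Z * E))                    ≈⟨ *-congˡ (trans (tr-+ E _) (+-congˡ (tr-+ _ _))) ⟩
          ω * (tr E + (tr (Z * E) + tr (Z * E)))          ≈⟨ trans (distribˡ ω _ _) (+-congˡ (distribˡ ω _ _)) ⟩
          ω * tr E + (ω * tr (Z * E) + ω * tr (Z * E))    ≈⟨ +-congˡ (+-cong (ω-tr-Z E) (ω-tr-Z E)) ⟩
          ω * tr E + (Z * tr E + Z * tr E)                ≈⟨ trans (+-congˡ (sym (distribʳ (tr E) Z Z))) (sym (distribʳ (tr E) ω _)) ⟩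
          β * tr E                                        ∎

        ω-tr-b : ∀ E → ω * tr (b * E) ≈ (T * β) * tr E
        ω-tr-b E = begin
          ω * tr (b * E)                        ≈⟨ *-congˡ (trans (tr-cong (solve 3 (λ T Z E →
                                                     T :* (con 1 :+ (Z :+ Z)) :* E := T :* (E :+ (Z :* E :+ Z :* E)))
                                                     refl T Z E)) (tr-T _)) ⟩
          ω * (T * tr (E + (Z * E + Z * E)))    ≈⟨ *-x∙yz≈y∙xz ω T _ ⟩
          T * (ω * tr (E + (Z * E + Z * E)))    ≈⟨ *-congˡ (ω-tr-double E) ⟩
          T * (β * tr E)                        ≈⟨ *-assoc T β _ ⟨
          (T * β) * tr E                        ∎

        ω-tr-a : ∀ E → ω * tr (a * E) ≈ α * tr E
        ω-tr-a E = begin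
          ω * tr (a * E)                                    ≈⟨ *-congˡ (tr-cong (solve 3 (λ T Z E →
                                                                 (con 1 :+ (T :* Z :+ T :* Z)) :* E := E :+ (T :* (Z :* E) :+ T :* (Z :* E)))
                                                                 refl T Z E)) ⟩
          ω * tr (E + (T * (Z * E) + T * (Z * E)))          ≈⟨ *-congˡ (trans (tr-+ E _) (+-congˡ (trans (tr-+ _ _) (+-cong (tr-T _) (tr-T _))))) ⟩
          ω * (tr E + (T * tr (Z * E) + T * tr (Z * E)))    ≈⟨ solve 4 (λ ω E T ZE → ω :* (E :+ (T :* ZE :+ T :* ZE)) :=
                                                                 ω :* E :+ (T :* (ω :* ZE) :+ T :* (ω :* ZE))) refl ω (tr E) T (tr (Z * E)) ⟩
          ω * tr E + (T * (ω * tr (Z * E)) + T * (ω * tr (Z * E)))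
                                                            ≈⟨ +-congˡ (+-cong (*-congˡ (ω-tr-Z E)) (*-congˡ (ω-tr-Z E))) ⟩
          ω * tr E + (T * (Z * tr E) + T * (Z * tr E))      ≈⟨ solve 4 (λ ω E T Z → ω :* E :+ (T :* (Z :* E) :+ T :* (Z :* E)) :=
                                                                 (ω :+ (T :* Z :+ T :* Z)) :* E) refl ω (tr E) T Z ⟩
          α * tr E                                          ∎

        -- Each letter of `w` uses one power of ω to turn its factor into α or Tβ; the additional
        -- power cancels tr 1 = 1/ω. The exponent is thus the number of gaps.
        ω^-tr-∏ : ∀ x w → ω ^ suc (length w) * tr (∏ factor′ x w) ≈ ∏ factor x w
        ω^-tr-∏ x []       = trans (*-congʳ (*-identityʳ ω)) ω-tr-1
        ω^-tr-∏ x (y ∷ ys) = begin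
          (ω * ω^m) * tr (factor′ d * E)          ≈⟨ trans (*-congʳ (*-comm ω ω^m)) (*-assoc ω^m ω _) ⟩
          ω^m * (ω * tr (factor′ d * E))          ≈⟨ *-congˡ (step d) ⟩
          ω^m * (factor d * tr E)                 ≈⟨ *-x∙yz≈y∙xz ω^m (factor d) _ ⟩
          factor d * (ω^m * tr E)                 ≈⟨ *-congˡ (ω^-tr-∏ (toLetter y) ys) ⟩
          factor d * ∏ factor (toLetter y) ys     ∎
          where
          d = descent x (toLetter y)
          E = ∏ factor′ (toLetter y) ys
          ω^m = ω ^ suc (length ys)
          step : ∀ d → ω * tr (factor′ d * E) ≈ factor d * tr E
          step false = ω-tr-a E
          step true  = ω-tr-b E

        insertions-[]′ : ∀ x → insertions x [] ≈ 1# * 1# + Z * _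
        insertions-[]′ x = trans (insertions-[] x) (+-cong (sym (*-identityˡ 1#)) (*-congˡ (jump-eq x [])))

        insertions-∷′ : ∀ x y ys → insertions x (y ∷ ys) ≈ wt (descent x (toLetter y)) * insertions (toLetter y) ys + Z * _
        insertions-∷′ x y ys = trans (insertions-∷ x y ys) (+-congˡ (*-congˡ (jump-eq x (y ∷ ys))))

        ω-insertions-[] : ∀ x → ω * insertions x [] ≈ gapEnd x * 1#
        ω-insertions-[] x = gap-solve _ _ _ _ _ _ _ _ _
          (insertions-[]′ (new Sign.+)) (insertions-[]′ (new Sign.-)) (insertions-[]′ x)

        ω-insertions-∷ : ∀ x y ys → ω * insertions x (y ∷ ys) ≈ gapAt x (toLetter y) * insertions (toLetter y) ys
        ω-insertions-∷ x y ys = gap-solve _ _ _ _ _ _ _ _ _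
          (insertions-∷′ (new Sign.+) y ys) (insertions-∷′ (new Sign.-) y ys) (insertions-∷′ x y ys)

        ω^-insertions : ∀ k b₀ w → ω ^ suc (length w) * insertions (old k b₀) w ≈ potential k * ∏ factor (old k b₀) w
        ω^-insertions k b₀ [] = begin
          (ω * 1#) * insertions (old k b₀) []   ≈⟨ *-congʳ (*-identityʳ ω) ⟩
          ω * insertions (old k b₀) []          ≈⟨ ω-insertions-[] (old k b₀) ⟩
          gapEnd (old k b₀) * 1#                ≈⟨ *-congʳ (end k b₀) ⟩
          potential k * 1#                      ∎
        ω^-insertions k b₀ ((k′ , b′) ∷ ys) = begin
          (ω * ω^m) * insertions x (y ∷ ys)
            ≈⟨ trans (*-congʳ (*-comm ω ω^m)) (*-assoc ω^m ω _) ⟩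
          ω^m * (ω * insertions x (y ∷ ys))
            ≈⟨ *-congˡ (ω-insertions-∷ x y ys) ⟩
          ω^m * (gapAt x (toLetter y) * insertions (toLetter y) ys)
            ≈⟨ *-x∙yz≈y∙xz ω^m _ _ ⟩
          gapAt x (toLetter y) * (ω^m * insertions (toLetter y) ys)
            ≈⟨ *-congˡ (ω^-insertions k′ b′ ys) ⟩
          gapAt x (toLetter y) * (potential k′ * ∏ factor (toLetter y) ys)
            ≈⟨ *-assoc _ _ _ ⟨
          (gapAt x (toLetter y) * potential k′) * ∏ factor (toLetter y) ys
            ≈⟨ *-congʳ (transfer k b₀ k′ b′) ⟩
          (potential k * factor (descent x (toLetter y))) * ∏ factor (toLetter y) ys
            ≈⟨ *-assoc _ _ _ ⟩
          potential k * ∏ factor x (y ∷ ys) ∎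
          where
          x = old k b₀
          y = k′ , b′
          ω^m = ω ^ suc (length ys)

        -- In this form the word enters only through its length and its number of descents, so that
        -- a sum over words of one length becomes a descent polynomial evaluated at b/a.
        ∏-factor′ : ∀ x w → ∏ factor′ x w ≈ a ^ length w * (b * a⁻¹) ^ descents x (List.map toLetter w)
        ∏-factor′ x []       = sym (*-identityˡ 1#)
        ∏-factor′ x (y ∷ ys) = trans (*-congˡ (∏-factor′ (toLetter y) ys)) (step (descent x (toLetter y)))
          where
          a^m q : Carrier
          a^m = a ^ length ys
          q = (b * a⁻¹) ^ descents (toLetter y) (List.map toLetter ys)
          step : ∀ d → factor′ d * (a^m * q)
                 ≈ (a * a^m) * (b * a⁻¹) ^ (indicator d ℕ.+ descents (toLetter y) (List.map toLetter ys))
          step false = sym (*-assoc a a^m q)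
          step true  = begin
            b * (a^m * q)                 ≈⟨ *-congʳ (trans (*-x∙yz≈y∙xz a b a⁻¹) (trans (*-congˡ a-inverse) (*-identityʳ b))) ⟨
            (a * (b * a⁻¹)) * (a^m * q)   ≈⟨ *-CSG.interchange a (b * a⁻¹) a^m q ⟩
            (a * a^m) * ((b * a⁻¹) * q)   ∎

      insertions-closed : ∀ b₀ w → insertions (old low b₀) w ≈
        tr (a ^ length w * (b * a⁻¹) ^ descents (old low b₀) (List.map toLetter w))
      insertions-closed b₀ w = trans
        (cancel-ω^ (suc (length w)) (trans (ω^-insertions low b₀ w)
          -- The word follows the letter π₀ = 0, which counts as low and has potential 1, so no
          -- potential is left over after telescoping.
          (trans (trans (*-congʳ unit) (*-identityˡ _)) (sym (ω^-tr-∏ (old low b₀) w)))))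
        (tr-cong (∏-factor′ (old low b₀) w))

module UnitLemma {c ℓ} (R : CommutativeRing c ℓ) where
  open CommutativeRing R
  open SetoidReasoning setoid

  unit-lemma : ∀ T Z m → m + (1# + T) ≈ 0# → (1# + m * Z) + (Z + T * Z) ≈ 1#
  unit-lemma T Z m m+u≈0 = begin
    (1# + m * Z) + (Z + T * Z)           ≈⟨ +-assoc _ _ _ ⟩
    1# + (m * Z + (Z + T * Z))           ≈⟨ +-congˡ (+-congˡ (+-congʳ (*-identityˡ Z))) ⟨
    1# + (m * Z + (1# * Z + T * Z))      ≈⟨ +-congˡ (trans (distribʳ Z m _) (+-congˡ (distribʳ Z 1# T))) ⟨
    1# + (m + (1# + T)) * Z              ≈⟨ +-congˡ (trans (*-congʳ m+u≈0) (zeroˡ Z)) ⟩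
    1# + 0#                              ≈⟨ +-identityʳ 1# ⟩
    1#                                   ∎

-- The insertion series and its closed form

module Insertion {c ℓ} (R : CommutativeRing c ℓ) (t : CommutativeRing.Carrier R) where
  open CommutativeRing R
  private
    𝕊 = Series.commutativeRing R
    module S = CommutativeRing 𝕊
    module SO = Ops S.rawRing
  open Ops rawRing using (_^_)
  open SeriesLemmas R
  open PowerSeries rawRing using (1+_X; 1/1+_X)
  open RingProperties ring using (-‿distribˡ-*)

  u : Carrier
  u = 1# + t

  weight : Bool → Carrier
  weight b = if b then t else 1#

  -- The coefficient of zᶠ sums t^des over the insertions of f fixed
  -- points into a word that follows the given letter.
  insertions jump : Letter → Profile → S.Carrier
  insertions x []       zero    = 1#
  insertions x (y ∷ ys) zero    = weight (descent x (toLetter y)) * insertions (toLetter y) ys 0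
  insertions x []       (suc f) = jump x [] f
  insertions x (y ∷ ys) (suc f) = weight (descent x (toLetter y)) * insertions (toLetter y) ys (suc f) + jump x (y ∷ ys) f
  jump x w f = weight (descent x (new Sign.+)) * insertions (new Sign.+) w f
             + weight (descent x (new Sign.-)) * insertions (new Sign.-) w f

  -- tr E is E(z/(1-uz))/(1-uz).
  tr : S.Carrier → S.Carrier
  tr E zero    = E 0
  tr E (suc f) = u * tr E f + tr (E ∘ suc) f

  T Z ω : S.Carrier
  T = C t
  Z = X
  ω = 1+ (- u) X

  private
    module CH = Hom {A = R} {B = 𝕊} C-isHom

    ω-unit : ω S.+ (Z S.+ T S.* Z) S.≈ S.1#
    ω-unit = S.trans (S.+-congʳ {Z S.+ T S.* Z} (1+X≈ (- u))) (UnitLemma.unit-lemma 𝕊 T Z (C (- u))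
      (S.trans (S.sym (S.trans (CH.+-homo (- u) u) (S.+-congˡ {C (- u)} (CH.+-homo 1# t)))) (S.trans (CH.cong (-‿inverseˡ u)) CH.0#-homo)))

  private
    module G = Gap.At 𝕊 T Z ω ω-unit
  open G public using (a; b)

  tr-cong : ∀ {E E′} → E S.≈ E′ → tr E S.≈ tr E′
  tr-cong E≈ zero    = E≈ 0
  tr-cong E≈ (suc f) = +-cong (*-congˡ (tr-cong E≈ f)) (tr-cong (E≈ ∘ suc) f)

  tr-+ : ∀ E E′ → tr (E S.+ E′) S.≈ tr E S.+ tr E′
  tr-+ E E′ zero    = refl
  tr-+ E E′ (suc f) = begin
    u * tr (E S.+ E′) f + tr ((E S.+ E′) ∘ suc) f
      ≈⟨ +-cong (trans (*-congˡ (tr-+ E E′ f)) (distribˡ u _ _)) (tr-+ (E ∘ suc) (E′ ∘ suc) f) ⟩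
    (u * tr E f + u * tr E′ f) + (tr (E ∘ suc) f + tr (E′ ∘ suc) f)
      ≈⟨ +-interchange _ _ _ _ ⟩
    tr E (suc f) + tr E′ (suc f) ∎
    where
    open SetoidReasoning setoid
    open CSG +-commutativeSemigroup using () renaming (interchange to +-interchange)

  tr-0 : tr S.0# S.≈ S.0#
  tr-0 zero    = refl
  tr-0 (suc f) = trans (+-cong (trans (*-congˡ (tr-0 f)) (zeroʳ u)) (tr-0 f)) (+-identityˡ 0#)

  tr-scale : ∀ a E n → tr (λ i → a * E i) n ≈ a * tr E n
  tr-scale a E zero    = refl
  tr-scale a E (suc f) = trans (+-cong (trans (*-congˡ (tr-scale a E f)) (x∙yz≈y∙xz u a _)) (tr-scale a (E ∘ suc) f))
    (sym (distribˡ a _ _))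
    where open CSG *-commutativeSemigroup using (x∙yz≈y∙xz)

  tr-C : ∀ a E → tr (C a S.* E) S.≈ C a S.* tr E
  tr-C a E n = trans (tr-cong (C-* a E) n) (trans (tr-scale a E n) (sym (C-* a (tr E) n)))

  private
    ω-suc : ∀ g n → (ω S.* g) (suc n) ≈ g (suc n) + - (u * g n)
    ω-suc g n = +-cong (*-identityˡ _) (trans (C-* (- u) g n) (sym (-‿distribˡ-* u (g n))))

    cancel-u : ∀ a b → (a + b) + - a ≈ b
    cancel-u a b = trans (+-congʳ (+-comm a b)) (trans (+-assoc b a (- a)) (trans (+-congˡ (-‿inverseʳ a)) (+-identityʳ b)))

    ω-tr-Z : ∀ E → ω S.* tr (Z S.* E) S.≈ Z S.* tr E
    ω-tr-Z E zero    = trans (+-identityʳ _) (trans (*-identityˡ _) (trans (X-*-zero E) (sym (X-*-zero (tr E)))))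
    ω-tr-Z E (suc n) = begin
      (ω S.* tr (Z S.* E)) (suc n)                                ≈⟨ ω-suc (tr (Z S.* E)) n ⟩
      (u * tr (Z S.* E) n + tr ((Z S.* E) ∘ suc) n) + - (u * tr (Z S.* E) n)  ≈⟨ cancel-u _ _ ⟩
      tr ((Z S.* E) ∘ suc) n                                      ≈⟨ tr-cong (X-*-suc E) n ⟩
      tr E n                                                      ≈⟨ X-*-suc (tr E) n ⟨
      (Z S.* tr E) (suc n)                                        ∎
      where open SetoidReasoning setoid

    ω-tr-1 : ω S.* tr S.1# S.≈ S.1#
    ω-tr-1 zero    = trans (+-identityʳ _) (*-identityˡ _)
    ω-tr-1 (suc n) = trans (ω-suc (tr S.1#) n) (trans (cancel-u _ _) (tr-0 n))

    C-weight : ∀ d g n → (G.wt d S.* g) n ≈ weight d * g n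
    C-weight false g n = trans (S.*-identityˡ g n) (sym (*-identityˡ _))
    C-weight true  g n = C-* t g n

    jump-eq : ∀ x w → jump x w S.≈ G.wt (descent x (new Sign.+)) S.* insertions (new Sign.+) w
                              S.+ G.wt (descent x (new Sign.-)) S.* insertions (new Sign.-) w
    jump-eq x w n = sym (+-cong (C-weight (descent x (new Sign.+)) (insertions (new Sign.+) w) n)
                                (C-weight (descent x (new Sign.-)) (insertions (new Sign.-) w) n))

    insertions-[] : ∀ x → insertions x [] S.≈ S.1# S.+ Z S.* jump x []
    insertions-[] x zero    = sym (trans (+-congˡ (X-*-zero (jump x []))) (+-identityʳ _))
    insertions-[] x (suc f) = sym (trans (+-congˡ (X-*-suc (jump x []) f)) (+-identityˡ _))

    insertions-∷ : ∀ x y ys → insertions x (y ∷ ys) S.≈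
      G.wt (descent x (toLetter y)) S.* insertions (toLetter y) ys S.+ Z S.* jump x (y ∷ ys)
    insertions-∷ x y ys zero    = sym (trans (+-cong (C-weight (descent x (toLetter y)) (insertions (toLetter y) ys) 0)
      (X-*-zero (jump x (y ∷ ys)))) (+-identityʳ _))
    insertions-∷ x y ys (suc f) = sym (+-cong (C-weight (descent x (toLetter y)) (insertions (toLetter y) ys) (suc f))
      (X-*-suc (jump x (y ∷ ys)) f))

  a⁻¹ : S.Carrier
  a⁻¹ = 1/1+ (t + t) X

  a-inverse : a S.* a⁻¹ S.≈ S.1#
  a-inverse = S.trans (S.*-congʳ {a⁻¹} (S.sym (S.trans (1+X≈ (t + t)) (S.+-congˡ {S.1#}
    (S.trans (S.*-congʳ {Z} (CH.+-homo t t)) (S.distribʳ Z T T)))))) (1+X-inverse (t + t))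

  insertions-closed : ∀ b₀ w → insertions (old low b₀) w S.≈
    tr ((a SO.^ length w) S.* ((b S.* a⁻¹) SO.^ descents (old low b₀) (List.map toLetter w)))
  insertions-closed = G.Telescope.insertions-closed (1/1+ (- u) X) (1+X-inverse (- u)) a⁻¹ a-inverse
    tr tr-cong tr-+ (tr-C t) ω-tr-1 ω-tr-Z jump insertions jump-eq insertions-[] insertions-∷

-- Signed involutions

module SignedInvolutions where
  open ≡

  unique-↭ : ∀ {a} {A : Set a} {xs ys : List A} → Unique xs → Unique ys →
             (∀ {x} → x ∈ xs → x ∈ ys) → (∀ {x} → x ∈ ys → x ∈ xs) → xs ↭ ys
  unique-↭ xs! ys! xs⊆ys ys⊆xs = ∼bag⇒↭ (unique∧set⇒bag xs! ys! (mk⇔ xs⊆ys ys⊆xs))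

  module _ {n} {P : Fin n → Set} (P? : Decidable P) where
    ∈-filterFin⁺ : ∀ {i} → P i → i ∈ filter P? (allFin n)
    ∈-filterFin⁺ = ∈-filter⁺ P? (∈-allFin _)

    ∈-filterFin⁻ : ∀ {i} → i ∈ filter P? (allFin n) → P i
    ∈-filterFin⁻ = proj₂ ∘ ∈-filter⁻ P? {xs = allFin n}

    filterFin! : Unique (filter P? (allFin n))
    filterFin! = Unique.filter⁺ P? (Unique.allFin⁺ n)

  vectors⁺ : ∀ {A : Set} {as : List A} → (∀ a → a ∈ as) → ∀ {m} (v : Vec A m) → v ∈ vectors as m
  vectors⁺ all []      = here refl
  vectors⁺ all (x ∷ v) = ∈-cartesianProductWith⁺ _∷_ (all x) (vectors⁺ all v)

  vectors! : ∀ {A : Set} {as : List A} → Unique as → ∀ m → Unique (vectors as m)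
  vectors! as! zero    = [] ∷ []
  vectors! as! (suc m) = Unique.cartesianProductWith⁺ _∷_ Vec.∷-injective as! (vectors! as! m)

  words⁺ : ∀ {n} (π : Word n) → π ∈ words n
  words⁺ = vectors⁺ λ { (s , i) → ∈-cartesianProduct⁺ (sign s) (∈-allFin i) }
    where
    sign : ∀ s → s ∈ Sign.+ ∷ Sign.- ∷ []
    sign Sign.+ = here refl
    sign Sign.- = there (here refl)

  words! : ∀ n → Unique (words n)
  words! n = vectors! (Unique.cartesianProduct⁺ (((λ ()) ∷ []) ∷ [] ∷ []) (Unique.allFin⁺ n)) n

  sgn : ∀ {n} → Word n → Fin n → Sign
  sgn π i = proj₁ (lookup π i)

  -- π(πᵢ) = i for the positive letters i, with the sign of πᵢ moved to the right.
  Involutive : ∀ {n} → Word n → Set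
  Involutive π = ∀ i → lookup π (abs π i) ≡ (sgn π i , i)

  abs-involutive : ∀ {n} {π : Word n} → Involutive π → ∀ i → abs π (abs π i) ≡ i
  abs-involutive inv i = cong proj₂ (inv i)

  module _ {n} {π : Word n} where
    isInvolution⇒involutive : IsInvolution π → Involutive π
    isInvolution⇒involutive h i = cong₂ _,_ (signs (sgn π i) _ (cong proj₁ (h (Sign.+ , i)))) (cong proj₂ (h (Sign.+ , i)))
      where
      signs : ∀ s s′ → s Sign.* s′ ≡ Sign.+ → s′ ≡ s
      signs Sign.+ Sign.+ _ = refl
      signs Sign.- Sign.- _ = refl

    involutive⇒isInvolution : Involutive π → IsInvolution π
    involutive⇒isInvolution inv (s , i) = cong₂ _,_
      (trans (cong (s Sign.* sgn π i Sign.*_) (cong proj₁ (inv i)))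
        (trans (Sign.*-assoc s (sgn π i) (sgn π i)) (trans (cong (s Sign.*_) (Sign.s*s≡+ (sgn π i))) (Sign.*-identityʳ s))))
      (cong proj₂ (inv i))

    involutive⇒isSignedPermutation : Involutive π → IsSignedPermutation π
    involutive⇒isSignedPermutation inv =
      (λ {i} {j} eq → trans (sym (abs-involutive {π = π} inv i)) (trans (cong (abs π) eq) (abs-involutive {π = π} inv j)))
      , λ j → abs π j , λ { refl → abs-involutive {π = π} inv j }

    ∈𝓘⁺ : Involutive π → π ∈ 𝓘 n
    ∈𝓘⁺ inv = ∈-filter⁺ (λ π → isSignedPermutation? π ×-dec isInvolution? π) (words⁺ π)
      (involutive⇒isSignedPermutation inv , involutive⇒isInvolution inv)

    ∈𝓘⁻ : π ∈ 𝓘 n → Involutive π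
    ∈𝓘⁻ π∈ = isInvolution⇒involutive
      (proj₂ (proj₂ (∈-filter⁻ (λ π → isSignedPermutation? π ×-dec isInvolution? π) {xs = words n} π∈)))

  𝓘! : ∀ n → Unique (𝓘 n)
  𝓘! n = Unique.filter⁺ (λ π → isSignedPermutation? π ×-dec isInvolution? π) (words! n)

  ins : ∀ {n} → Fin (suc n) → Sign → Word n → Word (suc n)
  ins p s τ = insertAt (Vec.map (map₂ (punchIn p)) τ) p (s , p)

  lookup-ext : ∀ {a} {A : Set a} {n} {xs ys : Vec A n} → (∀ i → lookup xs i ≡ lookup ys i) → xs ≡ ys
  lookup-ext {xs = xs} {ys} eq =
    trans (sym (Vec.tabulate∘lookup xs)) (trans (Vec.tabulate-cong eq) (Vec.tabulate∘lookup ys))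

  punchIn-view : ∀ {n} (p j : Fin (suc n)) → j ≡ p ⊎ ∃ λ i → j ≡ punchIn p i
  punchIn-view p j with p Fin.≟ j
  ... | yes p≡j = inj₁ (sym p≡j)
  ... | no  p≢j = inj₂ (punchOut p≢j , sym (Fin.punchIn-punchOut p≢j))

  module _ {n} (p : Fin (suc n)) (s : Sign) where
    ins-here : ∀ τ → lookup (ins p s τ) p ≡ (s , p)
    ins-here τ = Vec.insertAt-lookup (Vec.map (map₂ (punchIn p)) τ) p (s , p)

    ins-there : ∀ τ i → lookup (ins p s τ) (punchIn p i) ≡ map₂ (punchIn p) (lookup τ i)
    ins-there τ i = trans (Vec.insertAt-punchIn (Vec.map (map₂ (punchIn p)) τ) p (s , p) i)
                          (Vec.lookup-map i (map₂ (punchIn p)) τ)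

    map₂-punchIn-injective : ∀ {x y : ±[ n ]} → map₂ (punchIn p) x ≡ map₂ (punchIn p) y → x ≡ y
    map₂-punchIn-injective eq = let s≡ , i≡ = ,-injective eq in cong₂ _,_ s≡ (Fin.punchIn-injective p _ _ i≡)

    ins-injective : ∀ {τ τ′} → ins p s τ ≡ ins p s τ′ → τ ≡ τ′
    ins-injective {τ} {τ′} eq = lookup-ext λ i → map₂-punchIn-injective
      (trans (sym (ins-there τ i)) (trans (cong (λ π → lookup π (punchIn p i)) eq) (ins-there τ′ i)))

    ins-involutive : ∀ {τ} → Involutive τ → Involutive (ins p s τ)
    ins-involutive {τ} inv j with punchIn-view p j
    ... | inj₁ refl       rewrite ins-here τ = ins-here τ
    ... | inj₂ (i , refl) rewrite ins-there τ i =
          trans (ins-there τ (abs τ i)) (cong (map₂ (punchIn p)) (inv i))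

    ins-surjective : ∀ {π} → Involutive π → lookup π p ≡ (s , p) → ∃ λ τ → Involutive τ × π ≡ ins p s τ
    ins-surjective {π} inv πp = τ , τ-inv , sym ins-τ
      where
      -- A letter at another position with absolute value `p` would, by involutivity, make that
      -- position the absolute value of π(p), which is `p`.
      avoid : ∀ i → p ≢ abs π (punchIn p i)
      avoid i p≡ = Fin.punchInᵢ≢i p i
        (trans (sym (cong proj₂ (inv (punchIn p i)))) (trans (cong (abs π) (sym p≡)) (cong proj₂ πp)))
      τ : Word n
      τ = tabulate λ i → sgn π (punchIn p i) , punchOut (avoid i)
      ins-τ : ins p s τ ≡ π
      ins-τ = lookup-ext λ j → case punchIn-view p j of λ
        { (inj₁ refl) → trans (ins-here τ) (sym πp)
        ; (inj₂ (i , refl)) → trans (ins-there τ i) (trans (cong (map₂ (punchIn p)) (Vec.lookup∘tabulate _ i))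
                                    (cong (sgn π (punchIn p i) ,_) (Fin.punchIn-punchOut (avoid i)))) }
      τ-inv : Involutive τ
      τ-inv i = map₂-punchIn-injective (trans (sym (ins-there τ (abs τ i)))
        (trans (cong (lookup (ins p s τ)) (sym (cong proj₂ (ins-there τ i))))
          (trans (subst Involutive (sym ins-τ) inv (punchIn p i)) (cong (_, punchIn p i) (cong proj₁ (ins-there τ i))))))

    abs-here : ∀ τ → abs (ins p s τ) p ≡ p
    abs-here τ = cong proj₂ (ins-here τ)

    abs-there : ∀ τ i → abs (ins p s τ) (punchIn p i) ≡ punchIn p (abs τ i)
    abs-there τ i = cong proj₂ (ins-there τ i)

    fixed-there⁺ : ∀ τ {i} → abs τ i ≡ i → abs (ins p s τ) (punchIn p i) ≡ punchIn p i
    fixed-there⁺ τ {i} eq = trans (abs-there τ i) (cong (punchIn p) eq)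

    fixed-there⁻ : ∀ τ {i} → abs (ins p s τ) (punchIn p i) ≡ punchIn p i → abs τ i ≡ i
    fixed-there⁻ τ {i} eq = Fin.punchIn-injective p _ _ (trans (sym (abs-there τ i)) eq)

    fix-ins : ∀ τ → fix (ins p s τ) ≡ suc (fix τ)
    fix-ins τ = trans (↭-length (unique-↭ (filterFin! Fix?)
        (All.tabulate (λ q∈ p≡q → case ∈-map⁻ (punchIn p) q∈ of λ { (i , _ , q≡) → Fin.punchInᵢ≢i p i (sym (trans p≡q q≡)) })
         ∷ Unique.map⁺ (Fin.punchIn-injective p _ _) (filterFin! Fixτ?)) to from))
      (cong suc (length-map (punchIn p) (filter Fixτ? (allFin n))))
      where
      Fix? = λ i → abs (ins p s τ) i Fin.≟ i
      Fixτ? = λ i → abs τ i Fin.≟ i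
      to : ∀ {j} → j ∈ filter Fix? (allFin (suc n)) → j ∈ p ∷ List.map (punchIn p) (filter Fixτ? (allFin n))
      to {j} j∈ with punchIn-view p j
      ... | inj₁ j≡p        = here j≡p
      ... | inj₂ (i , refl) = there (∈-map⁺ (punchIn p) (∈-filterFin⁺ Fixτ? (fixed-there⁻ τ (∈-filterFin⁻ Fix? j∈))))
      from : ∀ {j} → j ∈ p ∷ List.map (punchIn p) (filter Fixτ? (allFin n)) → j ∈ filter Fix? (allFin (suc n))
      from (here refl) = ∈-filterFin⁺ Fix? (abs-here τ)
      from (there j∈) with i , i∈ , refl ← ∈-map⁻ (punchIn p) j∈ =
        ∈-filterFin⁺ Fix? (fixed-there⁺ τ (∈-filterFin⁻ Fixτ? i∈))

  NoFixBelow : ∀ {n} → ℕ → Word n → Set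
  NoFixBelow g π = ∀ i → toℕ i ℕ.< g → abs π i ≢ i

  inClass? : ∀ {n} g f → Decidable (λ (π : Word n) → NoFixBelow g π × fix π ≡ f)
  inClass? g f π = Fin.all? (λ i → (toℕ i ℕ.<? g) →-dec ¬? (abs π i Fin.≟ i)) ×-dec (fix π ℕ.≟ f)

  -- The bound `g` is the current position of a scan for fixed points from left to right. At `g` = 0
  -- the class consists of all involutions with f fixed points.
  class : ∀ n (g f : ℕ) → List (Word n)
  class n g f = filter (inClass? g f) (𝓘 n)

  module _ {n g f : ℕ} {π : Word n} where
    ∈class⁺ : Involutive π → NoFixBelow g π → fix π ≡ f → π ∈ class n g f
    ∈class⁺ inv noFix fix≡ = ∈-filter⁺ (inClass? g f) (∈𝓘⁺ inv) (noFix , fix≡)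

    ∈class⁻ : π ∈ class n g f → Involutive π × NoFixBelow g π × fix π ≡ f
    ∈class⁻ π∈ = Product.map₁ ∈𝓘⁻ (∈-filter⁻ (inClass? g f) {xs = 𝓘 n} π∈)

  class! : ∀ n g f → Unique (class n g f)
  class! n g f = Unique.filter⁺ (inClass? g f) (𝓘! n)

  fixed⇒0<fix : ∀ {n} (π : Word n) i → abs π i ≡ i → 0 ℕ.< fix π
  fixed⇒0<fix π i eq with filter (λ i → abs π i Fin.≟ i) (allFin _) | ∈-filterFin⁺ (λ i → abs π i Fin.≟ i) eq
  ... | _ ∷ _ | _ = s≤s z≤n

  0<fix⇒fixed : ∀ {n} (π : Word n) → 0 ℕ.< fix π → ∃ λ i → abs π i ≡ i
  0<fix⇒fixed π 0<fix with filter (λ i → abs π i Fin.≟ i) (allFin _) in eq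
  ... | i ∷ _ = i , ∈-filterFin⁻ (λ i → abs π i Fin.≟ i) (subst (i ∈_) (sym eq) (here refl))

  -- Without fixed points the bound says nothing, so every branch of the scan ends in the same set
  -- of fixed-point-free involutions σ.
  class-zero : ∀ n g → class n g 0 ↭ class n 0 0
  class-zero n g = unique-↭ (class! n g 0) (class! n 0 0)
    (λ {π} π∈ → let inv , _ , fix≡0 = ∈class⁻ {g = g} {f = 0} {π = π} π∈ in ∈class⁺ {g = 0} {f = 0} {π = π} inv (λ _ ()) fix≡0)
    (λ {π} π∈ → let inv , _ , fix≡0 = ∈class⁻ {g = 0} {f = 0} {π = π} π∈ in
      ∈class⁺ {g = g} {f = 0} {π = π} inv (λ i _ eq → ℕ.<-irrefl (sym fix≡0) (fixed⇒0<fix π i eq)) fix≡0)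

  class-empty : ∀ n g f → n ℕ.≤ g → class n g (suc f) ↭ []
  class-empty n g f n≤g = unique-↭ (class! n g (suc f)) []
    (λ {π} π∈ → let _ , noFix , fix≡ = ∈class⁻ {g = g} {f = suc f} {π = π} π∈
                    i , eq = 0<fix⇒fixed π (subst (0 ℕ.<_) (sym fix≡) (s≤s z≤n))
                in contradiction eq (noFix i (ℕ.≤-trans (Fin.toℕ<n i) n≤g)))
    (λ ())

  punchIn-below : ∀ {n} (p : Fin (suc n)) (i : Fin n) → toℕ i ℕ.< toℕ p → toℕ (punchIn p i) ℕ.< toℕ p
  punchIn-below (Fin.suc p) Fin.zero    _         = s≤s z≤n
  punchIn-below (Fin.suc p) (Fin.suc i) (s≤s i<p) = s≤s (punchIn-below p i i<p)

  punchIn-below⁻ : ∀ {n} (p : Fin (suc n)) (i : Fin n) → toℕ (punchIn p i) ℕ.< toℕ p → toℕ i ℕ.< toℕ p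
  punchIn-below⁻ (Fin.suc p) Fin.zero    _         = s≤s z≤n
  punchIn-below⁻ (Fin.suc p) (Fin.suc i) (s≤s i<p) = s≤s (punchIn-below⁻ p i i<p)

  -- One step of the scan: position p is not fixed and the bound advances, or it is fixed with one
  -- of the two signs and is deleted. Deletion moves the later positions down by one, so the next
  -- one to inspect has the same number and the bound stays.
  class-split : ∀ {n} (p : Fin (suc n)) f → class (suc n) (toℕ p) (suc f) ↭
    class (suc n) (suc (toℕ p)) (suc f) ++ List.map (ins p Sign.+) (class n (toℕ p) f) ++ List.map (ins p Sign.-) (class n (toℕ p) f)
  class-split {n} p f = unique-↭ (class! (suc n) (toℕ p) (suc f))
    (Unique.++⁺ (class! (suc n) (suc (toℕ p)) (suc f))
      (Unique.++⁺ (Unique.map⁺ (ins-injective p Sign.+) (class! n (toℕ p) f))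
                  (Unique.map⁺ (ins-injective p Sign.-) (class! n (toℕ p) f)) disjoint±)
      disjoint)
    to from
    where
    disjoint± : Disjoint (List.map (ins p Sign.+) (class n (toℕ p) f)) (List.map (ins p Sign.-) (class n (toℕ p) f))
    disjoint± (v∈₊ , v∈₋) with τ , _ , refl ← ∈-map⁻ (ins p Sign.+) v∈₊ | τ′ , _ , eq ← ∈-map⁻ (ins p Sign.-) v∈₋ =
      case trans (sym (ins-here p Sign.+ τ)) (trans (cong (λ π → lookup π p) eq) (ins-here p Sign.- τ′)) of λ ()

    fixes-p : ∀ {π} → π ∈ List.map (ins p Sign.+) (class n (toℕ p) f) ++ List.map (ins p Sign.-) (class n (toℕ p) f) → abs π p ≡ p
    fixes-p π∈ with ∈-++⁻ (List.map (ins p Sign.+) (class n (toℕ p) f)) π∈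
    ... | inj₁ π∈₊ with τ , _ , refl ← ∈-map⁻ (ins p Sign.+) π∈₊ = abs-here p Sign.+ τ
    ... | inj₂ π∈₋ with τ , _ , refl ← ∈-map⁻ (ins p Sign.-) π∈₋ = abs-here p Sign.- τ

    disjoint : Disjoint (class (suc n) (suc (toℕ p)) (suc f)) _
    disjoint {π} (π∈ , π∈′) = let _ , noFix , _ = ∈class⁻ {g = suc (toℕ p)} {f = suc f} {π = π} π∈ in
      noFix p ℕ.≤-refl (fixes-p π∈′)

    insert : ∀ s π → Involutive π → NoFixBelow (toℕ p) π → fix π ≡ suc f → lookup π p ≡ (s , p) →
             π ∈ List.map (ins p s) (class n (toℕ p) f)
    insert s π inv noFix fix≡ πp with τ , τ-inv , refl ← ins-surjective p s {π} inv πp =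
      ∈-map⁺ (ins p s) (∈class⁺ {g = toℕ p} {f = f} {π = τ} τ-inv
        (λ i i<p eq → noFix (punchIn p i) (punchIn-below p i i<p) (fixed-there⁺ p s τ eq))
        (ℕ.suc-injective (trans (sym (fix-ins p s τ)) fix≡)))

    to : ∀ {π} → π ∈ class (suc n) (toℕ p) (suc f) → π ∈ class (suc n) (suc (toℕ p)) (suc f) ++ _
    to {π} π∈ with ∈class⁻ {g = toℕ p} {f = suc f} {π = π} π∈ | abs π p Fin.≟ p | sgn π p in sgn≡
    ... | inv , noFix , fix≡ | no ¬fixed | _ = ∈-++⁺ˡ (∈class⁺ {g = suc (toℕ p)} {f = suc f} {π = π} inv noFix′ fix≡)
      where
      noFix′ : NoFixBelow (suc (toℕ p)) π
      noFix′ i (s≤s i≤p) with toℕ i ℕ.≟ toℕ p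
      ... | yes i≡p with refl ← Fin.toℕ-injective i≡p = ¬fixed
      ... | no  i≢p = noFix i (ℕ.≤∧≢⇒< i≤p i≢p)
    ... | inv , noFix , fix≡ | yes fixed | Sign.+ = ∈-++⁺ʳ (class (suc n) (suc (toℕ p)) (suc f))
      (∈-++⁺ˡ (insert Sign.+ π inv noFix fix≡ (cong₂ _,_ sgn≡ fixed)))
    ... | inv , noFix , fix≡ | yes fixed | Sign.- = ∈-++⁺ʳ (class (suc n) (suc (toℕ p)) (suc f))
      (∈-++⁺ʳ (List.map (ins p Sign.+) (class n (toℕ p) f)) (insert Sign.- π inv noFix fix≡ (cong₂ _,_ sgn≡ fixed)))

    inserted : ∀ s {τ} → τ ∈ class n (toℕ p) f → ins p s τ ∈ class (suc n) (toℕ p) (suc f)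
    inserted s {τ} τ∈ with inv , noFix , fix≡ ← ∈class⁻ {g = toℕ p} {f = f} {π = τ} τ∈ =
      ∈class⁺ {g = toℕ p} {f = suc f} {π = ins p s τ} (ins-involutive p s inv) noFix′ (trans (fix-ins p s τ) (cong suc fix≡))
      where
      noFix′ : NoFixBelow (toℕ p) (ins p s τ)
      noFix′ j j<p eq with punchIn-view p j
      ... | inj₁ refl       = ℕ.<-irrefl refl j<p
      ... | inj₂ (i , refl) = noFix i (punchIn-below⁻ p i j<p) (fixed-there⁻ p s τ eq)

    from : ∀ {π} → π ∈ class (suc n) (suc (toℕ p)) (suc f) ++ _ → π ∈ class (suc n) (toℕ p) (suc f)
    from {π} π∈ with ∈-++⁻ (class (suc n) (suc (toℕ p)) (suc f)) π∈
    ... | inj₁ π∈′ = let inv , noFix , fix≡ = ∈class⁻ {g = suc (toℕ p)} {f = suc f} {π = π} π∈′ in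
      ∈class⁺ {g = toℕ p} {f = suc f} {π = π} inv (λ i i<p → noFix i (ℕ.m<n⇒m<1+n i<p)) fix≡
    ... | inj₂ π∈′ with ∈-++⁻ (List.map (ins p Sign.+) (class n (toℕ p) f)) π∈′
    ...   | inj₁ π∈₊ with τ , τ∈ , refl ← ∈-map⁻ (ins p Sign.+) π∈₊ = inserted Sign.+ τ∈
    ...   | inj₂ π∈₋ with τ , τ∈ , refl ← ∈-map⁻ (ins p Sign.-) π∈₋ = inserted Sign.- τ∈

  -- Every point is fixed or lies in a two-cycle, as its smaller or its larger element.
  2cyc₂+fix≡n : ∀ {n} {π : Word n} → Involutive π → 2 ℕ.* cyc₂ π ℕ.+ fix π ≡ n
  2cyc₂+fix≡n {n} {π} inv = begin
    2 ℕ.* cyc₂ π ℕ.+ fix π                        ≡⟨ cong (λ c → c ℕ.+ (c ℕ.+ 0) ℕ.+ fix π) cyc₂≡ ⟩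
    length Up ℕ.+ (length Up ℕ.+ 0) ℕ.+ fix π     ≡⟨ cong (λ c → length Up ℕ.+ c ℕ.+ fix π) (trans (ℕ.+-identityʳ _) up≡down) ⟩
    length Up ℕ.+ length Down ℕ.+ fix π           ≡⟨ ℕ.+-assoc (length Up) _ _ ⟩
    length Up ℕ.+ (length Down ℕ.+ fix π)         ≡⟨ cong (length Up ℕ.+_) (length-++ Down) ⟨
    length Up ℕ.+ length (Down ++ Fixed)          ≡⟨ length-++ Up ⟨
    length (Up ++ Down ++ Fixed)                  ≡⟨ ↭-length parts ⟨
    length (allFin n)                             ≡⟨ length-allFin n ⟩
    n                                             ∎
    where
    open ≡-Reasoning
    g = abs π
    gg = abs-involutive {π = π} inv
    up? = λ i → i Fin.<? g i
    down? = λ i → g i Fin.<? i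
    fixed? = λ i → g i Fin.≟ i
    Up = filter up? (allFin n)
    Down = filter down? (allFin n)
    Fixed = filter fixed? (allFin n)
    pair? = λ ((i , j) : Fin n × Fin n) → (i Fin.<? j) ×-dec (g i Fin.≟ j) ×-dec (g j Fin.≟ i)

    length-allFin : ∀ n → length (allFin n) ≡ n
    length-allFin n = length-tabulate id

    cyc₂≡ : cyc₂ π ≡ length Up
    cyc₂≡ = trans (↭-length (unique-↭
        (Unique.filter⁺ pair? (Unique.cartesianProduct⁺ (Unique.allFin⁺ n) (Unique.allFin⁺ n)))
        (Unique.map⁺ (cong proj₁) (filterFin! up?)) to from))
      (length-map (λ i → i , g i) Up)
      where
      to : ∀ {ij} → ij ∈ filter pair? (cartesianProduct (allFin n) (allFin n)) → ij ∈ List.map (λ i → i , g i) Up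
      to {i , j} ij∈ with _ , i<j , refl , _ ← ∈-filter⁻ pair? {xs = cartesianProduct (allFin n) (allFin n)} ij∈ =
        ∈-map⁺ (λ i → i , g i) (∈-filterFin⁺ up? i<j)
      from : ∀ {ij} → ij ∈ List.map (λ i → i , g i) Up → ij ∈ filter pair? (cartesianProduct (allFin n) (allFin n))
      from ij∈ with i , i∈ , refl ← ∈-map⁻ (λ i → i , g i) ij∈ =
        ∈-filter⁺ pair? (∈-cartesianProduct⁺ (∈-allFin i) (∈-allFin (g i))) (∈-filterFin⁻ up? i∈ , refl , gg i)

    up≡down : length Up ≡ length Down
    up≡down = trans (sym (length-map g Up)) (↭-length (unique-↭
      (Unique.map⁺ (λ {i} {j} eq → trans (sym (gg i)) (trans (cong g eq) (gg j))) (filterFin! up?)) (filterFin! down?)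
      (λ k∈ → case ∈-map⁻ g k∈ of λ { (i , i∈ , refl) → ∈-filterFin⁺ down? (subst (Fin._< g i) (sym (gg i)) (∈-filterFin⁻ up? i∈)) })
      (λ {k} k∈ → subst (_∈ List.map g Up) (gg k)
        (∈-map⁺ g (∈-filterFin⁺ up? (subst (g k Fin.<_) (sym (gg k)) (∈-filterFin⁻ down? k∈)))))))

    parts : allFin n ↭ Up ++ Down ++ Fixed
    parts = unique-↭ (Unique.allFin⁺ n)
      (Unique.++⁺ (filterFin! up?) (Unique.++⁺ (filterFin! down?) (filterFin! fixed?)
        (λ (d , f) → Fin.<⇒≢ (∈-filterFin⁻ down? d) (∈-filterFin⁻ fixed? f)))
        λ (u , df) → case ∈-++⁻ Down df of λ
          { (inj₁ d) → Fin.<-asym (∈-filterFin⁻ up? u) (∈-filterFin⁻ down? d)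
          ; (inj₂ f) → Fin.<⇒≢ (∈-filterFin⁻ up? u) (sym (∈-filterFin⁻ fixed? f)) })
      (λ {i} _ → cover i) (λ _ → ∈-allFin _)
      where
      cover : ∀ i → i ∈ Up ++ Down ++ Fixed
      cover i with Fin.<-cmp i (g i)
      ... | tri< i<gi _ _ = ∈-++⁺ˡ (∈-filterFin⁺ up? i<gi)
      ... | tri≈ _ i≡gi _ = ∈-++⁺ʳ Up (∈-++⁺ʳ Down (∈-filterFin⁺ fixed? (sym i≡gi)))
      ... | tri> _ _ gi<i = ∈-++⁺ʳ Up (∈-++⁺ˡ (∈-filterFin⁺ down? gi<i))

open SignedInvolutions

-- Kinds and descents under insertion

module Profiles where
  open ≡

  descentsℤ : ∀ {n} → ℤ → Vec ℤ n → ℕ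
  descentsℤ a []       = 0
  descentsℤ a (b ∷ bs) = indicator (does (b ℤ.<? a)) ℕ.+ descentsℤ b bs

  count-∷ : ∀ {A : Set} {P : A → Set} (P? : Decidable P) x xs → count P? (x ∷ xs) ≡ indicator (does (P? x)) ℕ.+ count P? xs
  count-∷ P? x xs with does (P? x)
  ... | true  = refl
  ... | false = refl

  count-map : ∀ {A B : Set} {P : B → Set} (P? : Decidable P) (f : A → B) xs → count P? (List.map f xs) ≡ count (P? ∘ f) xs
  count-map P? f []       = refl
  count-map P? f (x ∷ xs) = trans (count-∷ P? (f x) (List.map f xs))
    (trans (cong (indicator (does (P? (f x))) ℕ.+_) (count-map P? f xs)) (sym (count-∷ (P? ∘ f) x xs)))

  count-descents : ∀ {n} a (v : Vec ℤ n) →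
    count (λ i → lookup (a ∷ v) (Fin.suc i) ℤ.<? lookup (a ∷ v) (inject₁ i)) (allFin n) ≡ descentsℤ a v
  count-descents a []      = refl
  count-descents a (b ∷ v) = trans (count-∷ P? Fin.zero _) (cong (indicator (does (b ℤ.<? a)) ℕ.+_)
    (trans (cong (count P?) (sym (map-tabulate id Fin.suc)))
      (trans (count-map P? Fin.suc (allFin _)) (count-descents b v))))
    where
    P? = λ i → lookup (a ∷ b ∷ v) (Fin.suc i) ℤ.<? lookup (a ∷ b ∷ v) (inject₁ i)

  des-descentsℤ : ∀ {n} (π : Word n) → des π ≡ descentsℤ (+ 0) (Vec.map value π)
  des-descentsℤ π = count-descents (+ 0) (Vec.map value π)

  -- `punchIn` on bare numbers, so that relabelled values and positions can be compared without
  -- reference to the length of the word.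
  punch : ℕ → ℕ → ℕ
  punch zero    k       = suc k
  punch (suc q) zero    = zero
  punch (suc q) (suc k) = suc (punch q k)

  toℕ-punchIn : ∀ {n} (p : Fin (suc n)) i → toℕ (punchIn p i) ≡ punch (toℕ p) (toℕ i)
  toℕ-punchIn Fin.zero    i           = refl
  toℕ-punchIn (Fin.suc p) Fin.zero    = refl
  toℕ-punchIn (Fin.suc p) (Fin.suc i) = cong suc (toℕ-punchIn p i)

  punch-below : ∀ {q k} → k ℕ.< q → punch q k ≡ k
  punch-below {suc q} {zero}  _         = refl
  punch-below {suc q} {suc k} (s≤s k<q) = cong suc (punch-below k<q)

  punch-above : ∀ {q k} → q ℕ.≤ k → punch q k ≡ suc k
  punch-above {zero}          _         = refl
  punch-above {suc q} {suc k} (s≤s q≤k) = cong suc (punch-above q≤k)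

  punch-≥ : ∀ q k → k ℕ.≤ punch q k
  punch-≥ zero    k       = ℕ.n≤1+n k
  punch-≥ (suc q) zero    = z≤n
  punch-≥ (suc q) (suc k) = s≤s (punch-≥ q k)

  punch-≤ : ∀ q k → punch q k ℕ.≤ suc k
  punch-≤ zero    k       = ℕ.≤-refl
  punch-≤ (suc q) zero    = z≤n
  punch-≤ (suc q) (suc k) = s≤s (punch-≤ q k)

  punch-mono-< : ∀ q {k l} → k ℕ.< l → punch q k ℕ.< punch q l
  punch-mono-< zero    k<l                         = s≤s k<l
  punch-mono-< (suc q) {zero}  {suc l} _           = s≤s z≤n
  punch-mono-< (suc q) {suc k} {suc l} (s≤s k<l)   = s≤s (punch-mono-< q k<l)

  -- The effect on values of inserting a fixed point of absolute value suc q.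
  shift : ℕ → ℤ → ℤ
  shift q (+ 0)         = + 0
  shift q (+ (suc k))   = + suc (punch q k)
  shift q (-[1+ k ])    = -[1+ punch q k ]

  shift-mono-< : ∀ q {v w} → v ℤ.< w → shift q v ℤ.< shift q w
  shift-mono-< q {+ 0}       {+ 0}       (+<+ ())
  shift-mono-< q {+ 0}       {+ suc l}   _               = +<+ (s≤s z≤n)
  shift-mono-< q {+ suc k}   {+ suc l}   (+<+ (s≤s k<l)) = +<+ (s≤s (punch-mono-< q k<l))
  shift-mono-< q { -[1+ k ]} {+ 0}       _               = -<+
  shift-mono-< q { -[1+ k ]} {+ suc l}   _               = -<+
  shift-mono-< q { -[1+ k ]} { -[1+ l ]} (-<- l<k)       = -<- (punch-mono-< q l<k)

  -- Relabelling is strictly increasing on all of ℤ, so it changes no comparison between old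
  -- letters. This preserves the outcomes that their kinds leave open.
  shift-<? : ∀ q v w → does (shift q v ℤ.<? shift q w) ≡ does (v ℤ.<? w)
  shift-<? q v w with ℤ.<-cmp v w
  ... | tri< v<w _ _ = trans (dec-true (_ ℤ.<? _) (shift-mono-< q v<w)) (sym (dec-true (v ℤ.<? w) v<w))
  ... | tri≈ v≮w refl _ = trans (dec-false (shift q v ℤ.<? shift q v) (ℤ.<-irrefl refl)) (sym (dec-false (v ℤ.<? w) v≮w))
  ... | tri> v≮w _ w<v = trans (dec-false (_ ℤ.<? _) (ℤ.<-asym (shift-mono-< q w<v))) (sym (dec-false (v ℤ.<? w) v≮w))

  fixedValue : Sign → ℕ → ℤ
  fixedValue s q = s ◃ suc q

  -- At i v x: the value v in position i ≥ 1, or the initial π₀ = 0, is of type x.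
  data At : ℕ → ℤ → Letter → Set where
    start  : ∀ {b} → At 0 (+ 0) (old low b)
    low    : ∀ {i v b} → ∣ v ∣ ℕ.≤ i → At (suc i) v (old low b)
    above  : ∀ {i k b} → i ℕ.≤ k → At i (+ suc k) (old above b)
    below  : ∀ {i k b} → i ℕ.≤ k → At i -[1+ k ] (old below b)
    fixed₊ : ∀ {i} → At (suc i) (+ suc i) (new Sign.+)
    fixed₋ : ∀ {i} → At (suc i) -[1+ i ] (new Sign.-)

  shift-low-before : ∀ {q i} v → i ℕ.< q → ∣ v ∣ ℕ.≤ i → ∣ shift q v ∣ ℕ.≤ i
  shift-low-before (+ 0)       i<q v≤i = z≤n
  shift-low-before (+ suc k)   i<q v≤i rewrite punch-below (ℕ.≤-<-trans (ℕ.<⇒≤ v≤i) i<q) = v≤i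
  shift-low-before -[1+ k ]    i<q v≤i rewrite punch-below (ℕ.≤-<-trans (ℕ.<⇒≤ v≤i) i<q) = v≤i

  shift-low-after : ∀ {q i} v → ∣ v ∣ ℕ.≤ i → ∣ shift q v ∣ ℕ.≤ suc i
  shift-low-after (+ 0)        v≤i = z≤n
  shift-low-after {q} (+ suc k)    v≤i = s≤s (ℕ.≤-trans (punch-≤ q k) v≤i)
  shift-low-after {q} -[1+ k ]     v≤i = s≤s (ℕ.≤-trans (punch-≤ q k) v≤i)

  -- Left of the insertion positions stay put. Low and fixed letters there have absolute value at
  -- most q and are not relabelled; the others can only move further from their position.
  at-before : ∀ {q i v x} → i ℕ.≤ q → At i v x → At i (shift q v) x
  at-before i≤q start = start
  at-before {v = v} i≤q (low v≤i)   = low (shift-low-before v i≤q v≤i)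
  at-before {q} i≤q (above {k = k} i≤k) = above (ℕ.≤-trans i≤k (punch-≥ q k))
  at-before {q} i≤q (below {k = k} i≤k) = below (ℕ.≤-trans i≤k (punch-≥ q k))
  at-before {q} {suc i} i≤q fixed₊ rewrite punch-below {q} {i} i≤q = fixed₊
  at-before {q} {suc i} i≤q fixed₋ rewrite punch-below {q} {i} i≤q = fixed₋

  -- Right of the insertion the position grows by one. So does every absolute value that is at least
  -- the position, while a smaller one grows by at most one, so no letter changes its type.
  at-after : ∀ {q i v x} → q ℕ.< i → At i v x → At (suc i) (shift q v) x
  at-after {v = v} q<i (low v≤i) = low (shift-low-after v v≤i)
  at-after {q} q<i (above {k = k} i≤k) rewrite punch-above {q} {k} (ℕ.≤-trans (ℕ.<⇒≤ q<i) i≤k) = above (s≤s i≤k)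
  at-after {q} q<i (below {k = k} i≤k) rewrite punch-above {q} {k} (ℕ.≤-trans (ℕ.<⇒≤ q<i) i≤k) = below (s≤s i≤k)
  at-after {q} {suc i} (s≤s q≤i) fixed₊ rewrite punch-above q≤i = fixed₊
  at-after {q} {suc i} (s≤s q≤i) fixed₋ rewrite punch-above q≤i = fixed₋

  at-fixed : ∀ s q → At (suc q) (fixedValue s q) (new s)
  at-fixed Sign.+ q = fixed₊
  at-fixed Sign.- q = fixed₋

  private
    ∣v∣≤i⇒v≤i : ∀ {i} v → ∣ v ∣ ℕ.≤ i → v ℤ.≤ + i
    ∣v∣≤i⇒v≤i (+ k)     le = ℤ.+≤+ le
    ∣v∣≤i⇒v≤i -[1+ k ]  le = ℤ.-≤+

    ∣v∣≤i⇒-i≤v : ∀ {i} v → ∣ v ∣ ℕ.≤ i → -[1+ i ] ℤ.< v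
    ∣v∣≤i⇒-i≤v (+ k)     le = -<+
    ∣v∣≤i⇒-i≤v -[1+ k ]  le = -<- le

    true< : ∀ {v w} → v ℤ.< w → does (v ℤ.<? w) ≡ true
    true< {v} {w} = dec-true (v ℤ.<? w)

    false> : ∀ {v w} → w ℤ.< v → does (v ℤ.<? w) ≡ false
    false> {v} {w} w<v = dec-false (v ℤ.<? w) (ℤ.<-asym w<v)

    <+suc : ∀ {i j} v → ∣ v ∣ ℕ.≤ i → i ℕ.≤ j → v ℤ.< + suc j
    <+suc v le i≤j = ℤ.≤-<-trans (∣v∣≤i⇒v≤i v le) (+<+ (s≤s i≤j))

    -suc< : ∀ {i j} v → ∣ v ∣ ℕ.≤ i → i ℕ.≤ j → -[1+ j ] ℤ.< v
    -suc< v le i≤j = ∣v∣≤i⇒-i≤v v (ℕ.≤-trans le i≤j)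

  -- The letter in position q ends up directly before the new one, whose absolute value is q+1. Its
  -- type places it between -(q+1) and q+1, above both or below both, which decides the comparison
  -- for either sign.
  descent-to-fixed : ∀ s {q v x} → At q v x → does (fixedValue s q ℤ.<? shift q v) ≡ descent x (new s)
  descent-to-fixed Sign.+ start = refl
  descent-to-fixed Sign.- start = refl
  descent-to-fixed Sign.+ {v = v} (low {i} v≤i) = false> (<+suc (shift (suc i) v) (shift-low-before v ℕ.≤-refl v≤i) (ℕ.n≤1+n i))
  descent-to-fixed Sign.- {v = v} (low {i} v≤i) = true< (-suc< (shift (suc i) v) (shift-low-before v ℕ.≤-refl v≤i) (ℕ.n≤1+n i))
  descent-to-fixed Sign.+ {q} (above q≤k) rewrite punch-above q≤k = true< (+<+ (s≤s (s≤s q≤k)))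
  descent-to-fixed Sign.- {q} (above q≤k) = refl
  descent-to-fixed Sign.+ {q} (below {k = k} q≤k) = refl
  descent-to-fixed Sign.- {q} (below q≤k) rewrite punch-above q≤k = false> (-<- (s≤s q≤k))
  descent-to-fixed Sign.+ {suc i} fixed₊ rewrite punch-below {suc i} {i} ℕ.≤-refl = false> { + suc (suc i)} (+<+ ℕ.≤-refl)
  descent-to-fixed Sign.- {suc i} fixed₊ = refl
  descent-to-fixed Sign.+ {suc i} fixed₋ = refl
  descent-to-fixed Sign.- {suc i} fixed₋ rewrite punch-below {suc i} {i} ℕ.≤-refl = true< { -[1+ suc i ]} (-<- ℕ.≤-refl)

  -- The letter that used to stand in position q+1 now follows the new one. If it was fixed itself,
  -- relabelling raises its absolute value to q+2, so its own sign decides the comparison.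
  descent-from-fixed : ∀ s {q v y} → At (suc q) v y → does (shift q v ℤ.<? fixedValue s q) ≡ descent (new s) y
  descent-from-fixed Sign.+ {q} {v} (low v≤q) = true< (lemma v v≤q)
    where
    lemma : ∀ v → ∣ v ∣ ℕ.≤ q → shift q v ℤ.< + suc q
    lemma (+ 0)     _ = +<+ (s≤s z≤n)
    lemma (+ suc k) k<q rewrite punch-below k<q = +<+ (s≤s k<q)
    lemma -[1+ k ]  _ = -<+
  descent-from-fixed Sign.- {q} {v} (low v≤q) = false> (lemma v v≤q)
    where
    lemma : ∀ v → ∣ v ∣ ℕ.≤ q → -[1+ q ] ℤ.< shift q v
    lemma (+ 0)     _ = -<+
    lemma (+ suc k) _ = -<+
    lemma -[1+ k ]  k<q rewrite punch-below k<q = -<- k<q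
  descent-from-fixed Sign.+ {q} (above {k = k} q<k) = false> (+<+ (s≤s (ℕ.≤-trans q<k (punch-≥ q k))))
  descent-from-fixed Sign.- {q} (above {k = k} q<k) = refl
  descent-from-fixed Sign.+ {q} (below {k = k} q<k) = refl
  descent-from-fixed Sign.- {q} (below {k = k} q<k) = true< (-<- (ℕ.≤-trans q<k (punch-≥ q k)))
  descent-from-fixed Sign.+ {q} fixed₊ = false> (+<+ (s≤s (ℕ.≤-reflexive (sym (punch-above {q} ℕ.≤-refl)))))
  descent-from-fixed Sign.- {q} fixed₊ = refl
  descent-from-fixed Sign.+ {q} fixed₋ = refl
  descent-from-fixed Sign.- {q} fixed₋ = true< (-<- (ℕ.≤-reflexive (sym (punch-above {q} ℕ.≤-refl))))

  -- Different kinds are separated although the thresholds belong to neighbouring positions: a low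
  -- letter in position i+1 has absolute value at most i, while a letter above or below in position
  -- i has absolute value at least i+1. Equal kinds are left to the recorded Boolean.
  descent-old : ∀ {i pv v k b₀ k′ b} → At i pv (old k b₀) → At (suc i) v (old k′ b) → does (v ℤ.<? pv) ≡ b →
                does (v ℤ.<? pv) ≡ descent (old k b₀) (old k′ b)
  descent-old start (low _) eq = eq
  descent-old (low _) (low _) eq = eq
  descent-old (above _) (above _) eq = eq
  descent-old (below _) (below _) eq = eq
  descent-old start (above _) _ = refl
  descent-old start (below _) _ = refl
  descent-old {pv = pv} (low {i} v≤i) (above {k = k} i≤k) _ = false> { + suc k} (<+suc pv v≤i (ℕ.≤-trans (ℕ.n≤1+n _) (ℕ.≤-trans (ℕ.n≤1+n _) i≤k)))
  descent-old {pv = pv} (low {i} v≤i) (below {k = k} i≤k) _ = true< { -[1+ k ]} (-suc< pv v≤i (ℕ.≤-trans (ℕ.n≤1+n _) (ℕ.≤-trans (ℕ.n≤1+n _) i≤k)))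
  descent-old {v = v} (above {k = k} i≤k) (low v≤i) _ = true< (<+suc v v≤i i≤k)
  descent-old {v = v} (below {k = k} i≤k) (low v≤i) _ = false> (-suc< v v≤i i≤k)
  descent-old (above {k = k} _) (below {k = l} _) _ = refl
  descent-old (below {k = k} _) (above {k = l} _) _ = refl

  -- Besides the types of the values, the actual comparisons with the predecessor are recorded.
  -- Types alone do not determine them between letters of equal kind, and an insertion has to
  -- transport them.
  data Rep : ∀ {n} → ℕ → Letter → ℤ → List Letter → Vec ℤ n → Set where
    []  : ∀ {i x a} → Rep i x a [] []
    _∷_ : ∀ {n i x a y v ys} {vs : Vec ℤ n} → At (suc i) v y × does (v ℤ.<? a) ≡ descent x y →
          Rep (suc i) y v ys vs → Rep i x a (y ∷ ys) (v ∷ vs)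

  rep-descents : ∀ {n i x a ys} {vs : Vec ℤ n} → Rep i x a ys vs → descentsℤ a vs ≡ descents x ys
  rep-descents []              = refl
  rep-descents ((_ , d) ∷ rep) = cong₂ (λ b → indicator b ℕ.+_) d (rep-descents rep)

  rep-shift : ∀ {n q i x a ys} {vs : Vec ℤ n} → q ℕ.≤ i → Rep i x a ys vs → Rep (suc i) x (shift q a) ys (Vec.map (shift q) vs)
  rep-shift q≤i []                 = []
  rep-shift {q = q} {a = a} q≤i (_∷_ {v = v} (at , d) rep) = (at-after (s≤s q≤i) at , trans (shift-<? q v a) d) ∷ rep-shift (ℕ.m≤n⇒m≤1+n q≤i) rep

  rep-insert : ∀ {n} s {i q x a} pre {suf} {vs : Vec ℤ n} (p : Fin (suc n)) → toℕ p ≡ length pre → i ℕ.+ length pre ≡ q →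
               At i a x → Rep i x a (pre ++ suf) vs →
               Rep i x (shift q a) (pre ++ new s ∷ suf) (insertAt (Vec.map (shift q) vs) p (fixedValue s q))
  rep-insert s {i} [] Fin.zero refl refl at rep rewrite ℕ.+-identityʳ i =
    -- Only the comparisons on the two sides of the inserted letter are new; all others are old ones
    -- after relabelling.
    (at-fixed s i , descent-to-fixed s at) ∷ after rep
    where
    after : ∀ {n ys} {vs : Vec ℤ n} → Rep i _ _ ys vs → Rep (suc i) (new s) (fixedValue s i) ys (Vec.map (shift i) vs)
    after []                = []
    after ((at′ , _) ∷ rep) = (at-after ℕ.≤-refl at′ , descent-from-fixed s at′) ∷ rep-shift (ℕ.n≤1+n i) rep
  rep-insert s {i} {q} {a = a} (y ∷ pre) (Fin.suc p) p≡ refl at (_∷_ {v = v} {vs = vs} (at′ , d) rep) =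
    (at-before (ℕ.≤-trans (ℕ.m≤m+n (suc i) (length pre)) (ℕ.≤-reflexive eq)) at′ , trans (shift-<? q v a) d)
    ∷ rep-insert s pre p (ℕ.suc-injective p≡) eq at′ rep
    where
    eq : suc i ℕ.+ length pre ≡ i ℕ.+ suc (length pre)
    eq = sym (ℕ.+-suc i (length pre))

  values : ∀ {n} → Word n → Vec ℤ n
  values = Vec.map value

  value-punchIn : ∀ {n} (p : Fin (suc n)) (x : ±[ n ]) → value (map₂ (punchIn p) x) ≡ shift (toℕ p) (value x)
  value-punchIn p (Sign.+ , i) rewrite toℕ-punchIn p i = refl
  value-punchIn p (Sign.- , i) rewrite toℕ-punchIn p i = refl

  values-ins : ∀ {n} (p : Fin (suc n)) s (τ : Word n) →
    values (ins p s τ) ≡ insertAt (Vec.map (shift (toℕ p)) (values τ)) p (fixedValue s (toℕ p))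
  values-ins p s τ = trans (Vec.map-insertAt value (s , p) (Vec.map (map₂ (punchIn p)) τ) p)
    (cong (λ v → insertAt v p (fixedValue s (toℕ p)))
      (trans (sym (Vec.map-∘ value (map₂ (punchIn p)) τ))
        (trans (Vec.map-cong (value-punchIn p) τ) (Vec.map-∘ (shift (toℕ p)) value τ))))

  Represents : ∀ {n} → List Letter → Word n → Set
  Represents w π = Rep 0 (old low false) (+ 0) w (values π)

  represents-des : ∀ {n w} {π : Word n} → Represents w π → des π ≡ descents (old low false) w
  represents-des {π = π} rep = trans (des-descentsℤ π) (rep-descents rep)

  represents-ins : ∀ {n} s pre {suf} (p : Fin (suc n)) {τ : Word n} → toℕ p ≡ length pre →
                   Represents (pre ++ suf) τ → Represents (pre ++ new s ∷ suf) (ins p s τ)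
  represents-ins s pre p {τ} p≡ rep = subst (Rep 0 _ (+ 0) (pre ++ new s ∷ _)) (sym (values-ins p s τ))
    (rep-insert s pre p p≡ (sym p≡) start rep)

  kind : ∀ {N} i (x : ±[ N ]) → toℕ (proj₂ x) ≢ i → ∃ λ k → ∀ b → At (suc i) (value x) (old k b)
  kind i (s , j) j≢i with ℕ.<-cmp (toℕ j) i
  kind i (Sign.+ , j) j≢i | tri< j<i _ _ = low   , λ b → low j<i
  kind i (Sign.- , j) j≢i | tri< j<i _ _ = low   , λ b → low j<i
  kind i (s      , j) j≢i | tri≈ _ j≡i _ = contradiction j≡i j≢i
  kind i (Sign.+ , j) j≢i | tri> _ _ i<j = above , λ b → above i<j
  kind i (Sign.- , j) j≢i | tri> _ _ i<j = below , λ b → below i<j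

  profile-from : ∀ {N m} i {k b₀ a} (xs : Vec ±[ N ] m) → At i a (old k b₀) →
    (∀ j → toℕ (proj₂ (lookup xs j)) ≢ i ℕ.+ toℕ j) →
    ∃ λ (w : Profile) → length w ≡ m × Rep i (old k b₀) a (List.map toLetter w) (Vec.map value xs)
  profile-from i []       at noFix = [] , refl , []
  profile-from i {a = a} (x ∷ xs) at noFix =
    let k , at-k = kind i x (λ eq → noFix Fin.zero (trans eq (sym (ℕ.+-identityʳ i))))
        -- The true outcome is stored for every letter; `descent` consults it only if the
        -- predecessor has the same kind.
        b = does (value x ℤ.<? a)
        w , len , rep = profile-from (suc i) xs (at-k b) (λ j eq → noFix (Fin.suc j) (trans eq (sym (ℕ.+-suc i (toℕ j)))))
    in (k , b) ∷ w , cong suc len , ((at-k b , descent-old at (at-k b) refl) ∷ rep)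

  profile : ∀ {m} (σ : Word m) → (∀ i → abs σ i ≢ i) →
    ∃ λ (w : Profile) → length w ≡ m × Represents (List.map toLetter w) σ
  profile σ noFix = profile-from 0 σ start (λ j eq → noFix j (Fin.toℕ-injective eq))

open Profiles

-- Summation over involutions by inserting fixed points

module ListSums {c ℓ} (R : CommutativeRing c ℓ) where
  open CommutativeRing R
  open Ops rawRing using (∑)
  open CSG +-commutativeSemigroup using (x∙yz≈y∙xz) renaming (interchange to +-interchange)

  module _ {a} {I : Set a} where
    ∑-cong-∈ : ∀ xs {f g : I → Carrier} → (∀ {x} → x ∈ xs → f x ≈ g x) → ∑ xs f ≈ ∑ xs g
    ∑-cong-∈ []       f≈g = refl
    ∑-cong-∈ (x ∷ xs) f≈g = +-cong (f≈g (here ≡.refl)) (∑-cong-∈ xs (f≈g ∘ there))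

    ∑-cong : ∀ xs {f g : I → Carrier} → (∀ x → f x ≈ g x) → ∑ xs f ≈ ∑ xs g
    ∑-cong xs f≈g = ∑-cong-∈ xs (λ {x} _ → f≈g x)

    ∑-↭ : ∀ {xs ys} (f : I → Carrier) → xs ↭ ys → ∑ xs f ≈ ∑ ys f
    ∑-↭ f ↭.refl = refl
    ∑-↭ f (↭.prep x p) = +-congˡ (∑-↭ f p)
    ∑-↭ f (↭.swap x y p) = trans (x∙yz≈y∙xz _ _ _) (+-congˡ (+-congˡ (∑-↭ f p)))
    ∑-↭ f (↭.trans p q) = trans (∑-↭ f p) (∑-↭ f q)

    ∑-++ : ∀ xs ys (f : I → Carrier) → ∑ (xs ++ ys) f ≈ ∑ xs f + ∑ ys f
    ∑-++ []       ys f = sym (+-identityˡ _)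
    ∑-++ (x ∷ xs) ys f = trans (+-congˡ (∑-++ xs ys f)) (sym (+-assoc _ _ _))

    ∑-map : ∀ {b} {J : Set b} (g : J → I) xs (f : I → Carrier) → ∑ (map g xs) f ≈ ∑ xs (f ∘ g)
    ∑-map g []       f = refl
    ∑-map g (x ∷ xs) f = +-congˡ (∑-map g xs f)

    ∑-distrib-+ : ∀ xs (f g : I → Carrier) → ∑ xs f + ∑ xs g ≈ ∑ xs (λ x → f x + g x)
    ∑-distrib-+ []       f g = +-identityˡ 0#
    ∑-distrib-+ (x ∷ xs) f g = trans (+-interchange _ _ _ _) (+-congˡ (∑-distrib-+ xs f g))

    ∑-zero : ∀ xs → ∑ xs (λ (_ : I) → 0#) ≈ 0#
    ∑-zero []       = refl
    ∑-zero (x ∷ xs) = trans (+-identityˡ _) (∑-zero xs)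

    *-distribˡ-∑ : ∀ a xs (f : I → Carrier) → a * ∑ xs f ≈ ∑ xs (λ x → a * f x)
    *-distribˡ-∑ a []       f = zeroʳ a
    *-distribˡ-∑ a (x ∷ xs) f = trans (distribˡ a _ _) (+-congˡ (*-distribˡ-∑ a xs f))

module ClassSum {c ℓ} (R : CommutativeRing c ℓ) (t : CommutativeRing.Carrier R) where
  open CommutativeRing R
  open Ops rawRing using (∑; _^_)
  open ListSums R
  open Insertion R t
  private
    module S = CommutativeRing (Series.commutativeRing R)
    module SO = Ops S.rawRing
    module SSums = ListSums (Series.commutativeRing R)

  -- merge f g r h σ sums h over the insertions of f fixed points into σ
  -- at positions ≥ g; the merged word has r letters from position g on.
  merge : ∀ {m} f g r → g ℕ.+ r ≡ f ℕ.+ m → (Word (f ℕ.+ m) → Carrier) → Word m → Carrier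
  merge {m} zero    g r       eq h σ = h σ
  merge {m} (suc f) g zero    eq h σ = 0#
  merge {m} (suc f) g (suc r) eq h σ = merge (suc f) (suc g) r eq′ h σ
    + (merge f g r (ℕ.suc-injective eq′) (h ∘ ins p Sign.+) σ + merge f g r (ℕ.suc-injective eq′) (h ∘ ins p Sign.-) σ)
    where
    eq′ = ≡.trans (≡.sym (ℕ.+-suc g r)) eq
    p : Fin (suc (f ℕ.+ m))
    p = fromℕ< (≡.subst (g ℕ.<_) eq′ (s≤s (ℕ.m≤m+n g r)))

  ∑-class-split : ∀ {n} (p : Fin (suc n)) f h → ∑ (class (suc n) (toℕ p) (suc f)) h ≈
    ∑ (class (suc n) (suc (toℕ p)) (suc f)) h
    + (∑ (class n (toℕ p) f) (h ∘ ins p Sign.+) + ∑ (class n (toℕ p) f) (h ∘ ins p Sign.-))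
  ∑-class-split {n} p f h = trans (∑-↭ h (class-split p f))
    (trans (∑-++ (class (suc n) (suc (toℕ p)) (suc f)) _ h) (+-congˡ
      (trans (∑-++ (map (ins p Sign.+) (class n (toℕ p) f)) _ h)
        (+-cong (∑-map (ins p Sign.+) (class n (toℕ p) f) h) (∑-map (ins p Sign.-) (class n (toℕ p) f) h)))))

  -- Iterates `class-split` until no fixed point or no position remains. The leftmost fixed point is
  -- deleted first, hence is the last to be inserted again, which is why it is composed onto `h`
  -- before the recursion continues.
  ∑-class : ∀ {m} f g r (eq : g ℕ.+ r ≡ f ℕ.+ m) h →
            ∑ (class (f ℕ.+ m) g f) h ≈ ∑ (class m 0 0) (merge f g r eq h)
  ∑-class {m} zero    g r       eq h = ∑-↭ h (class-zero m g)
  ∑-class {m} (suc f) g zero    eq h = trans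
    (∑-↭ h (class-empty (suc f ℕ.+ m) g f (ℕ.≤-reflexive (≡.trans (≡.sym eq) (ℕ.+-identityʳ g)))))
    (sym (∑-zero (class m 0 0)))
  ∑-class {m} (suc f) g (suc r) eq h = begin
    ∑ (class (suc n) g (suc f)) h
      ≈⟨ ≡.subst (λ g′ → ∑ (class (suc n) g′ (suc f)) h ≈ ∑ (class (suc n) (suc g′) (suc f)) h
             + (∑ (class n g′ f) (h ∘ ins p Sign.+) + ∑ (class n g′ f) (h ∘ ins p Sign.-))) (Fin.toℕ-fromℕ< g<n) (∑-class-split p f h) ⟩
    ∑ (class (suc n) (suc g) (suc f)) h + (∑ (class n g f) (h ∘ ins p Sign.+) + ∑ (class n g f) (h ∘ ins p Sign.-))
      ≈⟨ +-cong (∑-class (suc f) (suc g) r eq′ h) (+-cong (∑-class f g r eq″ (h ∘ ins p Sign.+)) (∑-class f g r eq″ (h ∘ ins p Sign.-))) ⟩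
    ∑ (class m 0 0) M₀ + (∑ (class m 0 0) M₊ + ∑ (class m 0 0) M₋)
      ≈⟨ trans (+-congˡ (∑-distrib-+ (class m 0 0) M₊ M₋)) (∑-distrib-+ (class m 0 0) M₀ (λ σ → M₊ σ + M₋ σ)) ⟩
    ∑ (class m 0 0) (merge (suc f) g (suc r) eq h) ∎
    where
    open SetoidReasoning setoid
    n = f ℕ.+ m
    eq′ = ≡.trans (≡.sym (ℕ.+-suc g r)) eq
    eq″ = ℕ.suc-injective eq′
    g<n = ≡.subst (g ℕ.<_) eq′ (s≤s (ℕ.m≤m+n g r))
    p : Fin (suc n)
    p = fromℕ< g<n
    M₀ = merge (suc f) (suc g) r eq′ h
    M₊ = merge f g r eq″ (h ∘ ins p Sign.+)
    M₋ = merge f g r eq″ (h ∘ ins p Sign.-)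

  merge-zero : ∀ {m} f g r (eq : g ℕ.+ r ≡ f ℕ.+ m) h σ → r ℕ.< f → merge f g r eq h σ ≈ 0#
  merge-zero (suc f) g zero    eq h σ _ = refl
  merge-zero (suc f) g (suc r) eq h σ (s≤s r<f) = trans
    (+-cong (merge-zero (suc f) (suc g) r _ h σ (ℕ.m<n⇒m<1+n r<f))
      (trans (+-cong (merge-zero f g r _ _ σ r<f) (merge-zero f g r _ _ σ r<f)) (+-identityˡ 0#)))
    (+-identityˡ 0#)

  insertions-0 : ∀ x w → insertions x w 0 ≈ t ^ descents x (map toLetter w)
  insertions-0 x []       = refl
  insertions-0 x (y ∷ ys) with descent x (toLetter y)
  ... | true  = *-congˡ (insertions-0 (toLetter y) ys)
  ... | false = trans (*-identityˡ _) (insertions-0 (toLetter y) ys)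

  weight-^ : ∀ x y n → t ^ (indicator (descent x y) ℕ.+ n) ≈ weight (descent x y) * t ^ n
  weight-^ x y n with descent x y
  ... | true  = refl
  ... | false = sym (*-identityˡ _)

  -- The letters before position g contribute the factor c, and x is the last of them.
  merge-eval : ∀ {m} f g r (eq : g ℕ.+ r ≡ f ℕ.+ m) h (σ : Word m) pre suf x c →
    length pre ≡ g → r ≡ f ℕ.+ length suf →
    (∀ w τ → Represents (pre ++ w) τ → h τ ≈ c * t ^ descents x w) →
    Represents (pre ++ map toLetter suf) σ →
    merge f g r eq h σ ≈ c * insertions x suf f
  merge-eval zero g r eq h σ pre suf x c _ _ h-eval rep =
    trans (h-eval _ σ rep) (*-congˡ (sym (insertions-0 x suf)))
  merge-eval {m} (suc f) g (suc r) eq h σ pre suf x c len r≡ h-eval rep = begin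
    merge (suc f) (suc g) r eq′ h σ + (merge f g r eq″ (h ∘ ins p Sign.+) σ + merge f g r eq″ (h ∘ ins p Sign.-) σ)
      ≈⟨ +-cong (proj₂ (skipped suf r≡ rep)) (+-cong (inserted Sign.+) (inserted Sign.-)) ⟩
    proj₁ (skipped suf r≡ rep) + (c * weight (descent x (new Sign.+)) * insertions (new Sign.+) suf f
                     + c * weight (descent x (new Sign.-)) * insertions (new Sign.-) suf f)
      ≈⟨ +-congˡ (trans (+-cong (*-assoc _ _ _) (*-assoc _ _ _)) (sym (distribˡ c _ _))) ⟩
    proj₁ (skipped suf r≡ rep) + c * jump x suf f
      ≈⟨ collect suf r≡ rep ⟩
    c * insertions x suf (suc f) ∎
    where
    open SetoidReasoning setoid
    eq′ = ≡.trans (≡.sym (ℕ.+-suc g r)) eq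
    eq″ = ℕ.suc-injective eq′
    g<n = ≡.subst (g ℕ.<_) eq′ (s≤s (ℕ.m≤m+n g r))
    p : Fin (suc (f ℕ.+ m))
    p = fromℕ< g<n

    inserted : ∀ s → merge f g r eq″ (h ∘ ins p s) σ ≈ c * weight (descent x (new s)) * insertions (new s) suf f
    -- `pre` stays as it is, because the remaining fixed points are inserted into the word that
    -- lacks this letter. The new letter is felt only as the predecessor of what follows and through
    -- its weight in the factor.
    inserted s = merge-eval f g r eq″ (h ∘ ins p s) σ pre suf (new s) (c * weight (descent x (new s))) len (ℕ.suc-injective r≡)
      (λ w τ rep′ → trans (h-eval (new s ∷ w) (ins p s τ) (represents-ins s pre p {τ = τ} (≡.trans (Fin.toℕ-fromℕ< g<n) (≡.sym len)) rep′))
        (trans (*-congˡ (weight-^ x (new s) (descents (new s) w))) (sym (*-assoc _ _ _)))) rep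

    skipped : ∀ suf → suc r ≡ suc f ℕ.+ length suf → Represents (pre ++ map toLetter suf) σ →
              Σ[ v ∈ Carrier ] merge (suc f) (suc g) r eq′ h σ ≈ v
    -- No old letter is left, so skipping a position would leave r = f positions for f+1 fixed
    -- points. This is the missing first summand in the recursion of `insertions` at the empty
    -- profile.
    skipped [] r≡ _ = 0# , merge-zero (suc f) (suc g) r eq′ h σ (s≤s (ℕ.≤-reflexive (≡.trans (ℕ.suc-injective r≡) (ℕ.+-identityʳ f))))
    skipped (y ∷ ys) r≡ rep = c * weight (descent x (toLetter y)) * insertions (toLetter y) ys (suc f) ,
      merge-eval (suc f) (suc g) r eq′ h σ (pre ++ [ toLetter y ]) ys (toLetter y) (c * weight (descent x (toLetter y)))
        (≡.trans (length-++ pre) (≡.trans (ℕ.+-comm (length pre) 1) (≡.cong suc len)))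
        (≡.trans (ℕ.suc-injective r≡) (ℕ.+-suc f (length ys)))
        (λ w τ rep′ → trans (h-eval (toLetter y ∷ w) τ (≡.subst (λ v → Represents v τ) (++-assoc pre [ toLetter y ] w) rep′))
          (trans (*-congˡ (weight-^ x (toLetter y) (descents (toLetter y) w))) (sym (*-assoc _ _ _))))
        (≡.subst (λ v → Represents v σ) (≡.sym (++-assoc pre [ toLetter y ] (map toLetter ys))) rep)

    collect : ∀ suf r≡ rep → proj₁ (skipped suf r≡ rep) + c * jump x suf f ≈ c * insertions x suf (suc f)
    collect []       _ _ = +-identityˡ _
    collect (y ∷ ys) _ _ = trans (+-congʳ (*-assoc _ _ _)) (sym (distribˡ c _ _))

  ∑-class-tr : ∀ f m → ∑ (class (f ℕ.+ m) 0 f) (λ π → t ^ des π) ≈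
    tr ((a SO.^ m) S.* SO.∑ (class m 0 0) (λ σ → (b S.* a⁻¹) SO.^ des σ)) f
  ∑-class-tr f m = begin
    ∑ (class (f ℕ.+ m) 0 f) (λ π → t ^ des π)              ≈⟨ ∑-class f 0 (f ℕ.+ m) ≡.refl (λ π → t ^ des π) ⟩
    ∑ (class m 0 0) (merge f 0 (f ℕ.+ m) ≡.refl (λ π → t ^ des π)) ≈⟨ ∑-cong-∈ (class m 0 0) (λ {σ} → single {σ}) ⟩
    ∑ (class m 0 0) (λ σ → tr (E σ) f)                     ≈⟨ ∑-tr (class m 0 0) f ⟩
    tr (SO.∑ (class m 0 0) E) f                            ≈⟨ tr-cong (SSums.*-distribˡ-∑ (a SO.^ m) (class m 0 0) (λ σ → (b S.* a⁻¹) SO.^ des σ)) f ⟨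
    tr ((a SO.^ m) S.* SO.∑ (class m 0 0) (λ σ → (b S.* a⁻¹) SO.^ des σ)) f ∎
    where
    open SetoidReasoning setoid
    E : Word m → S.Carrier
    E σ = (a SO.^ m) S.* ((b S.* a⁻¹) SO.^ des σ)

    ∑-tr : ∀ xs f → ∑ xs (λ σ → tr (E σ) f) ≈ tr (SO.∑ xs E) f
    ∑-tr []       f = sym (tr-0 f)
    ∑-tr (σ ∷ xs) f = trans (+-congˡ (∑-tr xs f)) (sym (tr-+ (E σ) (SO.∑ xs E) f))

    single : ∀ {σ} → σ ∈ class m 0 0 → merge f 0 (f ℕ.+ m) ≡.refl (λ π → t ^ des π) σ ≈ tr (E σ) f
    single {σ} σ∈ = trans (merge-eval f 0 (f ℕ.+ m) ≡.refl (λ π → t ^ des π) σ [] w (old low false) 1# ≡.refl (≡.cong (f ℕ.+_) (≡.sym len))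
        (λ v τ rep′ → trans (reflexive (≡.cong (t ^_) (represents-des {π = τ} rep′))) (sym (*-identityˡ _))) rep)
      (trans (*-identityˡ _) (trans (insertions-closed false w f)
        (reflexive (≡.cong₂ (λ l d → tr ((a SO.^ l) S.* ((b S.* a⁻¹) SO.^ d)) f) len (≡.sym (represents-des {π = σ} rep))))))
      where
      fix≡0 = proj₂ (proj₂ (∈class⁻ {g = 0} {f = 0} {π = σ} σ∈))
      prof = profile σ (λ i eq → ℕ.<-irrefl (≡.sym fix≡0) (fixed⇒0<fix σ i eq))
      w = proj₁ prof
      len = proj₁ (proj₂ prof)
      rep = proj₂ (proj₂ prof)

-- The polynomials F, J and A

ℤ-CR ℤ[t]-CR ℤ⟦t⟧-CR ℤ[x]⟦W⟧-CR ℤ[p][t]-CR : CommutativeRing _ _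
ℤ-CR         = ℤ.+-*-commutativeRing
ℤ[t]-CR      = Poly.commutativeRing ℤ-CR
ℤ⟦t⟧-CR      = Series.commutativeRing ℤ-CR
ℤ[x]⟦W⟧-CR   = Series.commutativeRing ℤ[t]-CR
ℤ[p][t]-CR   = Poly.commutativeRing ℤ[t]-CR

private
  module Pol = CommutativeRing ℤ[t]-CR
  module PolSer = CommutativeRing ℤ[x]⟦W⟧-CR
  module PolSerLemmas = SeriesLemmas ℤ[t]-CR
  module Ser = CommutativeRing ℤ⟦t⟧-CR
  coeffℤ : List ℤ → ℕ → ℤ
  coeffℤ = Polynomial.coeff ℤ-ring
  constℤ : ℤ → List ℤ
  constℤ = Polynomial.const ℤ-ring
  Xℤ : List ℤ
  Xℤ = Polynomial.X ℤ-ring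

-- The coefficientwise form of E(W) ↦ E(y/(1-y))/(1-y).
binomialTransform : ∀ {a} {A : Set a} → (A → A → A) → ℕ → (ℕ → A) → A
binomialTransform _∙_ zero    E = E 0
binomialTransform _∙_ (suc f) E = binomialTransform _∙_ f E ∙ binomialTransform _∙_ f (E ∘ suc)

binomialTransform-∑ : ∀ f E → binomialTransform ℤ._+_ f E ≡ Ops.∑≤ ℤ-ring f (λ r → E r ℤ.* + (f choose r))
binomialTransform-∑ zero    E = ≡.sym (≡.trans (ℤ.+-identityʳ _) (ℤ.*-identityʳ (E 0)))
binomialTransform-∑ (suc f) E = begin
  binomialTransform ℤ._+_ f E ℤ.+ binomialTransform ℤ._+_ f (E ∘ suc)
    ≡⟨ ≡.cong₂ ℤ._+_ (binomialTransform-∑ f E) (binomialTransform-∑ f (E ∘ suc)) ⟩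
  ∑≤ f (λ r → E r ℤ.* + (f choose r)) ℤ.+ ∑≤ f (λ r → E (suc r) ℤ.* + (f choose r))
    ≡⟨ ≡.cong (ℤ._+ ∑≤ f (λ r → E (suc r) ℤ.* + (f choose r))) last ⟨
  (E 0 ℤ.* + 1 ℤ.+ ∑≤ f (λ r → E (suc r) ℤ.* + (f choose suc r))) ℤ.+ ∑≤ f (λ r → E (suc r) ℤ.* + (f choose r))
    ≡⟨ ℤ.+-assoc (E 0 ℤ.* + 1) _ _ ⟩
  E 0 ℤ.* + 1 ℤ.+ (∑≤ f (λ r → E (suc r) ℤ.* + (f choose suc r)) ℤ.+ ∑≤ f (λ r → E (suc r) ℤ.* + (f choose r)))
    ≡⟨ ≡.cong (λ z → E 0 ℤ.* + 1 ℤ.+ z) (SumLemmas.∑≤-distrib-+ ℤ-CR f (λ r → E (suc r) ℤ.* + (f choose suc r)) (λ r → E (suc r) ℤ.* + (f choose r))) ⟨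
  E 0 ℤ.* + 1 ℤ.+ ∑≤ f (λ r → E (suc r) ℤ.* + (f choose suc r) ℤ.+ E (suc r) ℤ.* + (f choose r))
    ≡⟨ ≡.cong (λ z → E 0 ℤ.* + 1 ℤ.+ z) (SumLemmas.∑≤-cong ℤ-CR f (λ r → ≡.trans (≡.sym (ℤ.*-distribˡ-+ (E (suc r)) (+ (f choose suc r)) (+ (f choose r))))
         (≡.cong (λ c → E (suc r) ℤ.* + c) (≡.trans (ℕ.+-comm (f choose suc r) (f choose r)) (nCk+nC[k+1]≡[n+1]C[k+1] f r))))) ⟩
  ∑≤ (suc f) (λ r → E r ℤ.* + (suc f choose r)) ∎
  where
  open Ops ℤ-ring using (∑≤)
  open ≡.≡-Reasoning
  -- The sum for f is lengthened by the zero term at r = f+1, so that Pascal's rule can pair it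
  -- termwise with the shifted sum.
  last : ∑≤ (suc f) (λ r → E r ℤ.* + (f choose r)) ≡ ∑≤ f (λ r → E r ℤ.* + (f choose r))
  last = ≡.trans (SumLemmas.∑≤-last ℤ-CR f (λ r → E r ℤ.* + (f choose r)))
    (≡.trans (≡.cong (λ c → ∑≤ f (λ r → E r ℤ.* + (f choose r)) ℤ.+ E (suc f) ℤ.* + c) (k>n⇒nCk≡0 (ℕ.n<1+n f)))
      (≡.trans (≡.cong (λ z → ∑≤ f (λ r → E r ℤ.* + (f choose r)) ℤ.+ z) (ℤ.*-zeroʳ (E (suc f)))) (ℤ.+-identityʳ _)))

-- In length 2j+f the number of fixed points determines the number of two-cycles, by `2cyc₂+fix≡n`.
cyc₂-fix-↭ : ∀ {n} j f → n ≡ 2 ℕ.* j ℕ.+ f →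
  filter (λ π → (cyc₂ π ℕ.≟ j) ×-dec (fix π ℕ.≟ f)) (𝓘 n) ↭ class n 0 f
cyc₂-fix-↭ {n} j f n≡ = unique-↭ (Unique.filter⁺ P? (𝓘! n)) (class! n 0 f)
  (λ {π} π∈ → let π∈𝓘 , _ , fix≡ = ∈-filter⁻ P? {xs = 𝓘 n} π∈ in ∈class⁺ {g = 0} {π = π} (∈𝓘⁻ π∈𝓘) (λ _ ()) fix≡)
  (λ {π} π∈ → let inv , _ , fix≡ = ∈class⁻ {g = 0} {f = f} {π = π} π∈ in
    ∈-filter⁺ P? (∈𝓘⁺ inv) (ℕ.*-cancelˡ-≡ (cyc₂ π) j 2 (ℕ.+-cancelʳ-≡ f (2 ℕ.* cyc₂ π) (2 ℕ.* j)
      (≡.trans (≡.cong (2 ℕ.* cyc₂ π ℕ.+_) (≡.sym fix≡)) (≡.trans (2cyc₂+fix≡n {π = π} inv) n≡))) , fix≡))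
  where
  P? = λ π → (cyc₂ π ℕ.≟ j) ×-dec (fix π ℕ.≟ f)

-- The length is any n that equals 2j+f, since insertion produces it as f plus the length of σ,
-- whereas the sum over all involutions starts from n.
hom-F : ∀ {c ℓ} {B : CommutativeRing c ℓ} → let open CommutativeRing B in ∀ {φ} → IsHom ℤ[t]-CR B φ → ∀ n j f → n ≡ 2 ℕ.* j ℕ.+ f →
        φ (F j f) ≈ Ops.∑ rawRing (class n 0 f) (λ π → Ops._^_ rawRing (φ (Xℤ)) (des π))
hom-F {B = B} {φ} φ-isHom _ j f ≡.refl = trans (φ.∑-homo xs (λ π → t O.^ des π))
  (trans (ListSums.∑-cong B xs (λ π → φ.^-homo t (des π)))
    (ListSums.∑-↭ B (λ π → Ops._^_ rawRing (φ t) (des π)) (cyc₂-fix-↭ j f ≡.refl)))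
  where
  open CommutativeRing B
  module φ = Hom {A = ℤ[t]-CR} {B = B} φ-isHom
  module O = Ops ℤ[t]
  t = Xℤ
  xs = filter (λ π → (cyc₂ π ℕ.≟ j) ×-dec (fix π ℕ.≟ f)) (𝓘 (2 ℕ.* j ℕ.+ f))

-- With a = 1+2TZ, b = T(1+2Z) and u = 1+T: if u²x = T then
-- ab = u²x(1+2uZ+4x(uZ)²) and a+b = u(1+4xuZ).
module Identities {c ℓ} (R : CommutativeRing c ℓ) where
  open CommutativeRing R
  open Ops rawRing using (_^_; _·_)
  open Solver commutativeSemiring using (solve; _:=_; _:+_; _:*_; con)
  open SetoidReasoning setoid

  product : ∀ T Z u x → u ≈ 1# + T → u * (u * x) ≈ T →
    u ^ 2 * (x * (1# + 2 · (u * Z) + 4 · (x * (u * Z) ^ 2))) ≈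
    (1# + (T * Z + T * Z)) * (T * (1# + (Z + Z)))
  product T Z u x u≈ u²x≈ = begin
    u ^ 2 * (x * (1# + 2 · (u * Z) + 4 · (x * (u * Z) ^ 2)))
      ≈⟨ solve 3 (λ Z u x → (u :* (u :* con 1)) :* (x :* (con 1 :+ (u :* Z :+ (u :* Z :+ con 0))
           :+ (x :* (u :* Z :* (u :* Z :* con 1)) :+ (x :* (u :* Z :* (u :* Z :* con 1)) :+ (x :* (u :* Z :* (u :* Z :* con 1)) :+ (x :* (u :* Z :* (u :* Z :* con 1)) :+ con 0))))))
           := u :* (u :* x) :* (con 1 :+ con 2 :* (u :* Z) :+ con 4 :* (u :* (u :* x) :* Z :* Z))) refl Z u x ⟩
    u * (u * x) * (1# + (1# + 1#) * (u * Z) + ((1# + 1#) + 1# + 1#) * (u * (u * x) * Z * Z))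
      ≈⟨ *-cong u²x≈ (+-cong (+-congˡ (*-congˡ (*-congʳ u≈))) (*-congˡ (*-congʳ (*-congʳ u²x≈)))) ⟩
    T * (1# + (1# + 1#) * ((1# + T) * Z) + ((1# + 1#) + 1# + 1#) * (T * Z * Z))
      ≈⟨ solve 2 (λ T Z → T :* (con 1 :+ con 2 :* ((con 1 :+ T) :* Z) :+ con 4 :* (T :* Z :* Z)) :=
           (con 1 :+ (T :* Z :+ T :* Z)) :* (T :* (con 1 :+ (Z :+ Z)))) refl T Z ⟩
    (1# + (T * Z + T * Z)) * (T * (1# + (Z + Z))) ∎

  total : ∀ T Z u x → u ≈ 1# + T → u * (u * x) ≈ T →
    u * (1# + (4 · x) * (u * Z)) ≈ (1# + (T * Z + T * Z)) + T * (1# + (Z + Z))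
  total T Z u x u≈ u²x≈ = begin
    u * (1# + (4 · x) * (u * Z))
      ≈⟨ solve 3 (λ Z u x → u :* (con 1 :+ (x :+ (x :+ (x :+ (x :+ con 0)))) :* (u :* Z)) :=
           u :+ con 4 :* (u :* (u :* x) :* Z)) refl Z u x ⟩
    u + ((1# + 1#) + 1# + 1#) * (u * (u * x) * Z)
      ≈⟨ +-cong u≈ (*-congˡ (*-congʳ u²x≈)) ⟩
    (1# + T) + ((1# + 1#) + 1# + 1#) * (T * Z)
      ≈⟨ solve 2 (λ T Z → (con 1 :+ T) :+ con 4 :* (T :* Z) := (con 1 :+ (T :* Z :+ T :* Z)) :+ T :* (con 1 :+ (Z :+ Z))) refl T Z ⟩
    (1# + (T * Z + T * Z)) + T * (1# + (Z + Z)) ∎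

  u²x : ∀ t {u v} → u * v ≈ 1# → u * (u * (t * v ^ 2)) ≈ t
  u²x t {u} {v} uv≈1 = begin
    u * (u * (t * v ^ 2))      ≈⟨ solve 3 (λ t u v → u :* (u :* (t :* (v :* (v :* con 1)))) := t :* ((u :* v) :* (u :* v))) refl t u v ⟩
    t * ((u * v) * (u * v))    ≈⟨ *-congˡ (trans (*-cong uv≈1 uv≈1) (*-identityˡ 1#)) ⟩
    t * 1#                     ≈⟨ *-identityʳ t ⟩
    t                          ∎

  shift-total : ∀ {a a⁻¹} b → a * a⁻¹ ≈ 1# → a * (1# + b * a⁻¹) ≈ a + b
  shift-total {a} {a⁻¹} b aa⁻¹≈1 = begin
    a * (1# + b * a⁻¹)     ≈⟨ solve 3 (λ a a⁻¹ b → a :* (con 1 :+ b :* a⁻¹) := a :+ b :* (a :* a⁻¹)) refl a a⁻¹ b ⟩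
    a + b * (a * a⁻¹)      ≈⟨ +-congˡ (trans (*-congˡ aa⁻¹≈1) (*-identityʳ b)) ⟩
    a + b                  ∎

  shift-product : ∀ {a a⁻¹} b → a * a⁻¹ ≈ 1# → a ^ 2 * (b * a⁻¹) ≈ a * b
  shift-product {a} {a⁻¹} b aa⁻¹≈1 = begin
    a ^ 2 * (b * a⁻¹)      ≈⟨ solve 3 (λ a a⁻¹ b → (a :* (a :* con 1)) :* (b :* a⁻¹) := a :* b :* (a :* a⁻¹)) refl a a⁻¹ b ⟩
    a * b * (a * a⁻¹)      ≈⟨ trans (*-congˡ aa⁻¹≈1) (*-identityʳ _) ⟩
    a * b                  ∎

module HomogeneousSum {c ℓ} (S : CommutativeRing c ℓ) {ι} (ι-isHom : IsHom ℤ-CR S ι) (D : ℕ → ℕ → ℕ) (j : ℕ)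
  (J-homogenize : Jᴮ j Pol.≈ Homogeneous.Q ℤ[t]-CR D j Xℤ (Pol.1# Pol.+ Xℤ)) where
  open CommutativeRing S
  open Ops rawRing using (∑; _^_)
  open Homogeneous S D j using (Q; Q-cong; Q-homogeneous)
  open SetoidReasoning setoid
  private
    -- The summand 0 is the number of fixed points in the length of the words of `F j 0`.
    involutions = class (2 ℕ.* j ℕ.+ 0) 0 0

  -- After denominators are cleared, the expansion of J is an identity of integer polynomials, so it
  -- can be evaluated at any r in any commutative ring over ℤ. The value needed is b/a, a power
  -- series in Z.
  ∑-class-Q : ∀ r → ∑ involutions (λ σ → r ^ des σ) ≈ Q r (1# + r)
  ∑-class-Q r = begin
    ∑ involutions (λ σ → r ^ des σ)
      ≈⟨ ListSums.∑-cong S involutions (λ σ → Exp.^-congˡ semiring (des σ) Ev.eval-X) ⟨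
    ∑ involutions (λ σ → Ev.eval Xℤ ^ des σ)
      ≈⟨ hom-F {B = S} Ev.eval-isHom (2 ℕ.* j ℕ.+ 0) j 0 ≡.refl ⟨
    Ev.eval (Jᴮ j)
      ≈⟨ EvHom.cong {Jᴮ j} {Homogeneous.Q ℤ[t]-CR D j Xℤ (Pol.1# Pol.+ Xℤ)} J-homogenize ⟩
    Ev.eval (Homogeneous.Q ℤ[t]-CR D j Xℤ (Pol.1# Pol.+ Xℤ))
      ≈⟨ Q-homo {A = ℤ[t]-CR} {B = S} Ev.eval-isHom D j Xℤ (Pol.1# Pol.+ Xℤ) ⟩
    Q (Ev.eval Xℤ) (Ev.eval (Pol.1# Pol.+ Xℤ))
      ≈⟨ Q-cong Ev.eval-X (trans (EvHom.+-homo Pol.1# Xℤ) (+-cong EvHom.1#-homo Ev.eval-X)) ⟩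
    Q r (1# + r) ∎
    where
    module Ev = Evaluation {A = ℤ-CR} {B = S} ι-isHom r
    module EvHom = Hom {A = ℤ[t]-CR} {B = S} Ev.eval-isHom

  -- Since `Q` has degree 2j when y counts twice and w once, the power of a is absorbed by the
  -- arguments b/a and 1 + b/a, where it cancels the inverse.
  scaled-∑-class-Q : ∀ {a a⁻¹} b → a * a⁻¹ ≈ 1# →
    a ^ (2 ℕ.* j ℕ.+ 0) * ∑ involutions (λ σ → (b * a⁻¹) ^ des σ) ≈ Q (a * b) (a + b)
  scaled-∑-class-Q {a} {a⁻¹} b a-inverse = begin
    a ^ (2 ℕ.* j ℕ.+ 0) * ∑ involutions (λ σ → (b * a⁻¹) ^ des σ)
      ≈⟨ *-cong (Exp.^-congʳ semiring a (ℕ.+-identityʳ (2 ℕ.* j))) (∑-class-Q (b * a⁻¹)) ⟩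
    a ^ (2 ℕ.* j) * Q (b * a⁻¹) (1# + b * a⁻¹)
      ≈⟨ Q-homogeneous a (b * a⁻¹) (1# + b * a⁻¹) ⟩
    Q (a ^ 2 * (b * a⁻¹)) (a * (1# + b * a⁻¹))
      ≈⟨ Q-cong (Identities.shift-product S b a-inverse) (Identities.shift-total S b a-inverse) ⟩
    Q (a * b) (a + b) ∎

-- The arguments y and w of A-series = Q(y , w).
A-y A-w : PolSer.Carrier
A-y = PolSerLemmas.C Xℤ * (1# + 2 · PolSerLemmas.X + 4 · (PolSerLemmas.C Xℤ * PolSerLemmas.X ^ 2))
  where open Ops ℤ[x]⟦W⟧
A-w = PowerSeries.1+_X ℤ[x] (Ops._·_ ℤ[x] 4 Xℤ)

A-series-homogenize : ∀ D j → A-series D j PolSer.≈ Homogeneous.Q ℤ[x]⟦W⟧-CR D j A-y A-w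
A-series-homogenize D j = Homogeneous.P-homogenize ℤ[x]⟦W⟧-CR D j {w = A-w} {v = PowerSeries.1/1+_X ℤ[x] (Ops._·_ ℤ[x] 4 Xℤ)} A-y (PolSerLemmas.1+X-inverse (Ops._·_ ℤ[x] 4 Xℤ))

A-poly : (ℕ → ℕ → ℕ) → ℕ → ℕ → List ℤ
A-poly D j f = binomialTransform Pol._+_ f (A-series D j)

coeff-binomialTransform : ∀ f (E : ℕ → List ℤ) k →
  coeffℤ (binomialTransform Pol._+_ f E) k ≡ binomialTransform ℤ._+_ f (λ r → coeffℤ (E r) k)
coeff-binomialTransform zero    E k = ≡.refl
coeff-binomialTransform (suc f) E k = ≡.trans (Poly.coeff-add ℤ-CR (binomialTransform Pol._+_ f E) _ k)
  (≡.cong₂ ℤ._+_ (coeff-binomialTransform f E k) (coeff-binomialTransform f (E ∘ suc) k))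

coeff-A-poly : ∀ D j f k → coeffℤ (A-poly D j f) k ≡ γ D j f k
coeff-A-poly D j f k = ≡.trans (coeff-binomialTransform f (A-series D j) k)
  (binomialTransform-∑ f (λ r → A D j k r))

half-≤ : ∀ {k n} → k ℕ.≤ ⌊ n /2⌋ → 2 ℕ.* k ℕ.≤ n
half-≤ {k} {n} k≤ = ℕ.≤-trans (ℕ.*-monoʳ-≤ 2 k≤) (lemma n)
  where
  lemma : ∀ n → 2 ℕ.* ⌊ n /2⌋ ℕ.≤ n
  lemma zero          = z≤n
  lemma (suc zero)    = z≤n
  lemma (suc (suc n)) = ℕ.≤-trans (ℕ.≤-reflexive (ℕ.*-suc 2 ⌊ n /2⌋)) (s≤s (s≤s (lemma n)))

half-< : ∀ {k n} → ⌊ n /2⌋ ℕ.< k → n ℕ.< 2 ℕ.* k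
half-< {k} {n} <k = ℕ.<-≤-trans (lemma n) (ℕ.*-monoʳ-≤ 2 <k)
  where
  lemma : ∀ n → n ℕ.< 2 ℕ.* suc ⌊ n /2⌋
  lemma zero          = s≤s z≤n
  lemma (suc zero)    = s≤s (s≤s z≤n)
  lemma (suc (suc n)) = ℕ.≤-trans (s≤s (s≤s (lemma n))) (ℕ.≤-reflexive (≡.sym (ℕ.*-suc 2 (suc ⌊ n /2⌋))))

hom-gammaExpansion : ∀ {c ℓ} {R : CommutativeRing c ℓ} →
  let open CommutativeRing R ; open Ops rawRing using (∑≤; _^_) in
  ∀ {φ} → IsHom ℤ[t]-CR R φ → ∀ n g → φ (gammaExpansion ℤ-ring n g) ≈
  ∑≤ ⌊ n /2⌋ (λ k → φ (constℤ (g k)) * φ Xℤ ^ k * (1# + φ Xℤ) ^ (n ∸ 2 ℕ.* k))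
hom-gammaExpansion {R = R} φ-isHom n g = trans
  (φ.∑≤-homo ⌊ n /2⌋ (λ k → constℤ (g k) PO.* Xℤ PO.^ k PO.* (PO.1# PO.+ Xℤ) PO.^ (n ∸ 2 ℕ.* k)))
  (SumLemmas.∑≤-cong R ⌊ n /2⌋ (λ k → trans (φ.*-homo (constℤ (g k) PO.* Xℤ PO.^ k) ((PO.1# PO.+ Xℤ) PO.^ (n ∸ 2 ℕ.* k)))
    (*-cong (trans (φ.*-homo (constℤ (g k)) (Xℤ PO.^ k)) (*-congˡ (φ.^-homo Xℤ k)))
      (trans (φ.^-homo (PO.1# PO.+ Xℤ) (n ∸ 2 ℕ.* k))
        (Exp.^-congˡ semiring (n ∸ 2 ℕ.* k) (trans (φ.+-homo PO.1# Xℤ) (+-congʳ φ.1#-homo)))))))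
  where
  open CommutativeRing R
  module PO = Ops ℤ[t]
  module φ = Hom {A = ℤ[t]-CR} {B = R} φ-isHom

-- The expansion of F where 1+t is invertible

module Specialization {c ℓ} (R : CommutativeRing c ℓ) {φ} (φ-isHom : IsHom ℤ[t]-CR R φ) (D : ℕ → ℕ → ℕ) (j : ℕ)
  (J-homogenize : Jᴮ j Pol.≈ Homogeneous.Q ℤ[t]-CR D j Xℤ (Pol.1# Pol.+ Xℤ)) where
  open CommutativeRing R
  private
    𝕊 = Series.commutativeRing R
    module S = CommutativeRing 𝕊
    module SO = Ops S.rawRing
    module CR = SeriesLemmas R
    module φ = Hom {A = ℤ[t]-CR} {B = R} φ-isHom
    t = φ Xℤ
  open Ops rawRing using (_^_; ∑≤; ∑; _·_)
  open Insertion R t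
  open CSG *-commutativeSemigroup using () renaming (x∙yz≈y∙xz to *-x∙yz≈y∙xz)
  open Exp semiring using (^-homo-*; ^-congʳ; ^-congˡ; ^-assocʳ)
  open CommutativeExp commutativeSemiring using (^-distrib-*)
  open SetoidReasoning setoid

  private
    ι : ℤ → Carrier
    ι = φ ∘ constℤ

    ι-isHom : IsHom ℤ-CR R ι
    ι-isHom = ∘-isHom {A = ℤ-CR} {B = ℤ[t]-CR} {C = R} φ-isHom (PolyLemmas.const-isHom ℤ-CR)

    module Σ-class = HomogeneousSum 𝕊 (∘-isHom {A = ℤ-CR} {B = R} {C = 𝕊} CR.C-isHom ι-isHom)
                       D j J-homogenize

    Q-ab : S.Carrier
    Q-ab = Homogeneous.Q 𝕊 D j (a S.* b) (a S.+ b)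

    F-tr : ∀ f → φ (F j f) ≈ tr Q-ab f
    F-tr f = begin
      φ (F j f)
        ≈⟨ hom-F {B = R} φ-isHom (f ℕ.+ m) j f (≡.trans (≡.cong (f ℕ.+_) (ℕ.+-identityʳ (2 ℕ.* j))) (ℕ.+-comm f (2 ℕ.* j))) ⟩
      ∑ (class (f ℕ.+ m) 0 f) (λ π → t ^ des π)
        ≈⟨ ClassSum.∑-class-tr R t f m ⟩
      tr ((a SO.^ m) S.* SO.∑ (class m 0 0) (λ σ → (b S.* a⁻¹) SO.^ des σ)) f
        ≈⟨ tr-cong (Σ-class.scaled-∑-class-Q {a} {a⁻¹} b a-inverse) f ⟩
      tr Q-ab f ∎
      where m = 2 ℕ.* j ℕ.+ 0

  -- The point x = t/(1+t)² exists only where 1+t has an inverse v. The homomorphism Θ sends x to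
  -- this point and W to uZ, thereby carrying the series that defines A into the ring where `tr`
  -- acts.
  module _ {v} (unit : (1# + t) * v ≈ 1#) where
    private
      x : Carrier
      x = t * v ^ 2

      module Ev = Evaluation {A = ℤ-CR} {B = R} ι-isHom x
      module EvHom = Hom {A = ℤ[t]-CR} {B = R} Ev.eval-isHom
      module Θ = Rescale {A = ℤ[t]-CR} {B = R} Ev.eval-isHom u
      module ΘHom = Hom {A = ℤ[x]⟦W⟧-CR} {B = 𝕊} Θ.rescale-isHom
      module CHom = Hom {A = R} {B = 𝕊} CR.C-isHom
      Z₁ = CR.C u S.* Z

      Θ-X : Θ.rescale PolSerLemmas.X S.≈ Z₁
      Θ-X = Θ.rescale-X

      Θ-x : Θ.rescale (PolSerLemmas.C Xℤ) S.≈ CR.C x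
      Θ-x = S.trans (Θ.rescale-C Xℤ) (CHom.cong Ev.eval-X)

      module PolSerOps = Ops PolSer.rawRing

      Θ-y : Θ.rescale A-y S.≈ CR.C x S.* (S.1# S.+ 2 SO.· Z₁ S.+ 4 SO.· (CR.C x S.* (Z₁ SO.^ 2)))
      Θ-y = S.trans (ΘHom.*-homo (PolSerLemmas.C Xℤ) (PolSerOps.1# PolSerOps.+ 2 PolSerOps.· PolSerLemmas.X PolSerOps.+ xW²₄)) (S.*-cong Θ-x
        (S.trans (ΘHom.+-homo (PolSerOps.1# PolSerOps.+ 2 PolSerOps.· PolSerLemmas.X) xW²₄) (S.+-cong
          (S.trans (ΘHom.+-homo PolSerOps.1# (2 PolSerOps.· PolSerLemmas.X)) (S.+-cong ΘHom.1#-homo (S.trans (ΘHom.·-homo 2 PolSerLemmas.X) (·-cong 2 Θ-X))))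
          (S.trans (ΘHom.·-homo 4 (PolSerLemmas.C Xℤ PolSerOps.* PolSerLemmas.X PolSerOps.^ 2)) (·-cong 4
            (S.trans (ΘHom.*-homo (PolSerLemmas.C Xℤ) (PolSerLemmas.X PolSerOps.^ 2)) (S.*-cong Θ-x
              (S.trans (ΘHom.^-homo PolSerLemmas.X 2) (Exp.^-congˡ S.semiring 2 Θ-X)))))))))
        where
        xW²₄ : PolSer.Carrier
        xW²₄ = 4 PolSerOps.· (PolSerLemmas.C Xℤ PolSerOps.* PolSerLemmas.X PolSerOps.^ 2)
        ·-cong : ∀ n {x y} → x S.≈ y → n SO.· x S.≈ n SO.· y
        ·-cong zero    _   = S.refl
        ·-cong (suc n) x≈y = S.+-cong x≈y (·-cong n x≈y)

      Θ-w : Θ.rescale A-w S.≈ S.1# S.+ (4 SO.· CR.C x) S.* Z₁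
      Θ-w = S.trans (ΘHom.cong {A-w} {PolSerOps.1# PolSerOps.+ PolSerLemmas.C (Ops._·_ ℤ[x] 4 Xℤ) PolSerOps.* PolSerLemmas.X} (PolSerLemmas.1+X≈ (Ops._·_ ℤ[x] 4 Xℤ)))
        (S.trans (ΘHom.+-homo PolSerOps.1# (PolSerLemmas.C (Ops._·_ ℤ[x] 4 Xℤ) PolSerOps.* PolSerLemmas.X)) (S.+-cong ΘHom.1#-homo
          (S.trans (ΘHom.*-homo (PolSerLemmas.C (Ops._·_ ℤ[x] 4 Xℤ)) PolSerLemmas.X) (S.*-cong
            (S.trans (Θ.rescale-C (Ops._·_ ℤ[x] 4 Xℤ)) (S.trans (CHom.cong (trans (EvHom.·-homo 4 Xℤ)
               (+-cong Ev.eval-X (+-cong Ev.eval-X (+-cong Ev.eval-X (+-congʳ Ev.eval-X)))))) (CHom.·-homo 4 x))) Θ-X))))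

      C-u : CR.C u S.≈ S.1# S.+ T
      C-u = CHom.+-homo 1# t

      C-u²x : CR.C u S.* (CR.C u S.* CR.C x) S.≈ T
      C-u²x = S.trans (S.*-congˡ {CR.C u} (S.sym (CHom.*-homo u x))) (S.trans (S.sym (CHom.*-homo u (u * x)))
        (CHom.cong (Identities.u²x R t unit)))

      scaled-A : ∀ E → E PolSer.≈ Homogeneous.Q ℤ[x]⟦W⟧-CR D j A-y A-w → CR.C (u ^ (2 ℕ.* j)) S.* Θ.rescale E S.≈ Q-ab
      scaled-A E E≈ = S.trans (S.*-cong (CHom.^-homo u (2 ℕ.* j)) (S.trans (ΘHom.cong {E} {Homogeneous.Q ℤ[x]⟦W⟧-CR D j A-y A-w} E≈)
          (Q-homo {A = ℤ[x]⟦W⟧-CR} {B = 𝕊} Θ.rescale-isHom D j A-y A-w)))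
        (S.trans (Homogeneous.Q-homogeneous 𝕊 D j (CR.C u) (Θ.rescale A-y) (Θ.rescale A-w))
          (Homogeneous.Q-cong 𝕊 D j
            (S.trans (S.*-congˡ {CR.C u SO.^ 2} Θ-y) (Identities.product 𝕊 T Z (CR.C u) (CR.C x) C-u C-u²x))
            (S.trans (S.*-congˡ {CR.C u} Θ-w) (Identities.total 𝕊 T Z (CR.C u) (CR.C x) C-u C-u²x))))

      -- In the recursion of `tr` one branch carries a factor u, and the other acquires one from the
      -- shift of a rescaled series. Pulling out u^f therefore leaves Pascal's recursion.
      tr-rescale : ∀ f E → tr (Θ.rescale E) f ≈ u ^ f * Ev.eval (binomialTransform Pol._+_ f E)
      tr-rescale zero    E = refl
      tr-rescale (suc f) E = begin
        u * tr (Θ.rescale E) f + tr (Θ.rescale E ∘ suc) f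
          ≈⟨ +-cong (*-congˡ (tr-rescale f E)) (trans (tr-cong (λ n → *-assoc u (u ^ n) _) f)
               (trans (tr-scale u (Θ.rescale (E ∘ suc)) f) (*-congˡ (tr-rescale f (E ∘ suc))))) ⟩
        u * (u ^ f * Ev.eval (binomialTransform Pol._+_ f E)) + u * (u ^ f * Ev.eval (binomialTransform Pol._+_ f (E ∘ suc)))
          ≈⟨ +-cong (*-assoc _ _ _) (*-assoc _ _ _) ⟨
        u ^ suc f * Ev.eval (binomialTransform Pol._+_ f E) + u ^ suc f * Ev.eval (binomialTransform Pol._+_ f (E ∘ suc))
          ≈⟨ distribˡ _ _ _ ⟨
        u ^ suc f * (Ev.eval (binomialTransform Pol._+_ f E) + Ev.eval (binomialTransform Pol._+_ f (E ∘ suc)))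
          ≈⟨ *-congˡ (EvHom.+-homo (binomialTransform Pol._+_ f E) (binomialTransform Pol._+_ f (E ∘ suc))) ⟨
        u ^ suc f * Ev.eval (binomialTransform Pol._+_ (suc f) E) ∎

      F-eval : ∀ f → φ (F j f) ≈ u ^ (2 ℕ.* j ℕ.+ f) * Ev.eval (A-poly D j f)
      F-eval f = begin
        φ (F j f)                                                      ≈⟨ F-tr f ⟩
        tr Q-ab f                                                      ≈⟨ tr-cong (scaled-A (A-series D j) (A-series-homogenize D j)) f ⟨
        tr (CR.C (u ^ (2 ℕ.* j)) S.* Θ.rescale (A-series D j)) f       ≈⟨ tr-C (u ^ (2 ℕ.* j)) (Θ.rescale (A-series D j)) f ⟩
        (CR.C (u ^ (2 ℕ.* j)) S.* tr (Θ.rescale (A-series D j))) f     ≈⟨ CR.C-* (u ^ (2 ℕ.* j)) (tr (Θ.rescale (A-series D j))) f ⟩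
        u ^ (2 ℕ.* j) * tr (Θ.rescale (A-series D j)) f                ≈⟨ *-congˡ (tr-rescale f (A-series D j)) ⟩
        u ^ (2 ℕ.* j) * (u ^ f * Ev.eval (A-poly D j f))               ≈⟨ *-assoc _ _ _ ⟨
        (u ^ (2 ℕ.* j) * u ^ f) * Ev.eval (A-poly D j f)               ≈⟨ *-congʳ (^-homo-* u (2 ℕ.* j) f) ⟨
        u ^ (2 ℕ.* j ℕ.+ f) * Ev.eval (A-poly D j f)                   ∎

      u^x^ : ∀ n k → 2 ℕ.* k ℕ.≤ n → u ^ n * x ^ k ≈ t ^ k * u ^ (n ∸ 2 ℕ.* k)
      u^x^ n k 2k≤n = begin
        u ^ n * x ^ k                                  ≈⟨ *-congʳ (trans (^-congʳ u (≡.sym (ℕ.m+[n∸m]≡n 2k≤n))) (^-homo-* u (2 ℕ.* k) _)) ⟩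
        (u ^ (2 ℕ.* k) * u ^ (n ∸ 2 ℕ.* k)) * x ^ k    ≈⟨ trans (*-assoc _ _ _) (trans (*-congˡ (*-comm _ _)) (sym (*-assoc _ _ _))) ⟩
        (u ^ (2 ℕ.* k) * x ^ k) * u ^ (n ∸ 2 ℕ.* k)    ≈⟨ *-congʳ (trans (*-congʳ (sym (^-assocʳ u 2 k))) (sym (^-distrib-* (u ^ 2) x k))) ⟩
        (u ^ 2 * x) ^ k * u ^ (n ∸ 2 ℕ.* k)            ≈⟨ *-congʳ (^-congˡ k (trans (*-assoc u _ x) (trans (*-congˡ (*-congʳ (*-identityʳ u))) (Identities.u²x R t unit)))) ⟩
        t ^ k * u ^ (n ∸ 2 ℕ.* k)                      ∎

    F-gammaExpansion : ∀ f → (∀ k → 2 ℕ.* j ℕ.+ f ℕ.< 2 ℕ.* k → γ D j f k ≡ + 0) →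
                       φ (F j f) ≈ φ (gammaExpansion ℤ-ring (2 ℕ.* j ℕ.+ f) (γ D j f))
    F-gammaExpansion f γ-zero = begin
      φ (F j f)
        ≈⟨ F-eval f ⟩
      u ^ n * Ev.eval (A-poly D j f)
        -- The vanishing of γ stops the sum at the last k for which u^n x^k is t^k times a
        -- nonnegative power of u.
        ≈⟨ *-congˡ (Ev.eval-expansion ⌊ n /2⌋ (A-poly D j f) (λ k k> → ≡.trans (coeff-A-poly D j f k) (γ-zero k (half-< k>)))) ⟩
      u ^ n * ∑≤ ⌊ n /2⌋ (λ k → ι (coeffℤ (A-poly D j f) k) * x ^ k)
        ≈⟨ SumLemmas.*-distribˡ-∑≤ R ⌊ n /2⌋ (u ^ n) (λ k → ι (coeffℤ (A-poly D j f) k) * x ^ k) ⟩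
      ∑≤ ⌊ n /2⌋ (λ k → u ^ n * (ι (coeffℤ (A-poly D j f) k) * x ^ k))
        ≈⟨ SumLemmas.∑≤-cong-≤ R ⌊ n /2⌋ (λ k k≤ → trans (*-x∙yz≈y∙xz (u ^ n) (ι (coeffℤ (A-poly D j f) k)) (x ^ k))
             (trans (*-cong (reflexive (≡.cong ι (coeff-A-poly D j f k))) (u^x^ n k (half-≤ k≤))) (sym (*-assoc _ _ _)))) ⟩
      ∑≤ ⌊ n /2⌋ (λ k → ι (γ D j f k) * t ^ k * u ^ (n ∸ 2 ℕ.* k))
        ≈⟨ hom-gammaExpansion {R = R} φ-isHom n (γ D j f) ⟨
      φ (gammaExpansion ℤ-ring n (γ D j f)) ∎
      where
      n = 2 ℕ.* j ℕ.+ f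

-- Nonnegativity and the degree bound

Natural : ℤ → Set
Natural z = ∃ λ a → z ≡ + a

natural-+ : ∀ {y z} → Natural y → Natural z → Natural (y ℤ.+ z)
natural-+ (a , ≡.refl) (b , ≡.refl) = a ℕ.+ b , ≡.refl

natural-* : ∀ {y z} → Natural y → Natural z → Natural (y ℤ.* z)
natural-* (a , ≡.refl) (b , ≡.refl) = a ℕ.* b , ≡.sym (ℤ.pos-* a b)

∑≤-closed : ∀ {c ℓ} (R : CommutativeRing c ℓ) {p} (P : CommutativeRing.Carrier R → Set p) →
  (∀ {x y} → P x → P y → P (CommutativeRing._+_ R x y)) → P (CommutativeRing.0# R) →
  ∀ n {f} → (∀ i → i ℕ.≤ n → P (f i)) → P (Ops.∑≤ (CommutativeRing.rawRing R) n f)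
∑≤-closed R P P-+ P-0 zero    Pf = P-+ (Pf 0 z≤n) P-0
∑≤-closed R P P-+ P-0 (suc n) Pf = P-+ (Pf 0 z≤n) (∑≤-closed R P P-+ P-0 n (λ i i≤n → Pf (suc i) (s≤s i≤n)))

natural-∑≤ : ∀ n {f} → (∀ i → i ℕ.≤ n → Natural (f i)) → Natural (Ops.∑≤ ℤ-ring n f)
natural-∑≤ = ∑≤-closed ℤ-CR Natural natural-+ (0 , ≡.refl)

Graded : ℕ → List ℤ → Set
Graded n p = ∀ k → Natural (coeffℤ p k) × (n ℕ.< 2 ℕ.* k → coeffℤ p k ≡ + 0)

graded-≈ : ∀ {n p q} → q Pol.≈ p → Graded n p → Graded n q
graded-≈ q≈p g k = (proj₁ (proj₁ (g k)) , ≡.trans (q≈p k) (proj₂ (proj₁ (g k)))) , λ n< → ≡.trans (q≈p k) (proj₂ (g k) n<)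

graded-0 : ∀ {n} → Graded n []
graded-0 k = (0 , ≡.refl) , λ _ → ≡.refl

NaturalPoly : List ℤ → Set
NaturalPoly p = ∀ k → Natural (coeffℤ p k)

naturalPoly-+ : ∀ {p q} → NaturalPoly p → NaturalPoly q → NaturalPoly (p Pol.+ q)
naturalPoly-+ {p} {q} np nq k = _ , ≡.trans (Poly.coeff-add ℤ-CR p q k) (proj₂ (natural-+ (np k) (nq k)))

naturalPoly-* : ∀ {p q} → NaturalPoly p → NaturalPoly q → NaturalPoly (p Pol.* q)
naturalPoly-* {p} {q} np nq k = _ , ≡.trans (Poly.coeff-mul ℤ-CR p q k)
  (proj₂ (natural-∑≤ k {λ i → coeffℤ p i ℤ.* coeffℤ q (k ∸ i)} (λ i _ → natural-* (np i) (nq (k ∸ i)))))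

graded-+ : ∀ {n p q} → Graded n p → Graded n q → Graded n (p Pol.+ q)
graded-+ {n} {p} {q} gp gq k =
    naturalPoly-+ {p} {q} (λ k → proj₁ (gp k)) (λ k → proj₁ (gq k)) k
  , λ n< → ≡.trans (Poly.coeff-add ℤ-CR p q k) (≡.cong₂ ℤ._+_ (proj₂ (gp k) n<) (proj₂ (gq k) n<))

graded-* : ∀ {m n p q} → Graded m p → Graded n q → Graded (m ℕ.+ n) (p Pol.* q)
graded-* {m} {n} {p} {q} gp gq k =
    naturalPoly-* {p} {q} (λ k → proj₁ (gp k)) (λ k → proj₁ (gq k)) k
  , λ n< → ≡.trans (Poly.coeff-mul ℤ-CR p q k) (SumLemmas.∑≤-zero ℤ-CR k {f} (term n<))
  where
  f : ℕ → ℤ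
  f i = coeffℤ p i ℤ.* coeffℤ q (k ∸ i)
  term : m ℕ.+ n ℕ.< 2 ℕ.* k → ∀ i → i ℕ.≤ k → f i ≡ + 0
  term n< i i≤k with m ℕ.<? 2 ℕ.* i | n ℕ.<? 2 ℕ.* (k ∸ i)
  ... | yes m< | _ = ≡.cong (ℤ._* coeffℤ q (k ∸ i)) (proj₂ (gp i) m<)
  ... | no _ | yes n<′ = ≡.trans (≡.cong (coeffℤ p i ℤ.*_) (proj₂ (gq (k ∸ i)) n<′)) (ℤ.*-zeroʳ (coeffℤ p i))
  -- If both factors could be nonzero, then 2i ≤ m and 2(k-i) ≤ n, which would add up to 2k ≤ m+n.
  ... | no m≮ | no n≮ = contradiction n< (ℕ.≤⇒≯ (ℕ.≤-trans
          (ℕ.≤-reflexive (≡.trans (≡.cong (2 ℕ.*_) (≡.sym (ℕ.m+[n∸m]≡n i≤k))) (ℕ.*-distribˡ-+ 2 i (k ∸ i))))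
          (ℕ.+-mono-≤ (ℕ.≮⇒≥ m≮) (ℕ.≮⇒≥ n≮))))

-- The coefficient of x^k W^r may be nonzero only for 2k ≤ m+r. In effect x has weight 2 and W
-- weight -1, and m bounds the total; the bounds add under products.
GradedSeries : ℕ → (ℕ → List ℤ) → Set
GradedSeries m E = ∀ r → Graded (m ℕ.+ r) (E r)

gradedSeries-≈ : ∀ {m E E′} → E′ PolSer.≈ E → GradedSeries m E → GradedSeries m E′
gradedSeries-≈ {E = E} {E′} E′≈E g r = graded-≈ {p = E r} {q = E′ r} (E′≈E r) (g r)

gradedSeries-+ : ∀ {m E E′} → GradedSeries m E → GradedSeries m E′ → GradedSeries m (E PolSer.+ E′)
gradedSeries-+ {E = E} {E′} g g′ r = graded-+ {p = E r} {q = E′ r} (g r) (g′ r)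

gradedSeries-0 : ∀ {m} → GradedSeries m PolSer.0#
gradedSeries-0 r = graded-0

gradedSeries-* : ∀ {m n E E′} → GradedSeries m E → GradedSeries n E′ → GradedSeries (m ℕ.+ n) (E PolSer.* E′)
gradedSeries-* {m} {n} {E} {E′} g g′ r = ∑≤-closed ℤ[t]-CR (Graded (m ℕ.+ n ℕ.+ r))
  (λ {p} {q} → graded-+ {p = p} {q = q}) graded-0 r {λ i → E i Pol.* E′ (r ∸ i)} (λ i i≤r →
    ≡.subst (λ l → Graded l (E i Pol.* E′ (r ∸ i)))
      (≡.trans (lemma m i n (r ∸ i)) (≡.cong (m ℕ.+ n ℕ.+_) (ℕ.m+[n∸m]≡n i≤r)))
      (graded-* {p = E i} {q = E′ (r ∸ i)} (g i) (g′ (r ∸ i))))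
  where
  lemma : ∀ a b c d → (a ℕ.+ b) ℕ.+ (c ℕ.+ d) ≡ a ℕ.+ c ℕ.+ (b ℕ.+ d)
  lemma = solve-∀

gradedSeries-1 : GradedSeries 0 PolSer.1#
gradedSeries-1 zero    zero    = (1 , ≡.refl) , λ ()
gradedSeries-1 zero    (suc k) = (0 , ≡.refl) , λ _ → ≡.refl
gradedSeries-1 (suc r) k       = (0 , ≡.refl) , λ _ → ≡.refl

module PolSerOps = Ops PolSer.rawRing

gradedSeries-^ : ∀ {m E} → GradedSeries m E → ∀ n → GradedSeries (n ℕ.* m) (E PolSerOps.^ n)
gradedSeries-^ g zero    = gradedSeries-1
gradedSeries-^ {m} {E} g (suc n) = gradedSeries-* {m} {n ℕ.* m} {E} {E PolSerOps.^ n} g (gradedSeries-^ {m} {E} g n)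

gradedSeries-· : ∀ {m E} → GradedSeries m E → ∀ n → GradedSeries m (n PolSerOps.· E)
gradedSeries-· {m} g zero        = gradedSeries-0 {m}
gradedSeries-· {m} {E} g (suc n) = gradedSeries-+ {m} {E} {n PolSerOps.· E} g (gradedSeries-· {m} {E} g n)

gradedSeries-W : GradedSeries 0 PolSerLemmas.X
gradedSeries-W zero          k       = (0 , ≡.refl) , λ _ → ≡.refl
gradedSeries-W (suc zero)    zero    = (1 , ≡.refl) , λ ()
gradedSeries-W (suc zero)    (suc k) = (0 , ≡.refl) , λ _ → ≡.refl
gradedSeries-W (suc (suc r)) k       = (0 , ≡.refl) , λ _ → ≡.refl

graded-X : Graded 2 Xℤ
graded-X zero          = (0 , ≡.refl) , λ ()
graded-X (suc zero)    = (1 , ≡.refl) , λ { (s≤s (s≤s ())) }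
graded-X (suc (suc k)) = (0 , ≡.refl) , λ _ → ≡.refl

gradedSeries-x : GradedSeries 2 (PolSerLemmas.C Xℤ)
gradedSeries-x zero    = graded-X
gradedSeries-x (suc r) = graded-0

-- The product rule would give only the bound 2, because the bound 0 used for W is weaker than its
-- true weight -1. Computing xW² directly yields 0, so that y keeps the bound 2 of x.
gradedSeries-xW² : GradedSeries 0 (PolSerLemmas.C Xℤ PolSerOps.* PolSerLemmas.X PolSerOps.^ 2)
gradedSeries-xW² = gradedSeries-≈ {0} {λ r → Xℤ Pol.* W² r} {PolSerLemmas.C Xℤ PolSerOps.* PolSerLemmas.X PolSerOps.^ 2} (λ r → Pol.trans {(PolSerLemmas.C Xℤ PolSer.* (PolSerLemmas.X PolSerOps.^ 2)) r} {Xℤ Pol.* (PolSerLemmas.X PolSerOps.^ 2) r} {Xℤ Pol.* W² r}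
    (PolSerLemmas.C-* Xℤ (PolSerLemmas.X PolSerOps.^ 2) r) (Pol.*-congˡ {Xℤ} {(PolSerLemmas.X PolSerOps.^ 2) r} {W² r} (W²≈ r))) graded
  where
  W² : ℕ → List ℤ
  W² zero          = []
  W² (suc zero)    = []
  W² (suc (suc r)) = PolSer.1# r

  W*W : ℕ → List ℤ
  W*W = PolSerLemmas.X PolSer.* (PolSerLemmas.X PolSer.* PolSer.1#)

  W²≈ : ∀ r → W*W r Pol.≈ W² r
  W²≈ zero          = PolSerLemmas.X-*-zero (PolSerLemmas.X PolSer.* PolSer.1#)
  W²≈ (suc zero)    = Pol.trans {W*W 1} {(PolSerLemmas.X PolSer.* PolSer.1#) 0} {[]} (PolSerLemmas.X-*-suc (PolSerLemmas.X PolSer.* PolSer.1#) 0) (PolSerLemmas.X-*-zero PolSer.1#)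
  W²≈ (suc (suc r)) = Pol.trans {W*W (suc (suc r))} {(PolSerLemmas.X PolSer.* PolSer.1#) (suc r)} {PolSer.1# r}
    (PolSerLemmas.X-*-suc (PolSerLemmas.X PolSer.* PolSer.1#) (suc r)) (PolSerLemmas.X-*-suc PolSer.1# r)

  X*0 : ∀ n → Graded n (Xℤ Pol.* [])
  X*0 n = graded-≈ {n} {[]} {Xℤ Pol.* []} (Pol.zeroʳ Xℤ) graded-0

  graded : GradedSeries 0 (λ r → Xℤ Pol.* W² r)
  graded zero                = X*0 0
  graded (suc zero)          = X*0 1
  graded (suc (suc zero))    = graded-≈ {2} {Xℤ} {Xℤ Pol.* Pol.1#} (Pol.*-identityʳ Xℤ) graded-X
  graded (suc (suc (suc r))) = X*0 (3 ℕ.+ r)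

gradedSeries-y : GradedSeries 2 A-y
gradedSeries-y = gradedSeries-* {2} {0} {PolSerLemmas.C Xℤ} {PolSerOps.1# PolSerOps.+ 2 PolSerOps.· PolSerLemmas.X PolSerOps.+ 4 PolSerOps.· xW²} gradedSeries-x
  (gradedSeries-+ {0} {PolSerOps.1# PolSerOps.+ 2 PolSerOps.· PolSerLemmas.X} {4 PolSerOps.· xW²}
    (gradedSeries-+ {0} {PolSerOps.1#} {2 PolSerOps.· PolSerLemmas.X} gradedSeries-1 (gradedSeries-· {0} {PolSerLemmas.X} gradedSeries-W 2))
    (gradedSeries-· {0} {xW²} gradedSeries-xW² 4))
  where
  xW² : PolSer.Carrier
  xW² = PolSerLemmas.C Xℤ PolSerOps.* PolSerLemmas.X PolSerOps.^ 2

-- The term 4xW has weight exactly 1. It is checked coefficient by coefficient, as the bounds for x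
-- and W would add up to 2.
gradedSeries-w : GradedSeries 1 A-w
gradedSeries-w zero          zero          = (1 , ≡.refl) , λ ()
gradedSeries-w zero          (suc k)       = (0 , ≡.refl) , λ _ → ≡.refl
gradedSeries-w (suc zero)    zero          = (0 , ≡.refl) , λ ()
gradedSeries-w (suc zero)    (suc zero)    = (4 , ≡.refl) , λ { (s≤s (s≤s ())) }
gradedSeries-w (suc zero)    (suc (suc k)) = (0 , ≡.refl) , λ _ → ≡.refl
gradedSeries-w (suc (suc r)) k             = (0 , ≡.refl) , λ _ → ≡.refl

-- Every term of `Q` is a natural multiple of y^s w^{2(j-s)}, whose bound is 2s + 2(j-s) = 2j.
-- Homogenizing first removes the inverse series, whose coefficients have signs.
gradedSeries-A : ∀ D j → GradedSeries (2 ℕ.* j) (A-series D j)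
gradedSeries-A D j = gradedSeries-≈ {2 ℕ.* j} {Homogeneous.Q ℤ[x]⟦W⟧-CR D j A-y A-w} {A-series D j} (A-series-homogenize D j)
  (∑≤-closed ℤ[x]⟦W⟧-CR (GradedSeries (2 ℕ.* j)) (λ {E} {E′} → gradedSeries-+ {2 ℕ.* j} {E} {E′}) (gradedSeries-0 {2 ℕ.* j}) j {term}
    (λ s s≤j → gradedSeries-· {2 ℕ.* j} {A-y PolSerOps.^ s PolSerOps.* A-w PolSerOps.^ (2 ℕ.* (j ∸ s))}
      (≡.subst (λ l → GradedSeries l (A-y PolSerOps.^ s PolSerOps.* A-w PolSerOps.^ (2 ℕ.* (j ∸ s))))
        (≡.trans (lemma s (j ∸ s)) (≡.cong (2 ℕ.*_) (ℕ.m+[n∸m]≡n s≤j)))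
        (gradedSeries-* {s ℕ.* 2} {2 ℕ.* (j ∸ s) ℕ.* 1} {A-y PolSerOps.^ s} {A-w PolSerOps.^ (2 ℕ.* (j ∸ s))}
          (gradedSeries-^ {2} {A-y} gradedSeries-y s) (gradedSeries-^ {1} {A-w} gradedSeries-w (2 ℕ.* (j ∸ s))))) (D j s)))
  where
  term : ℕ → PolSer.Carrier
  term s = D j s PolSerOps.· (A-y PolSerOps.^ s PolSerOps.* A-w PolSerOps.^ (2 ℕ.* (j ∸ s)))
  lemma : ∀ s e → s ℕ.* 2 ℕ.+ 2 ℕ.* e ℕ.* 1 ≡ 2 ℕ.* (s ℕ.+ e)
  lemma = solve-∀

A-natural : ∀ D j k r → Natural (A D j k r)
A-natural D j k r = proj₁ (gradedSeries-A D j r k)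

γ-natural : ∀ D j f k → Natural (γ D j f k)
γ-natural D j f k = natural-∑≤ f (λ r _ → natural-* (A-natural D j k r) (f choose r , ≡.refl))

γ-vanishes : ∀ D j f k → 2 ℕ.* j ℕ.+ f ℕ.< 2 ℕ.* k → γ D j f k ≡ + 0
γ-vanishes D j f k n< = SumLemmas.∑≤-zero ℤ-CR f {λ r → A D j k r ℤ.* + (f choose r)}
  (λ r r≤f → ≡.cong (ℤ._* + (f choose r)) (proj₂ (gradedSeries-A D j r k) (ℕ.≤-<-trans (ℕ.+-monoʳ-≤ (2 ℕ.* j) r≤f) n<)))

-- Regrouping by the number of two-cycles

module Partition {c ℓ} (R : CommutativeRing c ℓ) where
  open CommutativeRing R
  open Ops rawRing using (∑; ∑≤)
  open SumLemmas R
  open SetoidReasoning setoid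

  private
    delta : ∀ N m w → m ℕ.≤ N → ∑≤ N (λ j → if does (m ℕ.≟ j) then w else 0#) ≈ w
    delta zero    zero    w _         = +-identityʳ w
    delta (suc N) zero    w _         = trans (+-congˡ (∑≤-zero N (λ _ _ → refl))) (+-identityʳ w)
    delta (suc N) (suc m) w (s≤s m≤N) = trans (+-identityˡ _) (delta N m w m≤N)

  ∑-partition : ∀ {A : Set} (κ : A → ℕ) N xs (f : A → Carrier) → (∀ {x} → x ∈ xs → κ x ℕ.≤ N) →
                ∑ xs f ≈ ∑≤ N (λ j → ∑ (filter (λ x → κ x ℕ.≟ j) xs) f)
  ∑-partition κ N []       f κ≤N = sym (∑≤-zero N (λ _ _ → refl))
  ∑-partition κ N (x ∷ xs) f κ≤N = begin
    f x + ∑ xs f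
      ≈⟨ +-cong (delta N (κ x) (f x) (κ≤N (here ≡.refl))) (sym (∑-partition κ N xs f (κ≤N ∘ there))) ⟨
    ∑≤ N (λ j → if does (κ x ℕ.≟ j) then f x else 0#) + ∑≤ N (λ j → ∑ (filter (λ x → κ x ℕ.≟ j) xs) f)
      ≈⟨ ∑≤-distrib-+ N (λ j → if does (κ x ℕ.≟ j) then f x else 0#) (λ j → ∑ (filter (λ x → κ x ℕ.≟ j) xs) f) ⟨
    ∑≤ N (λ j → (if does (κ x ℕ.≟ j) then f x else 0#) + ∑ (filter (λ x → κ x ℕ.≟ j) xs) f)
      ≈⟨ ∑≤-cong N step ⟩
    ∑≤ N (λ j → ∑ (filter (λ x → κ x ℕ.≟ j) (x ∷ xs)) f) ∎
    where
    step : ∀ j → (if does (κ x ℕ.≟ j) then f x else 0#) + ∑ (filter (λ x → κ x ℕ.≟ j) xs) f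
           ≈ ∑ (filter (λ x → κ x ℕ.≟ j) (x ∷ xs)) f
    step j with does (κ x ℕ.≟ j)
    ... | true  = refl
    ... | false = +-identityˡ _

  ∑≤-comm : ∀ m n (f : ℕ → ℕ → Carrier) → ∑≤ m (λ i → ∑≤ n (f i)) ≈ ∑≤ n (λ j → ∑≤ m (λ i → f i j))
  ∑≤-comm m n f = Sum.∑-comm semiring {suc m} {suc n} (λ i j → f (toℕ i) (toℕ j))

cyc₂≤half : ∀ {n} {π : Word n} → Involutive π → cyc₂ π ℕ.≤ ⌊ n /2⌋
cyc₂≤half {n} {π} inv = ℕ.≮⇒≥ λ half< → ℕ.<-irrefl ≡.refl
  (ℕ.<-≤-trans (half-< half<) (ℕ.≤-trans (ℕ.m≤m+n _ (fix π)) (ℕ.≤-reflexive (2cyc₂+fix≡n {π = π} inv))))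

cyc₂-↭ : ∀ n j → 2 ℕ.* j ℕ.≤ n → filter (λ π → cyc₂ π ℕ.≟ j) (𝓘 n) ↭ class n 0 (n ∸ 2 ℕ.* j)
cyc₂-↭ n j 2j≤n = unique-↭ (Unique.filter⁺ P? (𝓘! n)) (class! n 0 (n ∸ 2 ℕ.* j))
  (λ {π} π∈ → let π∈𝓘 , cyc≡ = ∈-filter⁻ P? {xs = 𝓘 n} π∈
                  inv = ∈𝓘⁻ {π = π} π∈𝓘 in
    ∈class⁺ {g = 0} {π = π} inv (λ _ ()) (ℕ.+-cancelˡ-≡ (2 ℕ.* j) _ _
      (≡.trans (≡.trans (≡.cong (λ c → 2 ℕ.* c ℕ.+ fix π) (≡.sym cyc≡)) (2cyc₂+fix≡n {π = π} inv)) (≡.sym (ℕ.m+[n∸m]≡n 2j≤n)))))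
  (λ {π} π∈ → let inv , _ , fix≡ = ∈class⁻ {g = 0} {f = n ∸ 2 ℕ.* j} {π = π} π∈ in
    ∈-filter⁺ P? (∈𝓘⁺ {π = π} inv) (ℕ.*-cancelˡ-≡ (cyc₂ π) j 2 (ℕ.+-cancelʳ-≡ (n ∸ 2 ℕ.* j) (2 ℕ.* cyc₂ π) (2 ℕ.* j)
      (≡.trans (≡.cong (2 ℕ.* cyc₂ π ℕ.+_) (≡.sym fix≡)) (≡.trans (2cyc₂+fix≡n {π = π} inv) (≡.sym (ℕ.m+[n∸m]≡n 2j≤n)))))))
  where
  P? = λ π → cyc₂ π ℕ.≟ j

-- C_{n,k}, as a polynomial over ℤ.
C-poly : (ℕ → ℕ → ℕ) → ℕ → ℕ → List ℤ
C-poly D n k = Ops.∑≤ ℤ[p] ⌊ n /2⌋ (λ j → Xℤ ^ (n ∸ 2 ℕ.* j) * constℤ (γ D j (n ∸ 2 ℕ.* j) k))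
  where open Ops ℤ[p]

C-poly-natural : ∀ D n k → NaturalPoly (C-poly D n k)
C-poly-natural D n k = ∑≤-closed ℤ[t]-CR NaturalPoly (λ {p} {q} → naturalPoly-+ {p} {q}) (λ _ → 0 , ≡.refl) ⌊ n /2⌋
  {λ j → Xℤ PO.^ (n ∸ 2 ℕ.* j) PO.* constℤ (γ D j (n ∸ 2 ℕ.* j) k)}
  (λ j _ → naturalPoly-* {Xℤ PO.^ (n ∸ 2 ℕ.* j)} {constℤ (γ D j (n ∸ 2 ℕ.* j) k)} (power (n ∸ 2 ℕ.* j))
    (λ { zero → γ-natural D j (n ∸ 2 ℕ.* j) k ; (suc _) → 0 , ≡.refl }))
  where
  module PO = Ops ℤ[p]
  power : ∀ m → NaturalPoly (Xℤ PO.^ m)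
  power zero    zero    = 1 , ≡.refl
  power zero    (suc k) = 0 , ≡.refl
  power (suc m)         = naturalPoly-* {Xℤ} {Xℤ PO.^ m} (λ k → proj₁ (graded-X k)) (power m)

-- Turns a polynomial over ℤ with natural coefficients into an honest list of natural numbers, as
-- membership in ℕ[p] demands.
map-abs : ∀ p → NaturalPoly p → map +_ (map ∣_∣ p) Pol.≈ p
map-abs []      nat k       = ≡.refl
map-abs (z ∷ p) nat zero    with a , ≡.refl ← nat 0 = ≡.refl
map-abs (z ∷ p) nat (suc k) = map-abs p (nat ∘ suc) k

-- φ and ψ stand for the inclusions of ℤ[t] and ℤ[p] into ℤ[p][t].
module Regroup {c ℓ} (R : CommutativeRing c ℓ) {φ ψ} (φ-isHom : IsHom ℤ[t]-CR R φ) (ψ-isHom : IsHom ℤ[t]-CR R ψ)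
  (D : ℕ → ℕ → ℕ) (F≈ : ∀ j f → F j f Pol.≈ gammaExpansion ℤ-ring (2 ℕ.* j ℕ.+ f) (γ D j f)) where
  open CommutativeRing R
  open Ops rawRing using (∑; ∑≤; _^_)
  open SumLemmas R
  open ListSums R
  open Partition R
  open SetoidReasoning setoid
  open Exp semiring using (^-congˡ)

  -- The numbers γ arise as constants of ℤ[t] and have to become coefficients of polynomials in p.
  -- The agreement of φ and ψ on integers moves them from one ring to the other.
  module _ (φ≈ψ : ∀ z → φ (constℤ z) ≈ ψ (constℤ z)) {t} (φ-X : φ Xℤ ≈ t) where
    private
      module φ = Hom {A = ℤ[t]-CR} {B = R} φ-isHom
      module ψ = Hom {A = ℤ[t]-CR} {B = R} ψ-isHom
      g = γ D
      e : ℕ → Carrier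
      e f = ψ (Ops._^_ ℤ[p] Xℤ f)
      κ : ℕ → ℕ → ℕ → Carrier
      κ n j k = ψ (constℤ (g j (n ∸ 2 ℕ.* j) k))
      power : ℕ → ℕ → Carrier
      power n k = t ^ k * (1# + t) ^ (n ∸ 2 ℕ.* k)

    class-expansion : ∀ n j → 2 ℕ.* j ℕ.≤ n → ∑ (class n 0 (n ∸ 2 ℕ.* j)) (λ π → t ^ des π) ≈ ∑≤ ⌊ n /2⌋ (λ k → κ n j k * power n k)
    class-expansion n j 2j≤n = begin
      ∑ (class n 0 f) (λ π → t ^ des π)
        ≈⟨ ∑-cong (class n 0 f) (λ π → ^-congˡ (des π) φ-X) ⟨
      ∑ (class n 0 f) (λ π → φ Xℤ ^ des π)
        ≈⟨ hom-F {B = R} φ-isHom n j f n≡ ⟨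
      φ (F j f)
        ≈⟨ φ.cong {F j f} {gammaExpansion ℤ-ring (2 ℕ.* j ℕ.+ f) (g j f)} (F≈ j f) ⟩
      φ (gammaExpansion ℤ-ring (2 ℕ.* j ℕ.+ f) (g j f))
        ≈⟨ reflexive (≡.cong (λ n → φ (gammaExpansion ℤ-ring n (g j f))) (≡.sym n≡)) ⟩
      φ (gammaExpansion ℤ-ring n (g j f))
        ≈⟨ hom-gammaExpansion {R = R} φ-isHom n (g j f) ⟩
      ∑≤ ⌊ n /2⌋ (λ k → φ (constℤ (g j f k)) * φ Xℤ ^ k * (1# + φ Xℤ) ^ (n ∸ 2 ℕ.* k))
        ≈⟨ ∑≤-cong ⌊ n /2⌋ (λ k → *-cong (*-cong (φ≈ψ (g j f k)) (^-congˡ k φ-X)) (^-congˡ (n ∸ 2 ℕ.* k) (+-congˡ {1#} φ-X))) ⟩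
      ∑≤ ⌊ n /2⌋ (λ k → κ n j k * t ^ k * (1# + t) ^ (n ∸ 2 ℕ.* k))
        ≈⟨ ∑≤-cong ⌊ n /2⌋ (λ k → *-assoc (κ n j k) (t ^ k) ((1# + t) ^ (n ∸ 2 ℕ.* k))) ⟩
      ∑≤ ⌊ n /2⌋ (λ k → κ n j k * power n k) ∎
      where
      f = n ∸ 2 ℕ.* j
      n≡ : n ≡ 2 ℕ.* j ℕ.+ f
      n≡ = ≡.sym (ℕ.m+[n∸m]≡n 2j≤n)

    regroup : ∀ n → ∑ (𝓘 n) (λ π → e (fix π) * t ^ des π) ≈
      ∑≤ ⌊ n /2⌋ (λ k → ψ (map +_ (map ∣_∣ (C-poly D n k))) * t ^ k * (1# + t) ^ (n ∸ 2 ℕ.* k))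
    regroup n = begin
      ∑ (𝓘 n) w
        ≈⟨ ∑-partition cyc₂ N (𝓘 n) w (λ {π} π∈ → cyc₂≤half {π = π} (∈𝓘⁻ π∈)) ⟩
      ∑≤ N (λ j → ∑ (filter (λ π → cyc₂ π ℕ.≟ j) (𝓘 n)) w)
        ≈⟨ ∑≤-cong-≤ N (λ j j≤ → block j (half-≤ j≤)) ⟩
      ∑≤ N (λ j → ∑≤ N (λ k → e (n ∸ 2 ℕ.* j) * (κ n j k * power n k)))
        -- With f = n-2j all blocks are expanded in the same polynomials t^k (1+t)^{n-2k}, so the
        -- two sums can be exchanged and the sum over j becomes the coefficient.
        ≈⟨ ∑≤-comm N N (λ j k → e (n ∸ 2 ℕ.* j) * (κ n j k * power n k)) ⟩
      ∑≤ N (λ k → ∑≤ N (λ j → e (n ∸ 2 ℕ.* j) * (κ n j k * power n k)))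
        ≈⟨ ∑≤-cong N (λ k → trans (∑≤-cong N (λ j → sym (*-assoc (e (n ∸ 2 ℕ.* j)) (κ n j k) (power n k))))
             (trans (sym (*-distribʳ-∑≤ N (power n k) (λ j → e (n ∸ 2 ℕ.* j) * κ n j k))) (sym (*-assoc _ _ _)))) ⟩
      ∑≤ N (λ k → ∑≤ N (λ j → e (n ∸ 2 ℕ.* j) * κ n j k) * t ^ k * (1# + t) ^ (n ∸ 2 ℕ.* k))
        ≈⟨ ∑≤-cong N (λ k → *-congʳ {(1# + t) ^ (n ∸ 2 ℕ.* k)} (*-congʳ {t ^ k} (sym (C-eq k)))) ⟩
      ∑≤ N (λ k → ψ (map +_ (map ∣_∣ (C-poly D n k))) * t ^ k * (1# + t) ^ (n ∸ 2 ℕ.* k)) ∎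
      where
      N = ⌊ n /2⌋
      w : Word n → Carrier
      w π = e (fix π) * t ^ des π
      C-eq : ∀ k → ψ (map +_ (map ∣_∣ (C-poly D n k))) ≈ ∑≤ N (λ j → e (n ∸ 2 ℕ.* j) * κ n j k)
      C-eq k = trans (ψ.cong {map +_ (map ∣_∣ (C-poly D n k))} {C-poly D n k} (map-abs (C-poly D n k) (C-poly-natural D n k)))
        (trans (ψ.∑≤-homo N (λ j → Ops._^_ ℤ[p] Xℤ (n ∸ 2 ℕ.* j) Pol.* constℤ (γ D j (n ∸ 2 ℕ.* j) k)))
          (∑≤-cong N (λ j → ψ.*-homo (Ops._^_ ℤ[p] Xℤ (n ∸ 2 ℕ.* j)) (constℤ (γ D j (n ∸ 2 ℕ.* j) k)))))
      block : ∀ j → 2 ℕ.* j ℕ.≤ n → ∑ (filter (λ π → cyc₂ π ℕ.≟ j) (𝓘 n)) w ≈ ∑≤ N (λ k → e (n ∸ 2 ℕ.* j) * (κ n j k * power n k))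
      block j 2j≤n = begin
        ∑ (filter (λ π → cyc₂ π ℕ.≟ j) (𝓘 n)) w
          ≈⟨ ∑-↭ w (cyc₂-↭ n j 2j≤n) ⟩
        ∑ (class n 0 f) w
          ≈⟨ ∑-cong-∈ (class n 0 f) (λ {π} π∈ → *-congʳ (reflexive (≡.cong e (proj₂ (proj₂ (∈class⁻ {g = 0} {f = f} {π = π} π∈)))))) ⟩
        ∑ (class n 0 f) (λ π → e f * t ^ des π)
          ≈⟨ *-distribˡ-∑ (e f) (class n 0 f) (λ π → t ^ des π) ⟨
        e f * ∑ (class n 0 f) (λ π → t ^ des π)
          ≈⟨ *-congˡ (class-expansion n j 2j≤n) ⟩
        e f * ∑≤ N (λ k → κ n j k * power n k)
          ≈⟨ *-distribˡ-∑≤ N (e f) (λ k → κ n j k * power n k) ⟩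
        ∑≤ N (λ k → e f * (κ n j k * power n k)) ∎
        where f = n ∸ 2 ℕ.* j

-- The coefficient rings of the theorem

module Inclusion where
  constₚ : List ℤ → List (List ℤ)
  constₚ = Polynomial.const ℤ[p]

  constₚ-isHom : IsHom ℤ[t]-CR ℤ[p][t]-CR constₚ
  constₚ-isHom = PolyLemmas.const-isHom ℤ[t]-CR

  open Evaluation {A = ℤ-CR} {B = ℤ[p][t]-CR}
    (∘-isHom {A = ℤ-CR} {B = ℤ[t]-CR} {C = ℤ[p][t]-CR} constₚ-isHom (PolyLemmas.const-isHom ℤ-CR)) (Polynomial.X ℤ[p]) public

private
  coeff-isHom : IsHom ℤ[t]-CR ℤ⟦t⟧-CR coeffℤ
  coeff-isHom = PolyLemmas.coeff-isHom ℤ-CR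

  t u v : Ser.Carrier
  t = SeriesLemmas.X ℤ-CR
  u = PowerSeries.1+_X ℤ-ring (+ 1)
  v = PowerSeries.1/1+_X ℤ-ring (+ 1)

  u≈1+t : u Ser.≈ Ser.1# Ser.+ t
  u≈1+t zero          = ≡.refl
  u≈1+t (suc zero)    = ≡.refl
  u≈1+t (suc (suc n)) = ≡.refl

  uv≈1 : u Ser.* v Ser.≈ Ser.1#
  uv≈1 = SeriesLemmas.1+X-inverse ℤ-CR (+ 1)

-- The given identity lives in power series because of the inverse of 1+t. Once that is cleared both
-- sides are coefficient sequences of polynomials, and equality of polynomials is equality of these
-- sequences.
J-homogenize : ∀ D → IsGammaVector D → ∀ j → Jᴮ j Pol.≈ Homogeneous.Q ℤ[t]-CR D j Xℤ (Pol.1# Pol.+ Xℤ)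
J-homogenize D hyp j = Ser.trans {coeffℤ (Jᴮ j)} {_} {coeffℤ Q} (hyp j)
  (Ser.trans {_} {Homogeneous.Q ℤ⟦t⟧-CR D j t u} {_} (Homogeneous.P-homogenize ℤ⟦t⟧-CR D j {w = u} {v = v} t uv≈1)
    (Ser.sym {coeffℤ Q} {Homogeneous.Q ℤ⟦t⟧-CR D j t u} (Q-homo {A = ℤ[t]-CR} {B = ℤ⟦t⟧-CR} coeff-isHom D j Xℤ (Pol.1# Pol.+ Xℤ))))
  where
  Q = Homogeneous.Q ℤ[t]-CR D j Xℤ (Pol.1# Pol.+ Xℤ)

-- The specialization is the embedding of ℤ[t] into ℤ⟦t⟧, where 1+t is invertible and from which
-- equalities of polynomials can be read back.
F≈gammaExpansion : ∀ D → IsGammaVector D → ∀ j f → F j f Pol.≈ gammaExpansion ℤ-ring (2 ℕ.* j ℕ.+ f) (γ D j f)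
F≈gammaExpansion D hyp j f = Specialization.F-gammaExpansion ℤ⟦t⟧-CR coeff-isHom D j (J-homogenize D hyp j) {v}
  (Ser.trans {(Ser.1# Ser.+ t) Ser.* v} {u Ser.* v} {Ser.1#} (Ser.*-congʳ {v} {Ser.1# Ser.+ t} {u} (Ser.sym {u} {Ser.1# Ser.+ t} u≈1+t)) uv≈1)
  f (γ-vanishes D j f)

open import Data.Nat.Base using (_+_; _*_; _<_)

corollary1p3 : (D : ℕ → ℕ → ℕ) → IsGammaVector D →
    (∀ j f →
    (∀ k → 2 * j + f < 2 * k → γ D j f k ≡ + 0)
    × F j f ≈[ ℤ[t] ] gammaExpansion ℤ-ring (2 * j + f) (γ D j f))
    × (∀ j k r → Σ[ a ∈ ℕ ] A D j k r ≡ + a)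
    × (∀ n → Σ[ C ∈ (ℕ → List ℕ) ]
    𝓕 n ≈[ ℤ[p][t] ] gammaExpansion ℤ[p] n (λ k → map +_ (C k)))
corollary1p3 D hyp =
    (λ j f → γ-vanishes D j f , F≈gammaExpansion D hyp j f)
  , A-natural D
  , λ n → (λ k → map ∣_∣ (C-poly D n k)) ,
      Regroup.regroup ℤ[p][t]-CR eval-isHom constₚ-isHom D (F≈gammaExpansion D hyp) eval-const eval-X n
  where open Inclusion
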